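{- Let $k\ge 3$ and let $\mathbf F$ be a $k$-CNF formula on $n$ variables. There exists a randomized algorithm running in time $O^*\left(s^4\cdot 2^{n-n/k}\right)$ that takes $\mathbf F$ and an integer $s\ge 1$ as input and, if $\mathbf F$ is satisfiable, with probability at least $1-o(1)$ outputs a multiset $S^*\subseteq\Omega_{\mathbf F}$ of size $s$ such that: 1. $\mathrm{sumPD}(S^*)\ge\frac12\left(1-\frac{2}{k+1}\right)\cdot\mathrm{OptSum}(\mathbf F,s)$ if $s\le 3+\left\lfloor\frac{4}{k-1}\right\rfloor$; 2. $\mathrm{sumPD}(S^*)\ge\frac{k-1}{k+3}\left(\frac{1-\frac1s}{1+\frac{k-1}{k+3}\cdot\frac1s}\right)\cdot\mathrm{OptSum}(\mathbf F,s)$ if $s\ge 3+\left\lceil\frac{4}{k-1}\right\rceil$.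
   Context: $\Omega_{\mathbf F}\subseteq\{0,1\}^n$ is the set of satisfying assignments of $\mathbf F$; $d_H$ is Hamming distance. For a multiset $S$ of elements of $\{0,1\}^n$, $\mathrm{sumPD}(S)=\frac12\sum_{z_1,z_2\in S}d_H(z_1,z_2)$ (sum over ordered pairs, counted with multiplicity), and $\mathrm{OptSum}(\mathbf F,s)$ is the maximum of $\mathrm{sumPD}(S)$ over multisets $S$ of $s$ satisfying assignments (counted with multiplicity). A $k$-CNF formula is a conjunction of clauses, each a disjunction of at most $k$ literals; formulas have $n^{O(1)}$ clauses. $k$ is a constant and $O^*$ hides factors polynomial in $n$; $o(1)$ is as $n\to\infty$. -}

module Defs where

open import Data.Bool.Base using (Bool; true; false; if_then_else_; _xor_)
import Data.Bool.Properties as Bool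
open import Data.Fin.Base using (Fin; toℕ)
open import Data.Integer.Base using (+_)
open import Data.List.Base as List
  using (List; []; _∷_; [_]; length; filter; map; cartesianProductWith)
open import Data.List.Membership.Propositional using (_∈_)
open import Data.List.Membership.Propositional.Properties
  using (∈-cartesianProductWith⁺; ∈-cartesianProductWith⁻; ∈-filter⁺; ∈-filter⁻; ∈-map⁺; ∈-map⁻)
import Data.List.Relation.Unary.All as ListAll
open import Data.List.Relation.Unary.All using () renaming (All to AllL)
open import Data.List.Relation.Unary.Any as ListAny using (here; there) renaming (Any to AnyL)
import Data.List.Extrema as Extrema
open import Data.Maybe.Base as Maybe using (Maybe; just; nothing)
open import Data.Maybe.Relation.Unary.Any as MaybeAny using ()
open import Data.Maybe using (Is-just)
open import Data.Nat.Base as ℕ using (ℕ; zero; suc; _∸_; _^_)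
import Data.Nat.Properties as ℕ
open import Data.Nat.ListAction using (sum)
open import Data.Product.Base using (_×_; _,_; ∃-syntax; proj₂)
open import Data.Rational.Base as ℚ using (ℚ; 0ℚ; 1ℚ; ½; _/_; _+_; _-_; _*_; _÷_; _≤_; ∣_∣)
import Data.Rational.Properties as ℚ
open import Data.Sum.Base using (inj₂; [_,_]′)
open import Function.Base using (_∘_)
open import Data.Vec.Base as Vec using (Vec; []; _∷_; lookup; toList; replicate)
open import Data.Vec.Relation.Unary.All as VecAll using ([]; _∷_) renaming (All to AllV)
open import Relation.Binary.PropositionalEquality using (_≡_; refl; sym)
open import Relation.Binary.Bundles using (DecTotalOrder)
open import Relation.Nullary.Decidable using (map′; _×-dec_; _→-dec_)
open import Relation.Unary using (Decidable)

private
  variable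
    A B : Set
    m n : ℕ

tuples : List A → (m : ℕ) → List (Vec A m)
tuples xs zero    = [ [] ]
tuples xs (suc m) = cartesianProductWith _∷_ xs (tuples xs m)

bitVectors : (n : ℕ) → List (Vec Bool n)
bitVectors = tuples (false ∷ true ∷ [])

Assignment : ℕ → Set
Assignment n = Vec Bool n

-- (i , b) is satisfied by z exactly when z assigns b to variable i.
Literal : ℕ → Set
Literal n = Fin n × Bool

Clause : ℕ → Set
Clause n = List (Literal n)

CNF : ℕ → Set
CNF n = List (Clause n)

IsKCNF : ℕ → CNF n → Set
IsKCNF k F = AllL (λ C → length C ℕ.≤ k) F

SatLiteral : Assignment n → Literal n → Set
SatLiteral z (i , b) = lookup z i ≡ b

Sat : CNF n → Assignment n → Set
Sat F z = AllL (AnyL (SatLiteral z)) F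

sat? : (F : CNF n) → Decidable (Sat F)
sat? F z = ListAll.all? (ListAny.any? λ { (i , b) → lookup z i Bool.≟ b }) F

Satisfiable : CNF n → Set
Satisfiable F = ∃[ z ] Sat F z

Ω : CNF n → List (Assignment n)
Ω {n} F = filter (sat? F) (bitVectors n)

d-H : Assignment n → Assignment n → ℕ
d-H []      []      = 0
d-H (x ∷ u) (y ∷ v) = (if x xor y then 1 else 0) ℕ.+ d-H u v

-- A multiset of size s is represented by a vector of length s; nothing below
-- depends on the order of its entries.
sumPD : {s : ℕ} → Vec (Assignment n) s → ℚ
sumPD S = ½ * (+ sum (cartesianProductWith d-H (toList S) (toList S)) / 1)

open Extrema (DecTotalOrder.totalOrder ℚ.≤-decTotalOrder) using (max; v≤max⁺; argmax-sel)

-- The default value 0 matters only when F is unsatisfiable: see OptSum-upper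
-- and OptSum-attained.
OptSum : CNF n → ℕ → ℚ
OptSum F s = max 0ℚ (map sumPD (tuples (Ω F) s))

⌈_/_⌉ : (a b : ℕ) .{{_ : ℕ.NonZero b}} → ℕ
⌈ a / b ⌉ = (a ℕ.+ ℕ.pred b) ℕ./ b

-- For k ≥ 2 the divisor suc (k ∸ 2) is k - 1, and is visibly nonzero.
smallThreshold largeThreshold : ℕ → ℕ
smallThreshold k = 3 ℕ.+ 4 ℕ./ suc (k ∸ 2)
largeThreshold k = 3 ℕ.+ ⌈ 4 / suc (k ∸ 2) ⌉

smallRatio : ℕ → ℚ
smallRatio k = ½ * (1ℚ - + 2 / suc k)

-- (k - 1)/(k + 3)
β : ℕ → ℚ
β k = + (k ∸ 1) / (3 ℕ.+ k)

largeDenominator : (k s : ℕ) .{{_ : ℕ.NonZero s}} → ℚ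
largeDenominator k s = 1ℚ + β k * (+ 1 / s)

largeDenominator≢0 : ∀ k s .{{_ : ℕ.NonZero s}} → ℚ.NonZero (largeDenominator k s)
largeDenominator≢0 k s =
  ℚ.pos⇒nonZero (largeDenominator k s) {{ℚ.pos+nonNeg⇒pos 1ℚ (β k * (+ 1 / s))
    {{ℚ.nonNeg*nonNeg⇒nonNeg (β k) {{ℚ.normalize-nonNeg (k ∸ 1) (3 ℕ.+ k)}}
                             (+ 1 / s) {{ℚ.normalize-nonNeg 1 s}}}}}}

largeRatio : (k s : ℕ) .{{_ : ℕ.NonZero s}} → ℚ
largeRatio k s = β k * ((1ℚ - + 1 / s) ÷ largeDenominator k s) {{largeDenominator≢0 k s}}

record Good (k : ℕ) (F : CNF n) (s : ℕ) .{{_ : ℕ.NonZero s}}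
            (S : Vec (Assignment n) s) : Set where
  constructor good
  field
    satisfying : AllV (Sat F) S
    small      : s ℕ.≤ smallThreshold k → smallRatio k * OptSum F s ≤ sumPD S
    large      : largeThreshold k ℕ.≤ s → largeRatio k s * OptSum F s ≤ sumPD S

good? : ∀ k (F : CNF n) s .{{_ : ℕ.NonZero s}} → Decidable (Good k F s)
good? k F s S = map′ (λ { (a , b , c) → good a b c }) (λ { (good a b c) → a , b , c })
  (VecAll.all? (sat? F) S
    ×-dec ((s ℕ.≤? smallThreshold k) →-dec (_ ℚ.≤? _))
    ×-dec ((largeThreshold k ℕ.≤? s) →-dec (_ ℚ.≤? _)))

-- The machine model is a Turing-complete while-language over binary trees with
-- fair coin flips. Every evaluation of a construct costs one unit. It allocates
-- and inspects at most one cell by itself, so a time unit is a constant number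
-- of operations of a pointer machine or word RAM (trees being shared, not
-- copied).
data Tree : Set where
  leaf : Tree
  node : Tree → Tree → Tree

-- Exp m: expressions with m free variables, as de Bruijn indices.
data Exp : ℕ → Set where
  var   : Fin m → Exp m
  nil   : Exp m
  cons  : Exp m → Exp m → Exp m
  -- case e a b: a if e is a leaf; b if e is a node, whose left child becomes
  -- variable 0 and whose right child becomes variable 1.
  case  : Exp m → Exp m → Exp (2 ℕ.+ m) → Exp m
  bind  : Exp m → Exp (1 ℕ.+ m) → Exp m
  -- call p e: runs the closed procedure p with the value of e as its argument.
  call  : Exp 1 → Exp m → Exp m
  flip  : Exp m
  -- while e g b: x := e; while g(x) is a node do x := b(x); return x.
  while : Exp m → Exp (1 ℕ.+ m) → Exp (1 ℕ.+ m) → Exp m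

Program : Set
Program = Exp 1

-- Consumes coins from a list; returns the value, the remaining coins and the
-- time spent. Fails if the coins or the fuel run out.
Run : Set → Set
Run A = List Bool → Maybe (A × List Bool × ℕ)

return : A → Run A
return a ω = just (a , ω , 0)

infixl 1 _>>=_
_>>=_ : Run A → (A → Run B) → Run B
(r >>= f) ω = r ω Maybe.>>= λ { (a , ω′ , t) →
  Maybe.map (λ { (b , ω″ , u) → b , ω″ , t ℕ.+ u }) (f a ω′) }

tick : Run A → Run A
tick r ω = Maybe.map (λ { (a , ω′ , t) → a , ω′ , suc t }) (r ω)

encodeBit : Bool → Tree
encodeBit false = leaf
encodeBit true  = node leaf leaf

toss : Run Tree
toss []      = nothing
toss (b ∷ ω) = just (encodeBit b , ω , 0)

-- The fuel bounds the number of guard evaluations of each single loop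
-- execution, and nothing else. As these all cost time, fuel T is enough for
-- any evaluation that takes time at most T.
eval : ℕ → Exp m → Vec Tree m → Run Tree
loop : ℕ → ℕ → Exp (1 ℕ.+ m) → Exp (1 ℕ.+ m) → Vec Tree m → Tree → Run Tree

eval f (var i)       ρ = tick (return (lookup ρ i))
eval f nil           ρ = tick (return leaf)
eval f (cons a b)    ρ = tick (eval f a ρ >>= λ u → eval f b ρ >>= λ v → return (node u v))
eval f (case e a b)  ρ = tick (eval f e ρ >>= λ
  { leaf       → eval f a ρ
  ; (node u v) → eval f b (u ∷ v ∷ ρ) })
eval f (bind e b)    ρ = tick (eval f e ρ >>= λ v → eval f b (v ∷ ρ))
eval f (call p e)    ρ = tick (eval f e ρ >>= λ v → eval f p (v ∷ []))
eval f flip          ρ = tick toss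
eval f (while e g b) ρ = tick (eval f e ρ >>= loop f f g b ρ)

loop f zero    g b ρ x = λ _ → nothing
loop f (suc j) g b ρ x = eval f g (x ∷ ρ) >>= λ
  { leaf       → return x
  ; (node _ _) → eval f b (x ∷ ρ) >>= loop f j g b ρ }

-- The output of P on x with coin flips ω, provided P halts within time T.
-- Each flip costs time, so T coins are enough.
run : (T : ℕ) → Program → Tree → Vec Bool T → Maybe Tree
run T P x ω = eval T P (x ∷ []) (toList ω) Maybe.>>= λ
  { (v , _ , t) → if t ℕ.≤ᵇ T then just v else nothing }

HaltsWithin : ℕ → Program → Tree → Set
HaltsWithin T P x = ∀ ω → Is-just (run T P x ω)

Pr : {T : ℕ} {E : Vec Bool T → Set} → Decidable E → ℚ
Pr {T} E? = _/_ (+ length (filter E? (bitVectors T))) (2 ^ T) {{ℕ.m^n≢0 2 T}}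

encodeList : (A → Tree) → List A → Tree
encodeList enc []       = leaf
encodeList enc (x ∷ xs) = node (enc x) (encodeList enc xs)

-- Numbers are written in unary. The running time is measured in terms of n
-- and s themselves, and an output already has s entries.
encodeℕ : ℕ → Tree
encodeℕ zero    = leaf
encodeℕ (suc n) = node leaf (encodeℕ n)

encodeLiteral : Literal n → Tree
encodeLiteral (i , b) = node (encodeBit b) (encodeℕ (toℕ i))

encodeInput : CNF n → ℕ → Tree
encodeInput {n} F s =
  node (encodeℕ n) (node (encodeℕ s) (encodeList (encodeList encodeLiteral) F))

decodeBit : Tree → Maybe Bool
decodeBit leaf             = just false
decodeBit (node leaf leaf) = just true
decodeBit _                = nothing

decodeVec : (Tree → Maybe A) → (m : ℕ) → Tree → Maybe (Vec A m)
decodeVec dec zero    leaf       = just []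
decodeVec dec (suc m) (node t u) = Maybe.zipWith _∷_ (dec t) (decodeVec dec m u)
decodeVec dec _       _          = nothing

decodeOutput : (n s : ℕ) → Tree → Maybe (Vec (Assignment n) s)
decodeOutput n s = decodeVec (decodeVec decodeBit n) s

Success : Program → (k : ℕ) (F : CNF n) (s : ℕ) .{{_ : ℕ.NonZero s}} →
          (T : ℕ) → Vec Bool T → Set
Success {n} P k F s T ω =
  MaybeAny.Any (Good k F s) (run T P (encodeInput F s) ω Maybe.>>= decodeOutput n s)

success? : ∀ P k (F : CNF n) s .{{_ : ℕ.NonZero s}} T → Decidable (Success P k F s T)
success? P k F s T ω = MaybeAny.dec (good? k F s) _

-- Every polynomially bounded function of n is at most poly c for some c.
poly : ℕ → ℕ → ℕ
poly c n = c ℕ.* suc n ^ c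

-- T ≤ poly d n · s⁴ · 2^(n - n/k), raised to the k-th power.
TimeBound : (k d n s T : ℕ) → Set
TimeBound k d n s T = T ^ k ℕ.≤ (poly d n ℕ.* s ^ 4) ^ k ℕ.* 2 ^ ((k ∸ 1) ℕ.* n)

Vanishing : (ℕ → ℚ) → Set
Vanishing δ = ∀ ε → 0ℚ ℚ.< ε → ∃[ N ] ∀ n → N ℕ.≤ n → ∣ δ n ∣ ≤ ε

tuples-complete : {xs : List A} {v : Vec A m} → AllV (_∈ xs) v → v ∈ tuples xs m
tuples-complete []         = here refl
tuples-complete (x∈ ∷ v∈) = ∈-cartesianProductWith⁺ _∷_ x∈ (tuples-complete v∈)

tuples-sound : ∀ (xs : List A) m {v : Vec A m} → v ∈ tuples xs m → AllV (_∈ xs) v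
tuples-sound xs zero    (here refl) = []
tuples-sound xs (suc m) v∈ with ∈-cartesianProductWith⁻ _∷_ xs (tuples xs m) v∈
... | _ , _ , x∈ , w∈ , refl = x∈ ∷ tuples-sound xs m w∈

bitVectors-complete : (v : Vec Bool n) → v ∈ bitVectors n
bitVectors-complete v = tuples-complete (VecAll.universal bit v)
  where
  bit : ∀ b → b ∈ (false ∷ true ∷ [])
  bit false = here refl
  bit true  = there (here refl)

OptSum-upper : ∀ (F : CNF n) {s} (S : Vec (Assignment n) s) →
               AllV (Sat F) S → sumPD S ≤ OptSum F s
OptSum-upper F {s} S sat = v≤max⁺ 0ℚ (map sumPD (tuples (Ω F) s))
  (inj₂ (ListAny.map ℚ.≤-reflexive (∈-map⁺ sumPD (tuples-complete
    (VecAll.map (λ {z} p → ∈-filter⁺ (sat? F) (bitVectors-complete z) p) sat)))))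

sumPD-nonNeg : ∀ {s} (S : Vec (Assignment n) s) → 0ℚ ≤ sumPD S
sumPD-nonNeg S = ℚ.nonNegative⁻¹ (½ * q)
  {{ℚ.nonNeg*nonNeg⇒nonNeg ½ q {{ℚ.normalize-nonNeg total 1}}}}
  where
  total = sum (cartesianProductWith d-H (toList S) (toList S))
  q = + total / 1

OptSum-attained : ∀ (F : CNF n) s → Satisfiable F →
                  ∃[ S ] AllV (Sat F) {n = s} S × sumPD S ≡ OptSum F s
OptSum-attained {n} F s (z , p) = [ zero-case , attained ∘ ∈-map⁻ sumPD ]′
  (argmax-sel (λ q → q) 0ℚ (map sumPD (tuples (Ω F) s)))
  where
  Maximizer = ∃[ S ] AllV (Sat F) {n = s} S × sumPD S ≡ OptSum F s

  all-z : ∀ s → AllV (Sat F) (replicate s z)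
  all-z zero    = []
  all-z (suc s) = p ∷ all-z s

  zero-case : OptSum F s ≡ 0ℚ → Maximizer
  zero-case eq = replicate s z , all-z s , ℚ.≤-antisym (OptSum-upper F _ (all-z s))
    (ℚ.≤-trans (ℚ.≤-reflexive eq) (sumPD-nonNeg (replicate s z)))

  attained : (∃[ S ] S ∈ tuples (Ω F) s × OptSum F s ≡ sumPD S) → Maximizer
  attained (S , S∈ , eq) =
    S , VecAll.map (λ z∈ → proj₂ (∈-filter⁻ (sat? F) {xs = bitVectors n} z∈))
                   (tuples-sound (Ω F) s S∈)
      , sym eq

{-# OPTIONS --safe #-}

-- The algorithm is deterministic and succeeds with certainty. It first collects
-- a set C of satisfying assignments, independently of s, such that
--   (k - 1) Σ_{y ∈ R} d(x,y) ≤ (k + 1) Σ_{y ∈ R} d(z,y)  for some z ∈ C,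
-- for every satisfying x and every multiset R; then it runs a best-response
-- local search from s copies of one element of C, replacing one member at a time.
--
-- C comes from the local search for k-SAT around the words of a covering code:
-- flipping the k literals of a falsified clause, repeatedly, leads from a centre
-- c at distance ρ from x in k^ρ branches to a satisfying z which agrees with x
-- wherever c does. Replacing x by z thus loses at most the contribution of the
-- coordinates where c and x differ. A random error pattern of relative weight
-- about 1/(k + 1) loses that fraction on average. To have this deterministically,
-- the code is a product of copies of one code on blocks of constant length b,
-- and all rotations and translations of the block code are tried, the same in
-- every block: averaged over them, each coordinate is wrong with probability
-- r/b ≤ 2/(k + 1). The block code is found greedily, and its cost |K| k^r is
-- about (2k/(k + 1))^b, below 2^(b - b/k) for large b because (1 + 1/k)^k > 2.
--
-- At a local optimum S, comparing with an optimal O for all exchanges bounds the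
-- cross distances between O and S by those within S. The triangle inequality
-- gives the first ratio, and the negative type of the Hamming metric the second.

module Submission where

open import Defs
open import Data.List.Base using (length)
open import Data.Nat.Base using (ℕ; NonZero; _≤_)
open import Data.Product.Base using (Σ-syntax; _×_)
open import Data.Rational.Base as ℚ using (ℚ; 1ℚ)

-- The exponential part of a best response is its scan of the candidates. Since `C` serves every
-- multiset `R` at once, `s` enters only through the number of scans, about n s³, and through the
-- size of the multiset against which each candidate is measured. Hence s⁴. The program is fixed
-- before `n`, and constructing a covering code for length `n` would itself take time. With a block
-- length that depends on `k` alone, the code is a literal of the program, and trying its b 2^b
-- transforms is a constant factor. The price is that any loss on one block is raised to the power
-- n/b. The factor of order (b + 1)² from the greedy choice and from the choice of the radius is
-- paid inside each block, by the gap between (1 + 1/k)^k and 2. The admissible loss 2/(k + 1) is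
-- twice the mean relative weight 1/(k + 1), so a first-moment argument finds the radius without
-- estimates of binomial coefficients. Inequalities between ratios are multiplied out over the
-- natural numbers, and 2^(n - n/k) is handled through its k-th power.

module Fractions where

  import Data.Integer.Base as ℤ
  import Data.Integer.Properties as ℤ
  open import Data.Integer.Base using (+_)
  open import Data.Nat.Base as ℕ using (ℕ; zero; suc; NonZero; _∸_)
  import Data.Nat.Properties as ℕ
  open import Data.Rational.Base as ℚ using (ℚ; 0ℚ; 1ℚ; ½; _/_; _+_; _-_; _*_; _÷_; toℚᵘ; 1/_)
  import Data.Rational.Properties as ℚ
  open import Data.Rational.Solver using (module +-*-Solver)
  open import Data.Rational.Unnormalised.Base as ℚᵘ using (mkℚᵘ; *≡*; *≤*)
  import Data.Rational.Unnormalised.Properties as ℚᵘ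
  open import Relation.Binary.PropositionalEquality

  open +-*-Solver

  -- The ratios of the statement, cleared of denominators

  ι : ℕ → ℚ
  ι n = + n / 1

  toℚᵘ-/ : ∀ a d → toℚᵘ (+ a / suc d) ℚᵘ.≃ mkℚᵘ (+ a) d
  toℚᵘ-/ a d = ℚ.toℚᵘ-fromℚᵘ (mkℚᵘ (+ a) d)

  ι-* : ∀ a b → ι a * ι b ≡ ι (a ℕ.* b)
  ι-* a b = ℚ.toℚᵘ-injective (ℚᵘ.≃-trans (ℚ.toℚᵘ-homo-* (ι a) (ι b))
    (ℚᵘ.≃-trans (ℚᵘ.*-cong (toℚᵘ-/ a 0) (toℚᵘ-/ b 0))
      (ℚᵘ.≃-trans (*≡* (cong (ℤ._* (+ 1)) (sym (ℤ.pos-* a b)))) (ℚᵘ.≃-sym (toℚᵘ-/ (a ℕ.* b) 0)))))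

  ι-+ : ∀ a b → ι a + ι b ≡ ι (a ℕ.+ b)
  ι-+ a b = ℚ.toℚᵘ-injective (ℚᵘ.≃-trans (ℚ.toℚᵘ-homo-+ (ι a) (ι b))
    (ℚᵘ.≃-trans (ℚᵘ.+-cong (toℚᵘ-/ a 0) (toℚᵘ-/ b 0))
      (ℚᵘ.≃-trans (*≡* (cong (ℤ._* (+ 1)) (trans (cong₂ ℤ._+_ (ℤ.*-identityʳ (+ a)) (ℤ.*-identityʳ (+ b))) (sym (ℤ.pos-+ a b)))))
        (ℚᵘ.≃-sym (toℚᵘ-/ (a ℕ.+ b) 0)))))

  ι-mono : ∀ {a b} → a ℕ.≤ b → ι a ℚ.≤ ι b
  ι-mono {a} {b} le = ℚ.toℚᵘ-cancel-≤ (ℚᵘ.≤-respˡ-≃ (ℚᵘ.≃-sym (toℚᵘ-/ a 0)) (ℚᵘ.≤-respʳ-≃ (ℚᵘ.≃-sym (toℚᵘ-/ b 0))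
    (*≤* (ℤ.*-monoʳ-≤-nonNeg (+ 1) (ℤ.+≤+ le)))))

  ι-/ : ∀ a d .{{_ : NonZero d}} → ι d * (+ a / d) ≡ ι a
  ι-/ a (suc d) = ℚ.toℚᵘ-injective (ℚᵘ.≃-trans (ℚ.toℚᵘ-homo-* (ι (suc d)) (+ a / suc d))
    (ℚᵘ.≃-trans (ℚᵘ.*-cong (toℚᵘ-/ (suc d) 0) (toℚᵘ-/ a d))
      (ℚᵘ.≃-trans (*≡* (trans (ℤ.*-identityʳ _) (trans (ℤ.*-comm (+ suc d) (+ a)) (cong (λ x → + a ℤ.* + suc x) (sym (ℕ.+-identityʳ d))))))
        (ℚᵘ.≃-sym (toℚᵘ-/ a 0)))))

  ι-positive : ∀ c .{{_ : NonZero c}} → ℚ.Positive (ι c)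
  ι-positive c = ℚ.normalize-pos c 1

  n/n≡1 : ∀ d .{{_ : NonZero d}} → + d / d ≡ 1ℚ
  n/n≡1 (suc d) = ℚ.toℚᵘ-injective (ℚᵘ.≃-trans (toℚᵘ-/ (suc d) d) (*≡* (ℤ.*-comm (+ suc d) (+ 1))))

  -- The bridge from the rationals of the statement to the natural numbers in which the bounds are
  -- proved. A ratio enters only through `a` and `c`; the factor ½ is that of `sumPD`.
  scale-≤ : ∀ {ratio a c o p} .{{_ : NonZero c}} → ι c * ratio ≡ ι a → a ℕ.* o ℕ.≤ c ℕ.* p → ratio * (½ * ι o) ℚ.≤ ½ * ι p
  scale-≤ {ratio} {a} {c} {o} {p} eq le = ℚ.*-cancelˡ-≤-pos (ι c) {{ι-positive c}} (begin
    ι c * (ratio * (½ * ι o)) ≡⟨ solve 4 (λ c r h o → c :* (r :* (h :* o)) := h :* (c :* r :* o)) refl (ι c) ratio ½ (ι o) ⟩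
    ½ * (ι c * ratio * ι o) ≡⟨ cong (λ x → ½ * (x * ι o)) eq ⟩
    ½ * (ι a * ι o) ≡⟨ cong (½ *_) (ι-* a o) ⟩
    ½ * ι (a ℕ.* o) ≤⟨ ℚ.*-monoˡ-≤-nonNeg ½ (ι-mono le) ⟩
    ½ * ι (c ℕ.* p) ≡⟨ cong (½ *_) (sym (ι-* c p)) ⟩
    ½ * (ι c * ι p) ≡⟨ solve 3 (λ h c p → h :* (c :* p) := c :* (h :* p)) refl ½ (ι c) (ι p) ⟩
    ι c * (½ * ι p) ∎)
    where open ℚ.≤-Reasoning

  module _ (h : ℕ) where

    open ≡-Reasoning

    -- Here `h` is k - 1, and 1 - 2/(k + 1) = h/(h + 2).
    smallRatio-eq : ι (2 ℕ.* suc (suc h)) * smallRatio (suc h) ≡ ι h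
    smallRatio-eq = begin
      ι (2 ℕ.* suc (suc h)) * (½ * (1ℚ - x)) ≡⟨ cong (_* (½ * (1ℚ - x))) (sym (ι-* 2 (suc (suc h)))) ⟩
      ι 2 * ι (suc (suc h)) * (½ * (1ℚ - x)) ≡⟨ solve 5 (λ t m h o x → t :* m :* (h :* (o :- x)) := t :* h :* (m :* o :- m :* x)) refl (ι 2) (ι (suc (suc h))) ½ 1ℚ x ⟩
      ι 2 * ½ * (ι (suc (suc h)) * 1ℚ - ι (suc (suc h)) * x) ≡⟨ cong₂ (λ u v → u * (v - ι (suc (suc h)) * x)) {ι 2 * ½} {1ℚ} refl (ℚ.*-identityʳ (ι (suc (suc h)))) ⟩
      1ℚ * (ι (suc (suc h)) - ι (suc (suc h)) * x) ≡⟨ ℚ.*-identityˡ _ ⟩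
      ι (suc (suc h)) - ι (suc (suc h)) * x ≡⟨ cong₂ _-_ (sym (ι-+ 2 h)) (ι-/ 2 (suc (suc h))) ⟩
      ι 2 + ι h - ι 2 ≡⟨ solve 2 (λ a b → a :+ b :- a := b) refl (ι 2) (ι h) ⟩
      ι h ∎
      where
      x : ℚ
      x = + 2 / suc (suc h)

    -- The multiset has `suc s` elements. Expanding numerator and denominator by (h + 4)(s + 1)
    -- gives h s over (s + 1)(h + 4) + h.
    largeRatio-eq : ∀ s → ι (suc s ℕ.* (4 ℕ.+ h) ℕ.+ h) * largeRatio (suc h) (suc s) ≡ ι (h ℕ.* s)
    largeRatio-eq s = begin
      ι (suc s ℕ.* (4 ℕ.+ h) ℕ.+ h) * (b * ((1ℚ - y) * i)) ≡⟨ cong (_* (b * ((1ℚ - y) * i))) denominator ⟩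
      ι (suc s) * ι (4 ℕ.+ h) * L * (b * ((1ℚ - y) * i)) ≡⟨ solve 7 (λ s m l b o y i → s :* m :* l :* (b :* ((o :- y) :* i)) := (m :* b) :* (s :* o :- s :* y) :* (l :* i)) refl (ι (suc s)) (ι (4 ℕ.+ h)) L b 1ℚ y i ⟩
      ι (4 ℕ.+ h) * b * (ι (suc s) * 1ℚ - ι (suc s) * y) * (L * i) ≡⟨ cong₂ _*_ (cong₂ _*_ (ι-/ h (4 ℕ.+ h)) (cong₂ _-_ (trans (ℚ.*-identityʳ (ι (suc s))) (sym (ι-+ 1 s))) (ι-/ 1 (suc s)))) (ℚ.*-inverseʳ L {{largeDenominator≢0 (suc h) (suc s)}}) ⟩
      ι h * (ι 1 + ι s - ι 1) * 1ℚ ≡⟨ trans (ℚ.*-identityʳ _) (cong (ι h *_) (solve 2 (λ a b → a :+ b :- a := b) refl (ι 1) (ι s))) ⟩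
      ι h * ι s ≡⟨ ι-* h s ⟩
      ι (h ℕ.* s) ∎
      where
      y b L i : ℚ
      y = + 1 / suc s
      b = β (suc h)
      L = largeDenominator (suc h) (suc s)
      i = (1/ L) {{largeDenominator≢0 (suc h) (suc s)}}
      denominator : ι (suc s ℕ.* (4 ℕ.+ h) ℕ.+ h) ≡ ι (suc s) * ι (4 ℕ.+ h) * L
      denominator = begin
        ι (suc s ℕ.* (4 ℕ.+ h) ℕ.+ h) ≡⟨ sym (trans (cong (_+ ι h) (ι-* (suc s) (4 ℕ.+ h))) (ι-+ (suc s ℕ.* (4 ℕ.+ h)) h)) ⟩
        ι (suc s) * ι (4 ℕ.+ h) + ι h ≡⟨ cong (λ x → ι (suc s) * ι (4 ℕ.+ h) + x) (sym (trans (cong₂ _*_ (ι-/ h (4 ℕ.+ h)) (ι-/ 1 (suc s))) (ℚ.*-identityʳ (ι h)))) ⟩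
        ι (suc s) * ι (4 ℕ.+ h) + ι (4 ℕ.+ h) * b * (ι (suc s) * y) ≡⟨ solve 4 (λ s m b y → s :* m :+ m :* b :* (s :* y) := s :* m :* (con 1ℚ :+ b :* y)) refl (ι (suc s)) (ι (4 ℕ.+ h)) b y ⟩
        ι (suc s) * ι (4 ℕ.+ h) * (1ℚ + b * y) ∎

open Fractions

open import Data.Bool.Base using (Bool; true; false; T; if_then_else_; _xor_)
import Data.Bool.Properties as Bool
open import Data.Fin using (#_)
open import Data.Fin.Base as Fin using (Fin; toℕ; fromℕ<)
open import Data.Fin.Patterns
open import Data.Fin.Properties using (toℕ-injective; toℕ-fromℕ<; fromℕ<-cong; toℕ<n)
import Data.Integer.Base as ℤ
open import Data.List.Base
  using (List; []; _∷_; foldl; replicate; map; _++_; _∷ʳ_; _ʳ++_; reverse; drop; cartesianProductWith; upTo)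
open import Data.List.Membership.Propositional using (_∈_; find)
open import Data.List.Membership.Propositional.Properties
  using (∈-map⁺; ∈-cartesianProductWith⁺; ∈-cartesianProductWith⁻; ∈-upTo⁺; ∈-∃++)
open import Data.List.Properties
  using (length-replicate; length-reverse; length-ʳ++; length-++; length-map; length-upTo; reverse-involutive; ʳ++-defn;
         ++-assoc; ++-identityʳ; filter-all)
open import Data.List.Relation.Unary.All as All using (All; []; _∷_)
open import Data.List.Relation.Unary.All.Properties using (∷ʳ⁺)
open import Data.List.Relation.Unary.Any using (Any; here; there)
open import Data.Maybe as Maybe using (Maybe; just; nothing; Is-just)
import Data.Maybe.Relation.Unary.Any as MaybeAny
open import Data.Nat.Base as ℕ hiding (ℕ; NonZero; _≤_; _/_)
open import Data.Nat.DivMod using (m≡m%n+[m/n]*n; m%n<n; m/n*n≤m; [m+n]%n≡m%n; m<n⇒m%n≡m)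
open import Data.Nat.ListAction using (sum)
open import Data.Nat.ListAction.Properties using (sum-++)
open import Data.Nat.Properties
open import Algebra.Properties.CommutativeSemigroup +-commutativeSemigroup using (interchange; x∙yz≈y∙xz)
open import Data.Nat.Solver using (module +-*-Solver)
open import Data.Product.Base using (∃-syntax; _,_; proj₁; proj₂)
open import Data.Rational.Base using (0ℚ; _/_)
import Data.Rational.Properties as ℚ
open import Data.Sum.Base using (_⊎_; inj₁; inj₂; map₁)
open import Data.Unit.Base using (⊤; tt)
open import Data.Vec.Base as Vec using (Vec; []; _∷_; toList; zipWith; lookup; tabulate; _[_]≔_)
open import Data.Vec.Properties using (length-toList; toList-++; tabulate-cong; tabulate∘lookup; take++drop≡id)
open import Data.Vec.Relation.Unary.All as VecAll using ([]; _∷_)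
open import Function.Base using (it; _∘_)
open import Function.Bundles using (Equivalence)
open import Relation.Binary.PropositionalEquality
open import Relation.Nullary using (¬_; yes; no; contradiction)
open import Relation.Nullary.Decidable.Core using (does)
open import Relation.Unary using (Decidable)

open +-*-Solver using (solve; con; _:+_; _:*_; _:=_)

private variable
  m n : ℕ
  A B : Set
  ρ : Vec Tree m
  e e₁ e₂ : Exp m
  v v₁ v₂ : Tree
  i j k t t₁ t₂ u w : ℕ

-- Costs of programs

-- An upper bound `t` on the time doubles as a bound on the fuel that suffices. The coins come back
-- untouched: the judgement describes evaluations that never flip.
record Eval (ρ : Vec Tree m) (e : Exp m) (v : Tree) (t : ℕ) : Set where
  constructor mkEval
  field
    evals : ∀ f ω → t ≤ f → ∃[ t′ ] t′ ≤ t × eval f e ρ ω ≡ just (v , ω , t′)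
open Eval public

relax : t₁ ≤ t₂ → Eval ρ e v t₁ → Eval ρ e v t₂
relax le p .evals f ω h with t′ , b , eq ← evals p f ω (≤-trans le h) = t′ , ≤-trans b le , eq

raw-var : ∀ i → Eval ρ (var i) (lookup ρ i) 1
raw-var i .evals f ω h = 1 , ≤-refl , refl

raw-nil : Eval ρ nil leaf 1
raw-nil .evals f ω h = 1 , ≤-refl , refl

raw-cons : Eval ρ e₁ v₁ t₁ → Eval ρ e₂ v₂ t₂ → Eval ρ (cons e₁ e₂) (node v₁ v₂) (suc (t₁ + t₂))
raw-cons {t₁ = t₁} {t₂ = t₂} p q .evals f ω h
  with t₁′ , b₁ , eq₁ ← evals p f ω (≤-trans (m≤m+n t₁ t₂) (<⇒≤ h))
  with t₂′ , b₂ , eq₂ ← evals q f ω (≤-trans (m≤n+m t₂ t₁) (<⇒≤ h))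
  rewrite eq₁ | eq₂ = _ , s≤s (+-mono-≤ b₁ (≤-trans (≤-reflexive (+-identityʳ t₂′)) b₂)) , refl

raw-caseL : ∀ {b} → Eval ρ e leaf t₁ → Eval ρ e₁ v t₂ → Eval ρ (case e e₁ b) v (suc (t₁ + t₂))
raw-caseL {t₁ = t₁} {t₂ = t₂} p q .evals f ω h
  with t₁′ , b₁ , eq₁ ← evals p f ω (≤-trans (m≤m+n t₁ t₂) (<⇒≤ h))
  with t₂′ , b₂ , eq₂ ← evals q f ω (≤-trans (m≤n+m t₂ t₁) (<⇒≤ h))
  rewrite eq₁ | eq₂ = _ , s≤s (+-mono-≤ b₁ b₂) , refl

raw-caseN : ∀ {b} → Eval ρ e (node v₁ v₂) t₁ → Eval (v₁ ∷ v₂ ∷ ρ) b v t₂ →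
            Eval ρ (case e e₁ b) v (suc (t₁ + t₂))
raw-caseN {t₁ = t₁} {t₂ = t₂} p q .evals f ω h
  with t₁′ , b₁ , eq₁ ← evals p f ω (≤-trans (m≤m+n t₁ t₂) (<⇒≤ h))
  with t₂′ , b₂ , eq₂ ← evals q f ω (≤-trans (m≤n+m t₂ t₁) (<⇒≤ h))
  rewrite eq₁ | eq₂ = _ , s≤s (+-mono-≤ b₁ b₂) , refl

raw-bind : ∀ {b} → Eval ρ e v₁ t₁ → Eval (v₁ ∷ ρ) b v t₂ → Eval ρ (bind e b) v (suc (t₁ + t₂))
raw-bind {t₁ = t₁} {t₂ = t₂} p q .evals f ω h
  with t₁′ , b₁ , eq₁ ← evals p f ω (≤-trans (m≤m+n t₁ t₂) (<⇒≤ h))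
  with t₂′ , b₂ , eq₂ ← evals q f ω (≤-trans (m≤n+m t₂ t₁) (<⇒≤ h))
  rewrite eq₁ | eq₂ = _ , s≤s (+-mono-≤ b₁ b₂) , refl

raw-call : ∀ {p} → Eval ρ e v₁ t₁ → Eval (v₁ ∷ []) p v t₂ → Eval ρ (call p e) v (suc (t₁ + t₂))
raw-call {t₁ = t₁} {t₂ = t₂} p q .evals f ω h
  with t₁′ , b₁ , eq₁ ← evals p f ω (≤-trans (m≤m+n t₁ t₂) (<⇒≤ h))
  with t₂′ , b₂ , eq₂ ← evals q f ω (≤-trans (m≤n+m t₂ t₁) (<⇒≤ h))
  rewrite eq₁ | eq₂ = _ , s≤s (+-mono-≤ b₁ b₂) , refl

record Loop (ρ : Vec Tree m) (g b : Exp (suc m)) (x v : Tree) (t : ℕ) : Set where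
  field
    loops : ∀ f j ω → t ≤ f → t ≤ j → ∃[ t′ ] t′ ≤ t × loop f j g b ρ x ω ≡ just (v , ω , t′)
open Loop

-- The extra unit pays for the counter `j`: `loop` adds no tick of its own, but each guard
-- evaluation uses up one of the `j` permitted ones.
loop-done : ∀ {g b : Exp (suc m)} {x} → Eval (x ∷ ρ) g leaf t → Loop ρ g b x x (suc t)
loop-done p .loops f (suc j) ω h (s≤s h′)
  with t′ , b , eq ← evals p f ω (<⇒≤ h)
  rewrite eq = _ , ≤-trans (≤-reflexive (+-identityʳ t′)) (m≤n⇒m≤1+n b) , refl

loop-step : ∀ {g b : Exp (suc m)} {x y z} →
            Eval (x ∷ ρ) g (node v₁ v₂) t → Eval (x ∷ ρ) b y t₁ → Loop ρ g b y z t₂ →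
            Loop ρ g b x z (suc (t + (t₁ + t₂)))
loop-step {t = t} {t₁ = t₁} {t₂ = t₂} p q l .loops f (suc j) ω h (s≤s h′)
  with t′ , b , eq ← evals p f ω (≤-trans (m≤m+n t _) (<⇒≤ h))
  with t₁′ , b₁ , eq₁ ← evals q f ω (≤-trans (m≤m+n t₁ t₂) (≤-trans (m≤n+m _ t) (<⇒≤ h)))
  with t₂′ , b₂ , eq₂ ← loops l f j ω (≤-trans (m≤n+m t₂ t₁) (≤-trans (m≤n+m _ t) (<⇒≤ h)))
                                      (≤-trans (m≤n+m t₂ t₁) (≤-trans (m≤n+m _ t) h′))
  rewrite eq | eq₁ | eq₂ = _ , m≤n⇒m≤1+n (+-mono-≤ b (+-mono-≤ b₁ b₂)) , refl

raw-while : ∀ {g b : Exp (suc m)} {x} → Eval ρ e x t₁ → Loop ρ g b x v t₂ →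
            Eval ρ (while e g b) v (suc (t₁ + t₂))
raw-while {t₁ = t₁} {t₂ = t₂} p l .evals f ω h
  with t₁′ , b₁ , eq₁ ← evals p f ω (≤-trans (m≤m+n t₁ t₂) (<⇒≤ h))
  with t₂′ , b₂ , eq₂ ← loops l f f ω (≤-trans (m≤n+m t₂ t₁) (<⇒≤ h)) (≤-trans (m≤n+m t₂ t₁) (<⇒≤ h))
  rewrite eq₁ | eq₂ = _ , s≤s (+-mono-≤ b₁ b₂) , refl

-- A cost is written a * u for a numeral a and a unit u, so that the numerals
-- of a composite expression are computed by unification.

unit-step : ∀ {{_ : NonZero u}} i → suc (i * u) ≤ suc i * u
unit-step {u} i = +-monoˡ-≤ (i * u) (>-nonZero⁻¹ u)

unit-step₂ : ∀ {{_ : NonZero u}} i j → suc (i * u + j * u) ≤ suc (i + j) * u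
unit-step₂ {u} i j rewrite sym (*-distribʳ-+ u i j) = unit-step (i + j)

record EvalIn (u : ℕ) (ρ : Vec Tree m) (e : Exp m) (v : Tree) (a : ℕ) : Set where
  constructor in-units
  field
    raw : Eval ρ e v (a * u)
open EvalIn public

eval-value : v₁ ≡ v₂ → EvalIn u ρ e v₁ i → EvalIn u ρ e v₂ i
eval-value refl p = p

-- Rounds a numeral up to a legible one; the comparison is settled by computation.
≤-coeff : ∀ {{_ : T (i ≤ᵇ j)}} → EvalIn u ρ e v i → EvalIn u ρ e v j
≤-coeff {i} {j} {u = u} {{le}} (in-units p) = in-units (relax (*-monoˡ-≤ u (≤ᵇ⇒≤ i j le)) p)

module _ {u : ℕ} {{_ : NonZero u}} where

  one-unit : 1 ≤ 1 * u
  one-unit = ≤-trans (>-nonZero⁻¹ u) (≤-reflexive (sym (*-identityˡ u)))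

  eval-var : ∀ i → EvalIn u ρ (var i) (lookup ρ i) 1
  eval-var i = in-units (relax one-unit (raw-var i))

  eval-nil : EvalIn u ρ nil leaf 1
  eval-nil = in-units (relax one-unit raw-nil)

  eval-cons : EvalIn u ρ e₁ v₁ i → EvalIn u ρ e₂ v₂ j → EvalIn u ρ (cons e₁ e₂) (node v₁ v₂) (suc (i + j))
  eval-cons {i = i} {j = j} (in-units p) (in-units q) = in-units (relax (unit-step₂ i j) (raw-cons p q))

  eval-caseL : ∀ {b} → EvalIn u ρ e leaf i → EvalIn u ρ e₁ v j → EvalIn u ρ (case e e₁ b) v (suc (i + j))
  eval-caseL {i = i} {j = j} (in-units p) (in-units q) = in-units (relax (unit-step₂ i j) (raw-caseL p q))

  eval-caseN : ∀ {b} → EvalIn u ρ e (node v₁ v₂) i → EvalIn u (v₁ ∷ v₂ ∷ ρ) b v j →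
               EvalIn u ρ (case e e₁ b) v (suc (i + j))
  eval-caseN {i = i} {j = j} (in-units p) (in-units q) = in-units (relax (unit-step₂ i j) (raw-caseN p q))

  eval-bind : ∀ {b} → EvalIn u ρ e v₁ i → EvalIn u (v₁ ∷ ρ) b v j → EvalIn u ρ (bind e b) v (suc (i + j))
  eval-bind {i = i} {j = j} (in-units p) (in-units q) = in-units (relax (unit-step₂ i j) (raw-bind p q))

  eval-call : ∀ {p} → EvalIn u ρ e v₁ i → EvalIn u (v₁ ∷ []) p v j → EvalIn u ρ (call p e) v (suc (i + j))
  eval-call {i = i} {j = j} (in-units p) (in-units q) = in-units (relax (unit-step₂ i j) (raw-call p q))

-- foldE l a b: the body b sees the current element as variable 0, the
-- accumulator as variable 3, and the ambient variables shifted by 5.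
foldE : Exp m → Exp m → Exp (5 + m) → Exp m
foldE l a b = case (while (cons l a) (case (var 0F) nil (var 0F))
                          (case (var 0F) nil (case (var 0F) nil (cons (var 1F) b))))
                   nil (var 1F)

-- The invariant sees the rest of the list. A growing state can thus be bounded by its size times
-- the growth still to come.
module _ {A St : Set} (enc : A → Tree) (encS : St → Tree) (step : St → A → St)
         (I : List A → St → Set) {ρ : Vec Tree m} {b : Exp (5 + m)} {c : ℕ}
         (body : ∀ x xs st → I (x ∷ xs) st → I xs (step st x) ×
                 (∀ t l y → Eval (enc x ∷ t ∷ l ∷ encS st ∷ y ∷ ρ) b (encS (step st x)) c)) where

  fold-loop : ∀ xs st → I xs st →
    Loop ρ (case (var 0F) nil (var 0F)) (case (var 0F) nil (case (var 0F) nil (cons (var 1F) b)))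
         (node (encodeList enc xs) (encS st)) (node leaf (encS (foldl step st xs))) (4 + length xs * (10 + c))
  fold-loop [] st inv = loop-done (raw-caseN (raw-var 0F) (raw-var 0F))
  fold-loop (x ∷ xs) st inv with inv′ , ev ← body x xs st inv =
    subst (Loop _ _ _ _ _) (arith c (length xs * (10 + c)))
      (loop-step (raw-caseN (raw-var 0F) (raw-var 0F))
                 (raw-caseN (raw-var 0F) (raw-caseN (raw-var 0F) (raw-cons (raw-var 1F) (ev _ _ _))))
                 (fold-loop xs (step st x) inv′))
    where
    arith : ∀ c y → suc (3 + (suc (1 + suc (1 + suc (1 + c))) + (4 + y))) ≡ 4 + (10 + c + y)
    arith = solve 2 (λ c y → con 1 :+ (con 3 :+ (con 6 :+ c :+ (con 4 :+ y))) := con 4 :+ (con 10 :+ c :+ y)) refl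

  raw-fold : ∀ xs st → I xs st → ∀ {la aa : Exp m} → Eval ρ la (encodeList enc xs) t₁ → Eval ρ aa (encS st) t₂ →
             Eval ρ (foldE la aa b) (encS (foldl step st xs)) (8 + (t₁ + t₂) + length xs * (10 + c))
  raw-fold {t₁ = t₁} {t₂ = t₂} xs st inv p q =
    subst (Eval ρ _ _) (arith (t₁ + t₂) (length xs * (10 + c)))
      (raw-caseN (raw-while (raw-cons p q) (fold-loop xs st inv)) (raw-var 1F))
    where
    arith : ∀ c y → suc (suc (suc c + (4 + y)) + 1) ≡ 8 + c + y
    arith = solve 2 (λ c y → con 1 :+ (con 1 :+ (con 1 :+ c :+ (con 4 :+ y)) :+ con 1) := con 8 :+ c :+ y) refl

module _ {A St : Set} (w : ℕ) {{_ : NonZero w}} (enc : A → Tree) (encS : St → Tree) (step : St → A → St)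
         (I : List A → St → Set) {ρ : Vec Tree m} {b : Exp (5 + m)} {u a : ℕ} {{_ : NonZero u}}
         (body : ∀ x xs st → I (x ∷ xs) st → I xs (step st x) ×
                 (∀ t l y → EvalIn w (enc x ∷ t ∷ l ∷ encS st ∷ y ∷ ρ) b (encS (step st x)) a)) where

  -- Nested loops multiply units but only add numerals: the length of the list goes into the unit
  -- `u`, so the numeral depends on the program text alone. The 18 collects 8 for the loop as a
  -- whole and 10 per element.
  eval-fold : ∀ {la aa : Exp m} xs st → I xs st → length xs * w ≤ u →
              EvalIn u ρ la (encodeList enc xs) i → EvalIn u ρ aa (encS st) j →
              EvalIn u ρ (foldE la aa b) (encS (foldl step st xs)) (18 + (i + j) + a)
  eval-fold {i = i} {j = j} xs st inv le (in-units p) (in-units q) =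
    in-units (relax bound (raw-fold enc encS step I
      (λ x xs st inv → proj₁ (body x xs st inv) , λ t l y → raw (proj₂ (body x xs st inv) t l y))
      xs st inv p q))
    where
    open ≤-Reasoning
    L = length xs
    bound : 8 + (i * u + j * u) + L * (10 + a * w) ≤ (18 + (i + j) + a) * u
    bound = begin
      8 + (i * u + j * u) + L * (10 + a * w) ≤⟨ +-mono-≤ (+-monoˡ-≤ (i * u + j * u) (m≤m*n 8 u)) (*-monoʳ-≤ L (+-monoˡ-≤ (a * w) (m≤m*n 10 w))) ⟩
      8 * u + (i * u + j * u) + L * (10 * w + a * w) ≡⟨ solve 6 (λ i j u L a w → con 8 :* u :+ (i :* u :+ j :* u) :+ L :* (con 10 :* w :+ a :* w) := (con 8 :+ (i :+ j)) :* u :+ (con 10 :+ a) :* (L :* w)) refl i j u L a w ⟩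
      (8 + (i + j)) * u + (10 + a) * (L * w) ≤⟨ +-monoʳ-≤ ((8 + (i + j)) * u) (*-monoʳ-≤ (10 + a) le) ⟩
      (8 + (i + j)) * u + (10 + a) * u ≡⟨ solve 4 (λ i j u a → (con 8 :+ (i :+ j)) :* u :+ (con 10 :+ a) :* u := (con 18 :+ (i :+ j) :+ a) :* u) refl i j u a ⟩
      (18 + (i + j) + a) * u ∎

-- The program

times : ℕ → (A → A) → A → A
times zero    f x = x
times (suc n) f x = times n f (f x)

encodeℕ-replicate : ∀ n → encodeList (λ (_ : ⊤) → leaf) (replicate n tt) ≡ encodeℕ n
encodeℕ-replicate zero    = refl
encodeℕ-replicate (suc n) = cong (node leaf) (encodeℕ-replicate n)

foldl-replicate : ∀ n (f : A → A) x → foldl (λ a _ → f a) x (replicate n tt) ≡ times n f x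
foldl-replicate zero    f x = refl
foldl-replicate (suc n) f x = foldl-replicate n f (f x)

module _ {St : Set} (w : ℕ) {{_ : NonZero w}} (encS : St → Tree) (step : St → St) (I : ℕ → St → Set)
         {ρ : Vec Tree m} {b : Exp (5 + m)} {u a : ℕ} {{_ : NonZero u}}
         (body : ∀ n st → I (suc n) st → I n (step st) ×
                 (∀ h t l y → EvalIn w (h ∷ t ∷ l ∷ encS st ∷ y ∷ ρ) b (encS (step st)) a)) where

  -- A unary number is a list of leaves, so a counting loop is a fold. The invariant is indexed by
  -- the iterations still to come.
  eval-times : ∀ {la aa : Exp m} n st → I n st → n * w ≤ u →
               EvalIn u ρ la (encodeℕ n) i → EvalIn u ρ aa (encS st) j →
               EvalIn u ρ (foldE la aa b) (encS (times n step st)) (18 + (i + j) + a)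
  eval-times n st inv le p q =
    eval-value (cong encS (foldl-replicate n step st))
      (eval-fold w (λ (_ : ⊤) → leaf) encS (λ st _ → step st) (λ xs → I (length xs))
        (λ _ xs st inv → proj₁ (body (length xs) st inv) , proj₂ (body (length xs) st inv) leaf)
        (replicate n tt) st (subst (λ l → I l st) (sym (length-replicate n)) inv)
        (subst (λ l → l * w ≤ u) (sym (length-replicate n)) le)
        (eval-value (sym (encodeℕ-replicate n)) p) q)

eval-if : ∀ {{_ : NonZero u}} (V : Bool → Tree) (x : Bool) {e₂ : Exp (2 + m)} →
          EvalIn u ρ e (encodeBit x) i → EvalIn u ρ e₁ (V false) j →
          EvalIn u (leaf ∷ leaf ∷ ρ) e₂ (V true) j →
          EvalIn u ρ (case e e₁ e₂) (V x) (suc (i + j))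
eval-if V false p q r = eval-caseL p q
eval-if V true  p q r = eval-caseN p r

encA : Vec Bool n → Tree
encA z = encodeList encodeBit (toList z)

trueE : Exp m
trueE = cons nil nil

-- `foldE` offers only an accumulator, hence the reversed order. Of the results only members and
-- lengths matter.
consMap : (A → B) → List B → List A → List B
consMap f = foldl (λ acc x → f x ∷ acc)

length-consMap : ∀ (f : A → B) acc xs → length (consMap f acc xs) ≡ length xs + length acc
length-consMap f acc []       = refl
length-consMap f acc (x ∷ xs) = trans (length-consMap f (f x ∷ acc) xs) (+-suc (length xs) (length acc))

consMap-acc : ∀ {f : A → B} {acc y} xs → y ∈ acc → y ∈ consMap f acc xs
consMap-acc []       y∈ = y∈
consMap-acc (x ∷ xs) y∈ = consMap-acc xs (there y∈)

∈-consMap : ∀ {f : A → B} {acc x xs} → x ∈ xs → f x ∈ consMap f acc xs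
∈-consMap {xs = x ∷ xs} (here refl) = consMap-acc xs (here refl)
∈-consMap {xs = x ∷ xs} (there x∈)  = ∈-consMap x∈

-- Words: reversal, access by position, literals

revE : Exp 1
revE = case (var 0F) nil (foldE (var 0F) (var 1F) (cons (var 0F) (var 3F)))

eval-rev : ∀ {{_ : NonZero u}} (enc : A → Tree) xs ys → length xs ≤ u →
           EvalIn u (node (encodeList enc xs) (encodeList enc ys) ∷ []) revE (encodeList enc (xs ʳ++ ys)) 25
eval-rev enc xs ys le =
  eval-caseN (eval-var 0F)
    (eval-fold 1 enc (encodeList enc) _ (λ _ _ → ⊤)
      (λ x xs st _ → tt , λ t l y → eval-cons (eval-var 0F) (eval-var 3F))
      xs ys tt (≤-trans (≤-reflexive (*-identityʳ _)) le) (eval-var 0F) (eval-var 1F))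

-- A zipper: bits move one at a time onto a reversed prefix. The `false` supplied past the end is
-- the padding of `takeVec`.
splitStep : List Bool × List Bool → List Bool × List Bool
splitStep (acc , [])    = false ∷ acc , []
splitStep (acc , b ∷ r) = b ∷ acc , r

encSplit : List Bool × List Bool → Tree
encSplit (acc , r) = node (encodeList encodeBit acc) (encodeList encodeBit r)

splitE : Exp 1
splitE = case (var 0F) nil (foldE (var 0F) (cons nil (var 1F))
  (case (var 3F) nil (case (var 1F) (cons (cons nil (var 0F)) nil) (cons (cons (var 0F) (var 2F)) (var 1F)))))

eval-split : ∀ {{_ : NonZero u}} i xs → i ≤ u →
             EvalIn u (node (encodeℕ i) (encodeList encodeBit xs) ∷ []) splitE (encSplit (times i splitStep ([] , xs))) 50
eval-split i xs le =
  ≤-coeff (eval-caseN (eval-var 0F)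
    (eval-times 1 encSplit splitStep (λ _ _ → ⊤) (λ _ st _ → tt , body st) i ([] , xs) tt
      (≤-trans (≤-reflexive (*-identityʳ _)) le) (eval-var 0F) (eval-cons eval-nil (eval-var 1F))))
  where
  body : ∀ st h t l y → EvalIn 1 (h ∷ t ∷ l ∷ encSplit st ∷ y ∷ _) _ (encSplit (splitStep st)) 9
  body (acc , [])    h t l y = ≤-coeff (eval-caseN (eval-var 3F) (eval-caseL (eval-var 1F) (eval-cons (eval-cons eval-nil (eval-var 0F)) eval-nil)))
  body (acc , x ∷ r) h t l y = ≤-coeff (eval-caseN (eval-var 3F) (eval-caseN (eval-var 1F)
    (eval-cons (eval-cons (eval-var 0F) (eval-var 2F)) (eval-var 1F))))

-- After `toℕ i` moves the zipper has entry `i` in focus, and unwinding the prefix onto a new entry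
-- `b` is an update at `i`. One traversal thus serves both reading and writing.
split-fin : ∀ (z : Vec Bool n) (i : Fin n) acc → ∃[ xs ] ∃[ ys ]
            times (toℕ i) splitStep (acc , toList z) ≡ (xs ʳ++ acc , lookup z i ∷ ys) ×
            (∀ b zs → (xs ʳ++ zs) ʳ++ (b ∷ ys) ≡ zs ʳ++ toList (z [ i ]≔ b)) × length xs ≤ toℕ i
split-fin (x ∷ z) Fin.zero acc = [] , toList z , refl , (λ b zs → refl) , z≤n
split-fin (x ∷ z) (Fin.suc i) acc with xs , ys , eq , eq′ , le ← split-fin z i (x ∷ acc) =
  x ∷ xs , ys , eq , (λ b zs → eq′ b (x ∷ zs)) , s≤s le

litSat : Vec Bool n → Literal n → Bool
litSat z (i , b) = does (lookup z i Bool.≟ b)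

setLit : Vec Bool n → Literal n → Vec Bool n
setLit z (i , b) = z [ i ]≔ b

eqBitE : Exp 9
eqBitE = case (var 0F) (case (var 4F) trueE nil) (case (var 6F) nil trueE)

litE : Exp 1
litE = case (var 0F) nil (case (var 0F) nil (case (call splitE (cons (var 1F) (var 3F))) nil (case (var 1F) nil eqBitE)))

eval-lit : ∀ {{_ : NonZero u}} (l : Literal n) (z : Vec Bool n) → n ≤ u →
           EvalIn u (node (encodeLiteral l) (encA z) ∷ []) litE (encodeBit (litSat z l)) 80
eval-lit {u = u} (i , b) z le with xs , ys , eq , _ ← split-fin z i [] =
  ≤-coeff (eval-caseN (eval-var 0F) (eval-caseN (eval-var 0F)
    (eval-caseN (eval-call (eval-cons (eval-var 1F) (eval-var 3F))
        (eval-value (cong encSplit eq) (eval-split (toℕ i) (toList z) (≤-trans (<⇒≤ (toℕ<n i)) le))))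
      (eval-caseN (eval-var 1F) (bits (lookup z i) b)))))
  where
  bits : ∀ {x y z w v s t} c b → EvalIn u (encodeBit c ∷ x ∷ y ∷ z ∷ encodeBit b ∷ w ∷ v ∷ s ∷ t ∷ []) eqBitE (encodeBit (does (c Bool.≟ b))) 8
  bits false false = ≤-coeff (eval-caseL (eval-var 0F) (eval-caseL (eval-var 4F) (eval-cons eval-nil eval-nil)))
  bits false true  = ≤-coeff (eval-caseL (eval-var 0F) (eval-caseN (eval-var 4F) eval-nil))
  bits true  false = ≤-coeff (eval-caseN (eval-var 0F) (eval-caseL (eval-var 6F) eval-nil))
  bits true  true  = ≤-coeff (eval-caseN (eval-var 0F) (eval-caseN (eval-var 6F) (eval-cons eval-nil eval-nil)))

setE : Exp 1
setE = case (var 0F) nil (case (var 0F) nil (case (call splitE (cons (var 1F) (var 3F))) nil (case (var 1F) nil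
  (call revE (cons (var 2F) (cons (var 4F) (var 1F)))))))

length-ʳ++-[] : ∀ (xs : List A) → length (xs ʳ++ []) ≡ length xs
length-ʳ++-[] xs = trans (length-ʳ++ xs) (+-identityʳ _)

eval-set : ∀ {{_ : NonZero u}} (l : Literal n) (z : Vec Bool n) → n ≤ u →
           EvalIn u (node (encodeLiteral l) (encA z) ∷ []) setE (encA (setLit z l)) 100
eval-set {u = u} (i , b) z le with xs , ys , eq , eq′ , lxs ← split-fin z i [] =
  ≤-coeff (eval-caseN (eval-var 0F) (eval-caseN (eval-var 0F)
    (eval-caseN (eval-call (eval-cons (eval-var 1F) (eval-var 3F))
        (eval-value (cong encSplit eq) (eval-split (toℕ i) (toList z) i≤u)))
      (eval-caseN (eval-var 1F)
        (eval-call (eval-cons (eval-var 2F) (eval-cons (eval-var 4F) (eval-var 1F)))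
          (eval-value (cong (encodeList encodeBit) (eq′ b []))
            (eval-rev encodeBit (xs ʳ++ []) (b ∷ ys)
              (≤-trans (≤-reflexive (length-ʳ++-[] xs)) (≤-trans lxs i≤u)))))))))
  where
  i≤u : toℕ i ≤ u
  i≤u = ≤-trans (<⇒≤ (toℕ<n i)) le

-- Clauses, formulas and one round of branching

clauseSat : Vec Bool n → Clause n → Bool
clauseSat z = foldl (λ acc l → if acc then true else litSat z l) false

encC : Clause n → Tree
encC = encodeList encodeLiteral

clauseE : Exp 1
clauseE = case (var 0F) nil (foldE (var 0F) nil (case (var 3F) (call litE (cons (var 0F) (var 6F))) trueE))

eval-clause : ∀ {{_ : NonZero u}} {{_ : NonZero w}} (C : Clause n) (z : Vec Bool n) → n ≤ w → length C * w ≤ u →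
              EvalIn u (node (encC C) (encA z) ∷ []) clauseE (encodeBit (clauseSat z C)) 120
eval-clause {w = w} C z n≤w le =
  ≤-coeff (eval-caseN (eval-var 0F)
    (eval-fold w encodeLiteral encodeBit _ (λ _ _ → ⊤)
      (λ x xs st _ → tt , λ t l y → eval-if (λ acc → encodeBit (if acc then true else litSat z x)) st
          (eval-var 3F)
          (eval-call (eval-cons (eval-var 0F) (eval-var 6F)) (eval-lit x z n≤w))
          (≤-coeff (eval-cons eval-nil eval-nil)))
      C false tt le (eval-var 0F) eval-nil))

-- The last falsified clause wins. Any would do, and overwriting spares a test of the accumulator.
findStep : Vec Bool n → Maybe (Clause n) → Clause n → Maybe (Clause n)
findStep z m C = if clauseSat z C then m else just C

falsified : Vec Bool n → CNF n → Maybe (Clause n)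
falsified z = foldl (findStep z) nothing

encM : Maybe (Clause n) → Tree
encM nothing  = leaf
encM (just C) = node (encC C) leaf

encF : CNF n → Tree
encF = encodeList encC

encL : List (Vec Bool n) → Tree
encL = encodeList encA

findE : Exp 1
findE = case (var 0F) nil (foldE (var 0F) nil
  (case (call clauseE (cons (var 0F) (var 6F))) (cons (var 0F) nil) (var 5F)))

expandE : Exp 1
expandE = case (var 0F) nil (case (var 1F) nil
  (case (call findE (cons (var 2F) (var 0F))) (cons (var 0F) (var 1F))
    (foldE (var 0F) (var 3F) (cons (call setE (cons (var 0F) (var 7F))) (var 3F)))))

flips : Vec Bool n → List (Vec Bool n) → Clause n → List (Vec Bool n)
flips z = consMap (setLit z)

expandAs : Vec Bool n → List (Vec Bool n) → Maybe (Clause n) → List (Vec Bool n)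
expandAs z acc nothing  = z ∷ acc
expandAs z acc (just C) = flips z acc C

-- A satisfying word is passed on unchanged, so a solution found early survives and the number of
-- rounds can be fixed beforehand.
expand : CNF n → List (Vec Bool n) → Vec Bool n → List (Vec Bool n)
expand F acc z = expandAs z acc (falsified z F)

roundE : Exp 1
roundE = case (var 0F) nil (foldE (var 1F) nil (call expandE (cons (var 5F) (cons (var 0F) (var 3F)))))

round : CNF n → List (Vec Bool n) → List (Vec Bool n)
round F = foldl (expand F) []

keep : CNF n → List (Vec Bool n) → Vec Bool n → List (Vec Bool n)
keep F acc z = keepAs (falsified z F)
  where
  keepAs : Maybe (Clause _) → List (Vec Bool _)
  keepAs nothing  = z ∷ acc
  keepAs (just _) = acc

keepE : Exp 1
keepE = case (var 0F) nil (foldE (var 1F) nil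
  (case (call findE (cons (var 5F) (var 0F))) (cons (var 0F) (var 3F)) (var 5F)))

clauseSat-acc : ∀ (z : Vec Bool n) C → foldl (λ acc l → if acc then true else litSat z l) true C ≡ true
clauseSat-acc z []      = refl
clauseSat-acc z (l ∷ C) = clauseSat-acc z C

clauseSat-true : ∀ (z : Vec Bool n) C → clauseSat z C ≡ true → Any (SatLiteral z) C
clauseSat-true z ((i , b) ∷ C) eq with lookup z i Bool.≟ b
... | yes p = here p
... | no  _ = there (clauseSat-true z C eq)

clauseSat-false : ∀ (z : Vec Bool n) C → clauseSat z C ≡ false → All (λ l → ¬ SatLiteral z l) C
clauseSat-false z [] eq = []
clauseSat-false z ((i , b) ∷ C) eq with lookup z i Bool.≟ b
... | no ¬p = ¬p ∷ clauseSat-false z C eq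
... | yes p with () ← trans (sym eq) (clauseSat-acc z C)

find-nothing : ∀ (z : Vec Bool n) m F → foldl (findStep z) m F ≡ nothing → m ≡ nothing × Sat F z
find-nothing z m []      eq = eq , []
find-nothing z m (C ∷ F) eq with clauseSat z C in eqC
... | true with p , q ← find-nothing z m F eq = p , clauseSat-true z C eqC ∷ q
... | false with () ← proj₁ (find-nothing z (just C) F eq)

find-just : ∀ (z : Vec Bool n) m F {C} → foldl (findStep z) m F ≡ just C →
            m ≡ just C ⊎ (C ∈ F × All (λ l → ¬ SatLiteral z l) C)
find-just z m []      eq = inj₁ eq
find-just z m (C ∷ F) eq with clauseSat z C in eqC
find-just z m (C ∷ F) eq | true with find-just z m F eq
... | inj₁ p       = inj₁ p
... | inj₂ (p , q) = inj₂ (there p , q)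
find-just z m (C ∷ F) eq | false with find-just z (just C) F eq
... | inj₁ refl    = inj₂ (here refl , clauseSat-false z C eqC)
... | inj₂ (p , q) = inj₂ (there p , q)

find-falsified : ∀ (z : Vec Bool n) F {C} → falsified z F ≡ just C → C ∈ F × All (λ l → ¬ SatLiteral z l) C
find-falsified z F eq with inj₂ p ← find-just z nothing F eq = p

module _ {k : ℕ} {{_ : NonZero k}} {F : CNF n} (kF : IsKCNF k F) where

  length-expand : ∀ acc z → length (expand F acc z) ≤ k + length acc
  length-expand acc z with falsified z F in eq
  ... | nothing = +-monoˡ-≤ (length acc) (>-nonZero⁻¹ k)
  ... | just C  = ≤-trans (≤-reflexive (length-consMap (setLit z) acc C))
                          (+-monoˡ-≤ (length acc) (All.lookup kF (proj₁ (find-falsified z F eq))))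

  length-round : ∀ L → length (round F L) ≤ length L * k
  length-round L = subst (length (round F L) ≤_) (+-identityʳ _) (go [] L)
    where
    open ≤-Reasoning
    go : ∀ acc L → length (foldl (expand F) acc L) ≤ length L * k + length acc
    go acc []      = ≤-refl
    go acc (z ∷ L) = begin
      length (foldl (expand F) (expand F acc z) L) ≤⟨ go _ L ⟩
      length L * k + length (expand F acc z) ≤⟨ +-monoʳ-≤ (length L * k) (length-expand acc z) ⟩
      length L * k + (k + length acc) ≡⟨ sym (+-assoc (length L * k) k _) ⟩
      length L * k + k + length acc ≡⟨ cong (_+ length acc) (+-comm (length L * k) k) ⟩
      k + length L * k + length acc                ∎

  -- Three nested units: `w₁` for the scan of a word, `w₂` for a clause, `w₃` for the whole formula.
  module _ {w₁ w₂ w₃ : ℕ} {{_ : NonZero w₁}} {{_ : NonZero w₂}} {{_ : NonZero w₃}}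
           (n≤w₁ : n ≤ w₁) (kw₁≤w₂ : k * w₁ ≤ w₂) (w₂≤w₃ : w₂ ≤ w₃) (Fw₂≤w₃ : length F * w₂ ≤ w₃) where

    eval-find : ∀ z → EvalIn w₃ (node (encF F) (encA z) ∷ []) findE (encM (falsified z F)) 160
    eval-find z = ≤-coeff (eval-caseN (eval-var 0F)
      (eval-fold w₂ encC encM (findStep z) (λ Cs _ → IsKCNF k Cs)
        (λ { C Cs m (kC ∷ kCs) → kCs , λ t l y → eval-if (λ b → encM (if b then m else just C)) (clauseSat z C)
          (eval-call (eval-cons (eval-var 0F) (eval-var 6F))
            (eval-clause {w = w₁} C z n≤w₁ (≤-trans (*-monoˡ-≤ w₁ kC) kw₁≤w₂)))
          (eval-cons (eval-var 0F) eval-nil) (≤-coeff (eval-var 5F)) })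
        F nothing kF Fw₂≤w₃ (eval-var 0F) eval-nil))

    eval-expand : ∀ acc z → EvalIn w₃ (node (encF F) (node (encA z) (encL acc)) ∷ []) expandE (encL (expand F acc z)) 320
    eval-expand acc z with falsified z F in eq
    ... | nothing = ≤-coeff (eval-caseN (eval-var 0F) (eval-caseN (eval-var 1F)
                      (eval-caseL (eval-call (eval-cons (eval-var 2F) (eval-var 0F)) (eval-value (cong encM eq) (eval-find z)))
                        (eval-cons (eval-var 0F) (eval-var 1F)))))
    ... | just C  = ≤-coeff (eval-caseN (eval-var 0F) (eval-caseN (eval-var 1F)
                      (eval-caseN (eval-call (eval-cons (eval-var 2F) (eval-var 0F)) (eval-value (cong encM eq) (eval-find z)))
                        (eval-fold w₁ encodeLiteral encL _ (λ _ _ → ⊤)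
                          (λ l _ acc _ → tt , λ _ _ _ → eval-cons (eval-call (eval-cons (eval-var 0F) (eval-var 7F)) (eval-set l z n≤w₁)) (eval-var 3F))
                          C acc tt (≤-trans (*-monoˡ-≤ w₁ (All.lookup kF (proj₁ (find-falsified z F eq)))) (≤-trans kw₁≤w₂ w₂≤w₃))
                          (eval-var 0F) (eval-var 3F)))))

    eval-round : ∀ {{_ : NonZero u}} L → length L * w₃ ≤ u →
                 EvalIn u (node (encF F) (encL L) ∷ []) roundE (encL (round F L)) 360
    eval-round L le = ≤-coeff (eval-caseN (eval-var 0F)
      (eval-fold w₃ encA encL (expand F) (λ _ _ → ⊤)
        (λ z _ acc _ → tt , λ _ _ _ → eval-call (eval-cons (eval-var 5F) (eval-cons (eval-var 0F) (eval-var 3F))) (eval-expand acc z))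
        L [] tt le (eval-var 1F) eval-nil))

    eval-keep : ∀ {{_ : NonZero u}} L → length L * w₃ ≤ u →
                EvalIn u (node (encF F) (encL L) ∷ []) keepE (encL (foldl (keep F) [] L)) 200
    eval-keep L le = ≤-coeff (eval-caseN (eval-var 0F)
      (eval-fold w₃ encA encL (keep F) (λ _ _ → ⊤) (λ z _ acc _ → tt , λ t l y → body z acc t l y)
        L [] tt le (eval-var 1F) eval-nil))
      where
      body : ∀ z acc t l y → EvalIn w₃ (encA z ∷ t ∷ l ∷ encL acc ∷ y ∷ encF F ∷ encL L ∷ node (encF F) (encL L) ∷ [])
        (case (call findE (cons (var 5F) (var 0F))) (cons (var 0F) (var 3F)) (var 5F)) (encL (keep F acc z)) 170
      body z acc t l y with falsified z F in eq
      ... | nothing = ≤-coeff (eval-caseL (eval-call (eval-cons (eval-var 5F) (eval-var 0F)) (eval-value (cong encM eq) (eval-find z)))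
                                (eval-cons (eval-var 0F) (eval-var 3F)))
      ... | just C  = ≤-coeff (eval-caseN (eval-call (eval-cons (eval-var 5F) (eval-var 0F)) (eval-value (cong encM eq) (eval-find z)))
                                (eval-var 5F))

-- Constants of the program and centres of the search

size : Tree → ℕ
size leaf       = 1
size (node t u) = suc (size t + size u)

-- The block codes enter the program as literals in this way. They depend on `k` only, so their size
-- is a constant of the time bound.
quoteE : Tree → Exp m
quoteE leaf       = nil
quoteE (node t u) = cons (quoteE t) (quoteE u)

raw-quote : ∀ t → Eval ρ (quoteE t) t (size t)
raw-quote leaf       = raw-nil
raw-quote (node t u) = raw-cons (raw-quote t) (raw-quote u)

eval-quote : ∀ t → size t ≤ u → EvalIn u ρ (quoteE t) t 1
eval-quote t le = in-units (relax (≤-trans le (≤-reflexive (sym (*-identityˡ _)))) (raw-quote t))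

takeVec : ∀ n → List Bool → Vec Bool n
takeVec zero    xs       = []
takeVec (suc n) []       = false ∷ takeVec n []
takeVec (suc n) (x ∷ xs) = x ∷ takeVec n xs

times-split : ∀ n acc xs → times n splitStep (acc , xs) ≡ (toList (takeVec n xs) ʳ++ acc , drop n xs)
times-split zero    acc xs       = refl
times-split (suc n) acc []       = trans (times-split n (false ∷ acc) []) (cong (toList (takeVec n []) ʳ++ (false ∷ acc) ,_) (drop-[] n))
  where
  drop-[] : ∀ n → drop n [] ≡ drop {A = Bool} (suc n) []
  drop-[] zero    = refl
  drop-[] (suc n) = refl
times-split (suc n) acc (x ∷ xs) = times-split n (x ∷ acc) xs

takeE : Exp 1
takeE = case (call splitE (var 0F)) nil (call revE (cons (var 0F) nil))

eval-take : ∀ {{_ : NonZero u}} n xs → n ≤ u →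
            EvalIn u (node (encodeℕ n) (encodeList encodeBit xs) ∷ []) takeE (encA (takeVec n xs)) 90
eval-take {u} n xs le = ≤-coeff (eval-caseN
  (eval-call (eval-var 0F) (eval-value (cong encSplit (times-split n [] xs)) (eval-split n xs le)))
  (eval-call (eval-cons (eval-var 0F) eval-nil)
    (eval-value (cong (encodeList encodeBit) (reverse-involutive (toList (takeVec n xs))))
      (eval-rev encodeBit (toList (takeVec n xs) ʳ++ []) []
        (≤-trans (≤-reflexive (trans (length-ʳ++-[] (toList (takeVec n xs))) (length-toList (takeVec n xs)))) le)))))

extend : List (Vec Bool m) → List (List Bool) → List (List Bool)
extend κ = foldl (λ acc p → consMap (λ c → toList c ++ p) acc κ) []

length-extend : ∀ (κ : List (Vec Bool m)) Ps → length (extend κ Ps) ≡ length Ps * length κ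
length-extend κ Ps = trans (go [] Ps) (+-identityʳ _)
  where
  go : ∀ acc Ps → length (foldl (λ acc p → consMap (λ c → toList c ++ p) acc κ) acc Ps) ≡ length Ps * length κ + length acc
  go acc []       = refl
  go acc (p ∷ Ps) = begin
    _ ≡⟨ go _ Ps ⟩
    length Ps * length κ + length (consMap (λ c → toList c ++ p) acc κ) ≡⟨ cong (length Ps * length κ +_) (length-consMap _ acc κ) ⟩
    length Ps * length κ + (length κ + length acc) ≡⟨ sym (+-assoc (length Ps * length κ) _ _) ⟩
    length Ps * length κ + length κ + length acc ≡⟨ cong (_+ length acc) (+-comm (length Ps * length κ) _) ⟩
    length κ + length Ps * length κ + length acc ∎
    where open ≡-Reasoning

∈-extend : ∀ {κ : List (Vec Bool m)} {Ps c p} → c ∈ κ → p ∈ Ps → toList c ++ p ∈ extend κ Ps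
∈-extend {κ = κ} {c = c} c∈ = go [] _
  where
  keeps : ∀ acc Ps {y} → y ∈ acc → y ∈ foldl (λ acc p → consMap (λ c → toList c ++ p) acc κ) acc Ps
  keeps acc []       y∈ = y∈
  keeps acc (p ∷ Ps) y∈ = keeps _ Ps (consMap-acc κ y∈)
  go : ∀ acc Ps {p} → p ∈ Ps → toList c ++ p ∈ foldl (λ acc p → consMap (λ c → toList c ++ p) acc κ) acc Ps
  go acc (p ∷ Ps) (here refl) = keeps _ Ps (∈-consMap c∈)
  go acc (p ∷ Ps) (there p∈)  = go _ Ps p∈

centres : ∀ n → ℕ → List (Vec Bool n) → List (Vec Bool m) → List (Vec Bool n)
centres n q acc κ = consMap (takeVec n) acc (times q (extend κ) ([] ∷ []))

-- Code words are stored reversed: revE prepends them in the right order.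
encW : Vec Bool m → Tree
encW c = encodeList encodeBit (reverse (toList c))

encP : List (List Bool) → Tree
encP = encodeList (encodeList encodeBit)

extendE : Exp 1
extendE = case (var 0F) nil
  (foldE (var 1F) nil (foldE (var 5F) (var 3F) (cons (call revE (cons (var 0F) (var 5F))) (var 3F))))

eval-extend : ∀ {{_ : NonZero u}} {{_ : NonZero w}} {{_ : NonZero m}} (κ : List (Vec Bool m)) Ps →
              length κ * m ≤ w → length Ps * w ≤ u →
              EvalIn u (node (encodeList encW κ) (encP Ps) ∷ []) extendE (encP (extend κ Ps)) 120
eval-extend {w = w} {m = m} κ Ps κ≤ Ps≤ = ≤-coeff (eval-caseN (eval-var 0F)
  (eval-fold w (encodeList encodeBit) encP _ (λ _ _ → ⊤)
    (λ p _ acc _ → tt , λ t l y →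
      eval-fold m encW encP _ (λ _ _ → ⊤)
        (λ c _ acc _ → tt , λ _ _ _ → eval-cons (eval-call (eval-cons (eval-var 0F) (eval-var 5F))
            (eval-value (cong (encodeList encodeBit) (word c p))
              (eval-rev encodeBit (reverse (toList c)) p
                (≤-reflexive (trans (length-reverse (toList c)) (length-toList c))))))
          (eval-var 3F))
        κ acc tt κ≤ (eval-var 5F) (eval-var 3F))
    Ps [] tt Ps≤ (eval-var 1F) eval-nil))
  where
  word : ∀ (c : Vec Bool m) p → reverse (toList c) ʳ++ p ≡ toList c ++ p
  word c p = trans (ʳ++-defn (reverse (toList c))) (cong (_++ p) (reverse-involutive (toList c)))

centresE : Exp 1
centresE = case (var 0F) nil (case (var 0F) nil (case (var 3F) nil
  (foldE (foldE (var 3F) (cons nil nil) (call extendE (cons (var 5F) (var 3F))))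
         (var 1F) (cons (call takeE (cons (var 7F) (var 0F))) (var 3F)))))

module _ {Y : ℕ} {{_ : NonZero Y}} (κ : List (Vec Bool m)) {{_ : NonZero m}} {{_ : NonZero (length κ)}} where

  length-parts : ∀ q Ps → length (times q (extend κ) Ps) ≡ length Ps * length κ ^ q
  length-parts zero    Ps = sym (*-identityʳ _)
  length-parts (suc q) Ps = trans (length-parts q (extend κ Ps))
    (trans (cong (_* length κ ^ q) (length-extend κ Ps)) (*-assoc (length Ps) _ _))

  length-centres : ∀ q acc → length (centres n q acc κ) ≡ length κ ^ q + length acc
  length-centres q acc = trans (length-consMap (takeVec _) acc (times q (extend κ) ([] ∷ [])))
    (cong (_+ length acc) (trans (length-parts q ([] ∷ [])) (*-identityˡ _)))

  eval-centres : ∀ {{_ : NonZero u}} {{_ : NonZero w}} q (acc : List (Vec Bool n)) →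
                 length κ ^ q ≤ Y → length κ * m ≤ w → suc n ≤ w → suc q * (Y * w) ≤ u →
                 EvalIn u (node (node (encodeℕ n) (encodeℕ q)) (node (encodeList encW κ) (encL acc)) ∷ [])
                   centresE (encL (centres n q acc κ)) 300
  eval-centres {w = w} {n = n} q acc κ^q≤Y κ≤ n<w le =
    ≤-coeff (eval-caseN (eval-var 0F) (eval-caseN (eval-var 0F) (eval-caseN (eval-var 3F)
      (eval-fold w (encodeList encodeBit) encL _ (λ _ _ → ⊤)
        (λ p _ acc _ → tt , λ _ _ _ → eval-cons (eval-call (eval-cons (eval-var 7F) (eval-var 0F)) (eval-take n p (<⇒≤ n<w))) (eval-var 3F))
        (times q (extend κ) ([] ∷ [])) acc tt
        (≤-trans (*-monoˡ-≤ w (≤-trans (≤-reflexive (trans (length-parts q ([] ∷ [])) (*-identityˡ _))) κ^q≤Y))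
                 (≤-trans (m≤m+n (Y * w) (q * (Y * w))) le))
        -- The invariant charges each partial word for all its future extensions: `length Ps` times
        -- `length κ ^ j` for the `j` blocks left stays below `Y`.
        (eval-times (Y * w) encP (extend κ) (λ j Ps → length Ps * length κ ^ j ≤ Y)
          (λ j Ps inv → step j Ps inv , λ _ _ _ _ →
            eval-call (eval-cons (eval-var 5F) (eval-var 3F))
              (eval-extend κ Ps κ≤ (*-monoˡ-≤ w (bound (suc j) Ps inv))))
          q ([] ∷ []) (≤-trans (≤-reflexive (*-identityˡ _)) κ^q≤Y)
          (≤-trans (m≤n+m (q * (Y * w)) (Y * w)) le)
          (eval-var 3F) (eval-cons eval-nil eval-nil))
        (eval-var 1F)))))
    where
    instance
      Yw≢0 : NonZero (Y * w)
      Yw≢0 = m*n≢0 Y w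
    step : ∀ j (Ps : List (List Bool)) → length Ps * length κ ^ suc j ≤ Y → length (extend κ Ps) * length κ ^ j ≤ Y
    step j Ps inv = ≤-trans (≤-reflexive (trans (cong (_* length κ ^ j) (length-extend κ Ps)) (*-assoc (length Ps) _ _))) inv
    bound : ∀ j (Ps : List (List Bool)) → length Ps * length κ ^ j ≤ Y → length Ps ≤ Y
    bound j Ps inv = ≤-trans (m≤m*n (length Ps) (length κ ^ j) {{m^n≢0 (length κ) j}}) inv

-- (room left in the last block , number of blocks)
blockStep : ℕ → ℕ × ℕ → ℕ × ℕ
blockStep b′ (zero  , q) = b′ , suc q
blockStep b′ (suc c , q) = c , q

blocks : ℕ → ℕ → ℕ
blocks b′ n = proj₂ (times n (blockStep b′) (0 , 0))

-- The counter keeps the number of blocks times their length equal to the positions consumed plus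
-- the room left. So `blocks` is division by `suc b′` rounded up, and `c` is the excess.
blocks-cover : ∀ b′ n → ∃[ c ] c ≤ b′ × blocks b′ n * suc b′ ≡ n + c
blocks-cover b′ n = let c , le , eq = go n 0 0 z≤n in c , le , trans (sym (+-identityʳ _)) eq
  where
  go : ∀ n c q → c ≤ b′ → let r = times n (blockStep b′) (c , q) in
       ∃[ c′ ] c′ ≤ b′ × proj₂ r * suc b′ + c ≡ q * suc b′ + n + c′
  go zero    c       q le = c , le , cong (_+ c) (sym (+-identityʳ _))
  go (suc n) zero    q le with c′ , le′ , eq ← go n b′ (suc q) ≤-refl =
    c′ , le′ , +-cancelʳ-≡ b′ _ _ (trans (cong (_+ b′) (+-identityʳ _)) (trans eq
      (solve 4 (λ b q n c → (con 1 :+ b :+ q :* (con 1 :+ b)) :+ n :+ c := q :* (con 1 :+ b) :+ (con 1 :+ n) :+ c :+ b) refl b′ q n c′)))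
  go (suc n) (suc c) q le with c′ , le′ , eq ← go n c q (<⇒≤ le) =
    c′ , le′ , trans (+-suc _ c) (trans (cong suc eq) (cong (_+ c′) (sym (+-suc (q * suc b′) n))))

encBlocks : ℕ × ℕ → Tree
encBlocks (c , q) = node (encodeℕ c) (encodeℕ q)

blocksE : ℕ → Exp 1
blocksE b′ = case (foldE (var 0F) (cons nil nil)
  (case (var 3F) nil (case (var 0F) (cons (quoteE (encodeℕ b′)) (cons nil (var 1F))) (cons (var 1F) (var 3F))))) nil (var 1F)

eval-blocks : ∀ {{_ : NonZero u}} {{_ : NonZero w}} b′ n → size (encodeℕ b′) ≤ w → n * w ≤ u →
              EvalIn u (encodeℕ n ∷ []) (blocksE b′) (encodeℕ (blocks b′ n)) 50
eval-blocks {w = w} b′ n b≤w le = ≤-coeff (eval-caseN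
  (eval-times w encBlocks (blockStep b′) (λ _ _ → ⊤) (λ _ st _ → tt , body st) n (0 , 0) tt le
    (eval-var 0F) (eval-cons eval-nil eval-nil))
  (eval-var 1F))
  where
  body : ∀ st h t l y → EvalIn w (h ∷ t ∷ l ∷ encBlocks st ∷ y ∷ _) _ (encBlocks (blockStep b′ st)) 10
  body (zero  , q) h t l y = ≤-coeff (eval-caseN (eval-var 3F) (eval-caseL (eval-var 0F)
    (eval-cons (eval-quote (encodeℕ b′) b≤w) (eval-cons eval-nil (eval-var 1F)))))
  body (suc c , q) h t l y = ≤-coeff (eval-caseN (eval-var 3F) (eval-caseN (eval-var 0F)
    (eval-cons (eval-var 1F) (eval-var 3F))))

encFam : List (List (Vec Bool m)) → Tree
encFam = encodeList (encodeList encW)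

allCentres : ∀ n → ℕ → List (List (Vec Bool m)) → List (Vec Bool n)
allCentres n q = foldl (centres n q) []

-- As many rounds as the distance `q * r` from a centre. The nesting avoids forming the product: `r`
-- is a constant of the program, while `q` is computed from `n`.
rounds : CNF n → (q r : ℕ) → List (Vec Bool n) → List (Vec Bool n)
rounds F q r = times q (times r (round F))

candidates : List (List (Vec Bool m)) → (r q : ℕ) → CNF n → List (Vec Bool n)
candidates {n = n} fam r q F = foldl (keep F) [] (rounds F q r (allCentres n q fam))

candidatesE : ℕ → ℕ → List (List (Vec Bool m)) → Exp 1
candidatesE b′ r fam = case (var 0F) nil (bind (call (blocksE b′) (var 0F)) (bind
  (foldE (quoteE (encFam fam)) nil (call centresE (cons (cons (var 6F) (var 5F)) (cons (var 0F) (var 3F)))))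
  (call keepE (cons (var 3F)
    (foldE (var 1F) (var 0F) (foldE (quoteE (encodeℕ r)) (var 3F) (call roundE (cons (var (# 13)) (var 3F)))))))))

module _ (b′ r M : ℕ) {{_ : NonZero M}} (fam : List (List (Vec Bool (suc b′)))) (famM : All (λ κ → length κ ≡ M) fam)
         {k : ℕ} {{_ : NonZero k}} where

  private
    length≢0 : ∀ (κ : List (Vec Bool (suc b′))) → length κ ≡ M → NonZero (length κ)
    length≢0 κ eq = subst NonZero (sym eq) it

  length-allCentres : ∀ q → length (allCentres n q fam) ≡ length fam * M ^ q
  length-allCentres {n = n} q = trans (go [] fam famM) (+-identityʳ _)
    where
    open ≡-Reasoning
    go : ∀ acc (fam : List (List (Vec Bool (suc b′)))) → All (λ κ → length κ ≡ M) fam →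
         length (foldl (centres n q) acc fam) ≡ length fam * M ^ q + length acc
    go acc []        []           = refl
    go acc (κ ∷ fam) (eq ∷ all) = begin
      length (foldl (centres n q) (centres n q acc κ) fam) ≡⟨ go _ fam all ⟩
      length fam * M ^ q + length (centres n q acc κ) ≡⟨ cong (length fam * M ^ q +_) (trans (length-centres {Y = 1} κ {{_}} {{length≢0 κ eq}} q acc) (cong (λ l → l ^ q + length acc) eq)) ⟩
      length fam * M ^ q + (M ^ q + length acc) ≡⟨ sym (+-assoc (length fam * M ^ q) _ _) ⟩
      length fam * M ^ q + M ^ q + length acc ≡⟨ cong (_+ length acc) (+-comm (length fam * M ^ q) _) ⟩
      M ^ q + length fam * M ^ q + length acc                 ∎

  module _ {F : CNF n} (kF : IsKCNF k F) {X : ℕ} where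

    private
      round-step : ∀ c j L → length L * (k ^ suc j * c) ≤ X → length (round F L) * (k ^ j * c) ≤ X
      round-step c j L inv = ≤-trans (*-monoˡ-≤ (k ^ j * c) (length-round kF L))
        (≤-trans (≤-reflexive (solve 4 (λ l k p c → l :* k :* (p :* c) := l :* (k :* p :* c)) refl (length L) k (k ^ j) c)) inv)

    length-times-round : ∀ c j L → length L * (k ^ j * c) ≤ X → length (times j (round F) L) * c ≤ X
    length-times-round c zero    L inv = subst (λ x → length L * x ≤ X) (+-identityʳ c) inv
    length-times-round c (suc j) L inv = length-times-round c j (round F L) (round-step c j L inv)

    rounds-step : ∀ j L → length L * (k ^ r) ^ suc j ≤ X → length (times r (round F) L) * (k ^ r) ^ j ≤ X
    rounds-step j L = length-times-round ((k ^ r) ^ j) r L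

    length-rounds : ∀ q L → length L * (k ^ r) ^ q ≤ X → length (rounds F q r L) ≤ X
    length-rounds zero    L inv = ≤-trans (≤-reflexive (sym (*-identityʳ _))) inv
    length-rounds (suc q) L inv = length-rounds q (times r (round F) L) (rounds-step q L inv)

    length-keep : ∀ acc L → length (foldl (keep F) acc L) ≤ length L + length acc
    length-keep acc []      = ≤-refl
    length-keep acc (z ∷ L) = ≤-trans (length-keep (keep F acc z) L)
      (≤-trans (+-monoʳ-≤ (length L) (one z)) (≤-reflexive (+-suc (length L) (length acc))))
      where
      one : ∀ z → length (keep F acc z) ≤ suc (length acc)
      one z with falsified z F
      ... | nothing = ≤-refl
      ... | just _  = n≤1+n _

    start-bound : ∀ q → length fam * M ^ q * (k ^ r) ^ q ≤ X → length (allCentres n q fam) * (k ^ r) ^ q ≤ X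
    start-bound q = subst (λ l → l * (k ^ r) ^ q ≤ X) (sym (length-allCentres q))

    length-candidates : ∀ q → length fam * M ^ q * (k ^ r) ^ q ≤ X → length (candidates fam r q F) ≤ X
    length-candidates q total = ≤-trans (length-keep [] (rounds F q r (allCentres n q fam)))
      (≤-trans (≤-reflexive (+-identityʳ _)) (length-rounds q (allCentres n q fam) (start-bound q total)))

    -- The units from inside out: `wC` for a scan of one block code or word, `u₁` for all centres of
    -- one code, `u₂` for a round, `u₃` for `r` rounds, and `u` for `q` times that. `X` caps every
    -- list of words during the rounds.
    module _ {w₁ w₂ w₃ wC u₁ u₂ u₃ u : ℕ} {{_ : NonZero w₁}} {{_ : NonZero w₂}} {{_ : NonZero w₃}}
             {{_ : NonZero wC}} {{_ : NonZero u₁}} {{_ : NonZero u₂}} {{_ : NonZero u₃}} {{_ : NonZero u}}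
             (n≤w₁ : n ≤ w₁) (kw₁≤w₂ : k * w₁ ≤ w₂) (w₂≤w₃ : w₂ ≤ w₃) (Fw₂≤w₃ : length F * w₂ ≤ w₃)
             (M≤wC : M * suc b′ ≤ wC) (n<wC : suc n ≤ wC) (b≤wC : size (encodeℕ b′) ≤ wC) (nwC≤u : n * wC ≤ u)
             (total : length fam * M ^ blocks b′ n * (k ^ r) ^ blocks b′ n ≤ X)
             (centres≤ : suc (blocks b′ n) * (M ^ blocks b′ n * wC) ≤ u₁) (fam≤ : length fam * u₁ ≤ u) (sizefam≤ : size (encFam fam) ≤ u)
             (Xw₃≤u₂ : X * w₃ ≤ u₂) (ru₂≤u₃ : r * u₂ ≤ u₃) (r≤u₃ : size (encodeℕ r) ≤ u₃) (qu₃≤u : blocks b′ n * u₃ ≤ u) (Xw₃≤u : X * w₃ ≤ u) where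

      private
        q : ℕ
        q = blocks b′ n
        start : length (allCentres n q fam) * (k ^ r) ^ q ≤ X
        start = start-bound q total

      eval-candidates : EvalIn u (node (encodeℕ n) (encF F) ∷ []) (candidatesE b′ r fam) (encL (candidates fam r q F)) 1100
      eval-candidates = ≤-coeff (eval-caseN (eval-var 0F) (eval-bind
        (eval-call (eval-var 0F) (eval-blocks {w = wC} b′ n b≤wC nwC≤u)) (eval-bind
        (eval-fold u₁ (encodeList encW) encL (centres n q) (λ κs _ → All (λ κ → length κ ≡ M) κs)
          (λ { κ κs acc (eq ∷ all) → all , λ _ _ _ → eval-call
              (eval-cons (eval-cons (eval-var 6F) (eval-var 5F)) (eval-cons (eval-var 0F) (eval-var 3F)))
              (eval-centres {Y = M ^ q} {{m^n≢0 M q}} κ {{_}} {{length≢0 κ eq}} q acc (≤-reflexive (cong (_^ q) eq)) (subst (λ l → l * suc b′ ≤ wC) (sym eq) M≤wC) n<wC centres≤) })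
          fam [] famM fam≤ (eval-quote (encFam fam) sizefam≤) eval-nil)
        (eval-call (eval-cons (eval-var 3F)
            (eval-times u₃ encL (times r (round F)) (λ j L → length L * (k ^ r) ^ j ≤ X)
              (λ j L inv → rounds-step j L inv , λ _ _ _ _ →
                eval-times u₂ encL (round F) (λ i L → length L * (k ^ i * (k ^ r) ^ j) ≤ X)
                  (λ i L inv → round-step ((k ^ r) ^ j) i L inv , λ _ _ _ _ →
                    eval-call (eval-cons (eval-var (# 13)) (eval-var 3F))
                      (eval-round kF n≤w₁ kw₁≤w₂ w₂≤w₃ Fw₂≤w₃ L (≤-trans (*-monoˡ-≤ w₃ (cap (suc i) j L inv)) Xw₃≤u₂)))
                  r L inv ru₂≤u₃ (eval-quote (encodeℕ r) r≤u₃) (eval-var 3F))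
              q (allCentres n q fam) start qu₃≤u (eval-var 1F) (eval-var 0F)))
          (eval-keep kF n≤w₁ kw₁≤w₂ w₂≤w₃ Fw₂≤w₃ (rounds F q r (allCentres n q fam))
            (≤-trans (*-monoˡ-≤ w₃ (length-rounds q (allCentres n q fam) start)) Xw₃≤u))))))
        where
        cap : ∀ i j (L : List (Vec Bool n)) → length L * (k ^ i * (k ^ r) ^ j) ≤ X → length L ≤ X
        cap i j L inv = ≤-trans (m≤m*n (length L) (k ^ i * (k ^ r) ^ j)
          {{m*n≢0 (k ^ i) ((k ^ r) ^ j) {{m^n≢0 k i}} {{m^n≢0 (k ^ r) j {{m^n≢0 k r}}}}}}) inv

-- Distances and best responses in the program

d-H≤n : ∀ (z y : Vec Bool n) → d-H z y ≤ n
d-H≤n []      []      = z≤n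
d-H≤n (x ∷ z) (y ∷ w) with x xor y
... | true  = s≤s (d-H≤n z w)
... | false = m≤n⇒m≤1+n (d-H≤n z w)

-- A fold runs over one list only, so the other word is part of the state and is consumed along the
-- way.
distStep : List Bool × ℕ → Bool → List Bool × ℕ
distStep ([]     , c) x = [] , c
distStep (y ∷ ys , c) x = ys , (if x xor y then 1 else 0) + c

encDist : List Bool × ℕ → Tree
encDist (ys , c) = node (encodeList encodeBit ys) (encodeℕ c)

foldl-distStep : ∀ (z y : Vec Bool n) c → foldl distStep (toList y , c) (toList z) ≡ ([] , d-H z y + c)
foldl-distStep []      []      c = refl
foldl-distStep (x ∷ z) (y ∷ w) c = trans (foldl-distStep z w _) (cong ([] ,_)
  (trans (sym (+-assoc (d-H z w) b c)) (cong (_+ c) (+-comm (d-H z w) b))))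
  where b = if x xor y then 1 else 0

sumD : Vec Bool n → List (Vec Bool n) → ℕ
sumD z []      = 0
sumD z (y ∷ R) = d-H z y + sumD z R

addD : Vec Bool n → ℕ → Vec Bool n → ℕ
addD z c y = d-H z y + c

foldl-addD : ∀ (z : Vec Bool n) c R → foldl (addD z) c R ≡ sumD z R + c
foldl-addD z c []      = refl
foldl-addD z c (y ∷ R) = trans (foldl-addD z (d-H z y + c) R)
  (trans (sym (+-assoc (sumD z R) (d-H z y) c)) (cong (_+ c) (+-comm (sumD z R) (d-H z y))))

sumD≤ : ∀ (z : Vec Bool n) R → sumD z R ≤ length R * n
sumD≤ z []      = z≤n
sumD≤ z (y ∷ R) = +-mono-≤ (d-H≤n z y) (sumD≤ z R)

distBodyE : Exp (5 + m)
distBodyE = case (var 3F) nil (case (var 0F) (cons nil (var 1F)) (cons (var 1F)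
  (case (var 0F) (case (var 4F) (var 3F) (cons nil (var 5F))) (case (var 6F) (cons nil (var 5F)) (var 7F)))))

distE : Exp 1
distE = case (var 0F) nil (foldE (var 1F) nil (case (foldE (var 5F) (cons (var 0F) (var 3F)) distBodyE) nil (var 1F)))

eval-dist : ∀ {{_ : NonZero u}} {{_ : NonZero w}} (z : Vec Bool n) R → n ≤ w → length R * w ≤ u →
            EvalIn u (node (encA z) (encL R) ∷ []) distE (encodeℕ (sumD z R)) 100
eval-dist {w = w} z R n≤w le = ≤-coeff (eval-caseN (eval-var 0F)
  (eval-value (cong encodeℕ (trans (foldl-addD z 0 R) (+-identityʳ _)))
    (eval-fold w encA encodeℕ (addD z) (λ _ _ → ⊤)
      (λ y _ c _ → tt , λ _ _ _ → eval-caseN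
        (eval-value (cong encDist (foldl-distStep z y c))
          (eval-fold 1 encodeBit encDist distStep (λ _ _ → ⊤) (λ x _ st _ → tt , body x st)
            (toList z) (toList y , c) tt
            (≤-trans (≤-reflexive (trans (*-identityʳ _) (length-toList z))) n≤w)
            (eval-var 5F) (eval-cons (eval-var 0F) (eval-var 3F))))
        (eval-var 1F))
      R 0 tt le (eval-var 1F) eval-nil)))
  where
  body : ∀ {m} {ρ : Vec Tree m} x st t l y → EvalIn 1 (encodeBit x ∷ t ∷ l ∷ encDist st ∷ y ∷ ρ) distBodyE (encDist (distStep st x)) 20
  body x     ([]         , c) t l y = ≤-coeff (eval-caseN (eval-var 3F) (eval-caseL (eval-var 0F) (eval-cons eval-nil (eval-var 1F))))
  body false (false ∷ ys , c) t l y = ≤-coeff (eval-caseN (eval-var 3F) (eval-caseN (eval-var 0F) (eval-cons (eval-var 1F)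
    (eval-caseL (eval-var 0F) (eval-caseL (eval-var 4F) (eval-var 3F))))))
  body true  (false ∷ ys , c) t l y = ≤-coeff (eval-caseN (eval-var 3F) (eval-caseN (eval-var 0F) (eval-cons (eval-var 1F)
    (eval-caseL (eval-var 0F) (eval-caseN (eval-var 4F) (eval-cons eval-nil (eval-var 5F)))))))
  body false (true  ∷ ys , c) t l y = ≤-coeff (eval-caseN (eval-var 3F) (eval-caseN (eval-var 0F) (eval-cons (eval-var 1F)
    (eval-caseN (eval-var 0F) (eval-caseL (eval-var 6F) (eval-cons eval-nil (eval-var 5F)))))))
  body true  (true  ∷ ys , c) t l y = ≤-coeff (eval-caseN (eval-var 3F) (eval-caseN (eval-var 0F) (eval-cons (eval-var 1F)
    (eval-caseN (eval-var 0F) (eval-caseN (eval-var 6F) (eval-var 7F))))))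

times-pred : ∀ a b → times a pred b ≡ b ∸ a
times-pred zero    b       = refl
times-pred (suc a) zero    = trans (times-pred a zero) (0∸n≡0 a)
times-pred (suc a) (suc b) = times-pred a b

monusE : Exp 1
monusE = case (var 0F) nil (foldE (var 0F) (var 1F) (case (var 3F) nil (var 1F)))

eval-monus : ∀ {{_ : NonZero u}} a b → a ≤ u →
             EvalIn u (node (encodeℕ a) (encodeℕ b) ∷ []) monusE (encodeℕ (b ∸ a)) 30
eval-monus a b le = ≤-coeff (eval-caseN (eval-var 0F)
  (eval-value (cong encodeℕ (times-pred a b))
    (eval-times 1 encodeℕ pred (λ _ _ → ⊤) (λ _ st _ → tt , body st) a b tt (≤-trans (≤-reflexive (*-identityʳ a)) le)
      (eval-var 0F) (eval-var 1F))))
  where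
  body : ∀ st h t l y → EvalIn 1 (h ∷ t ∷ l ∷ encodeℕ st ∷ y ∷ _) _ (encodeℕ (pred st)) 3
  body zero    h t l y = eval-caseL (eval-var 3F) eval-nil
  body (suc c) h t l y = eval-caseN (eval-var 3F) (eval-var 1F)

choose : Vec Bool n → Vec Bool n → ℕ → Vec Bool n
choose a z zero    = a
choose a z (suc _) = z

-- Only a strict gain replaces the current choice. Hence an exchange always raises the potential,
-- and without a gain the old member itself stays.
better : List (Vec Bool n) → Vec Bool n → Vec Bool n → Vec Bool n
better R a z = choose a z (sumD z R ∸ sumD a R)

best : List (Vec Bool n) → List (Vec Bool n) → Vec Bool n → Vec Bool n
best C R y = foldl (better R) y C

betterE : Exp (9 + m)
betterE = case (call monusE (cons (call distE (cons (var 3F) (var 6F))) (call distE (cons (var 0F) (var 6F))))) (var 3F) (var 2F)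

bestE : Exp 1
bestE = case (var 0F) nil (case (var 0F) nil (foldE (var 3F) (var 0F) betterE))

-- Round robin: the member on trial leaves at the front and its successor joins at the back. So
-- `length S` steps try every member once and, if nothing is gained, restore the list.
improve : List (Vec Bool n) → List (Vec Bool n) → List (Vec Bool n)
improve C []      = []
improve C (y ∷ R) = R ∷ʳ best C R y

length-improve : ∀ (C S : List (Vec Bool n)) → length (improve C S) ≡ length S
length-improve C []      = refl
length-improve C (y ∷ R) = trans (length-++ R {best C R y ∷ []}) (+-comm (length R) 1)

improveE : Exp 1
improveE = case (var 0F) nil (case (var 1F) nil
  (call revE (cons (call revE (cons (var 1F) nil)) (cons (call bestE (cons (cons (var 0F) (var 1F)) (var 2F))) nil))))

module _ {u w w₁ : ℕ} {{_ : NonZero u}} {{_ : NonZero w}} {{_ : NonZero w₁}} {n : ℕ} (n≤w₁ : n ≤ w₁) where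

  eval-best : ∀ (C R : List (Vec Bool n)) y → length R * w₁ ≤ w → length C * w ≤ u →
              EvalIn u (node (node (encA y) (encL R)) (encL C) ∷ []) bestE (encA (best C R y)) 300
  eval-best C R y R≤w C≤u = ≤-coeff (eval-caseN (eval-var 0F) (eval-caseN (eval-var 0F)
    (eval-fold w encA encA (better R) (λ _ _ → ⊤) (λ z _ a _ → tt , body z a) C y tt C≤u (eval-var 3F) (eval-var 0F))))
    where
    pick : ∀ {m} {ρ : Vec Tree m} (z a : Vec Bool n) d e₁ e₂ → EvalIn w ρ e₁ (encA a) 1 → (∀ {h t} → EvalIn w (h ∷ t ∷ ρ) e₂ (encA z) 1) →
           ∀ {e} → EvalIn w ρ e (encodeℕ d) 270 → EvalIn w ρ (case e e₁ e₂) (encA (choose a z d)) 272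
    pick z a zero    e₁ e₂ p q r = eval-caseL r p
    pick z a (suc d) e₁ e₂ p q r = eval-caseN r q
    body : ∀ z a t l x → EvalIn w (encA z ∷ t ∷ l ∷ encA a ∷ x ∷ encA y ∷ encL R ∷ _ ∷ _ ∷ _) betterE (encA (better R a z)) 272
    body z a t l x = pick z a (sumD z R ∸ sumD a R) (var 3F) (var 2F) (eval-var 3F) (eval-var 2F)
      (≤-coeff (eval-call (eval-cons
          (eval-call (eval-cons (eval-var 3F) (eval-var 6F)) (eval-dist a R n≤w₁ R≤w))
          (eval-call (eval-cons (eval-var 0F) (eval-var 6F)) (eval-dist z R n≤w₁ R≤w)))
        (eval-monus (sumD a R) (sumD z R) (≤-trans (sumD≤ a R) (≤-trans (*-monoʳ-≤ (length R) n≤w₁) R≤w)))))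

  eval-improve : ∀ C S → length S * w₁ ≤ w → length C * w ≤ u → length S ≤ u →
                 EvalIn u (node (encL C) (encL S) ∷ []) improveE (encL (improve C S)) 400
  eval-improve C []      S≤w C≤u S≤u = ≤-coeff (eval-caseN (eval-var 0F) (eval-caseL (eval-var 1F) eval-nil))
  eval-improve C (y ∷ R) S≤w C≤u S≤u = ≤-coeff (eval-caseN (eval-var 0F) (eval-caseN (eval-var 1F)
    (eval-call (eval-cons (eval-call (eval-cons (eval-var 1F) eval-nil) (eval-rev encA R [] R≤u))
                 (eval-cons (eval-call (eval-cons (eval-cons (eval-var 0F) (eval-var 1F)) (eval-var 2F))
                   (eval-best C R y (≤-trans (m≤n+m (length R * w₁) w₁) S≤w) C≤u)) eval-nil))
      (eval-value (cong encL (trans (ʳ++-defn (R ʳ++ [])) (cong (_++ (best C R y ∷ [])) (reverse-involutive R))))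
        (eval-rev encA (R ʳ++ []) (best C R y ∷ []) (≤-trans (≤-reflexive (length-ʳ++-[] R)) R≤u))))))
    where
    R≤u : length R ≤ u
    R≤u = ≤-trans (n≤1+n _) S≤u

-- The number of sweeps is fixed rather than tested for: `suc n * (s * s)` exceeds the largest value
-- s² n of the potential, so some sweep gains nothing. A sweep has `s` steps, and each step measures
-- every candidate against about `s` words.
localSearch : ℕ → ℕ → List (Vec Bool n) → List (Vec Bool n) → List (Vec Bool n)
localSearch n s C = times (suc n) (times s (times s (times s (improve C))))

times-replicate : ∀ {A : Set} s (z : A) xs → length (times s (z ∷_) xs) ≡ s + length xs
times-replicate zero    z xs = refl
times-replicate (suc s) z xs = trans (times-replicate s z (z ∷ xs)) (+-suc s _)

times-length : ∀ {A : Set} s (f : List A → List A) → (∀ xs → length (f xs) ≡ length xs) → ∀ xs → length (times s f xs) ≡ length xs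
times-length zero    f h xs = refl
times-length (suc s) f h xs = trans (times-length s f h (f xs)) (h xs)

-- The default for an empty list of candidates is reached only if the formula is unsatisfiable.
disperse : ℕ → ℕ → List (Vec Bool n) → List (Vec Bool n)
disperse n s []      = []
disperse n s (z ∷ C) = localSearch n s (z ∷ C) (times s (z ∷_) [])

-- The four nested loops see the candidates and s at de Bruijn indices
-- shifted by 5 for each enclosing loop.
searchE : Exp (6 + m)
searchE = foldE (cons nil (var 5F)) (foldE (var 3F) nil (cons (var 5F) (var 3F)))
  (foldE (var 8F) (var 3F) (foldE (var (# 13)) (var 3F) (foldE (var (# 18)) (var 3F)
    (call improveE (cons (var (# 22)) (var 3F))))))

-- The unit `w` is for comparing two candidates and `v` for one best response; the four loops put
-- `suc n * (s * (s * s))` of the latter into `u`.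
module _ {u v w w₁ : ℕ} {{_ : NonZero u}} {{_ : NonZero v}} {{_ : NonZero w}} {{_ : NonZero w₁}} {n s : ℕ} (n≤w₁ : n ≤ w₁)
         {C : List (Vec Bool n)} (s≤w : s * w₁ ≤ w) (C≤v : length C * w ≤ v) (s≤v : s ≤ v)
         (u≤ : suc n * (s * (s * (s * v))) ≤ u) (s≤u : s ≤ u) (sv : s * v ≤ u) .{{_ : NonZero s}} where

  private
    Size : ℕ → List (Vec Bool n) → Set
    Size _ S = length S ≡ s

    instance
      v₁≢0 : NonZero (s * v)
      v₁≢0 = m*n≢0 s v
      v₂≢0 : NonZero (s * (s * v))
      v₂≢0 = m*n≢0 s (s * v)
      v₃≢0 : NonZero (s * (s * (s * v)))
      v₃≢0 = m*n≢0 s (s * (s * v))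

    len₀ : ∀ S → length (improve C S) ≡ length S
    len₀ = length-improve C
    len₁ : ∀ S → length (times s (improve C) S) ≡ length S
    len₁ = times-length s _ len₀
    len₂ : ∀ S → length (times s (times s (improve C)) S) ≡ length S
    len₂ = times-length s _ len₁
    len₃ : ∀ S → length (times s (times s (times s (improve C))) S) ≡ length S
    len₃ = times-length s _ len₂

  eval-search : ∀ z {t₁ t₂ t₃ t₄} → EvalIn u (encA z ∷ t₁ ∷ encL C ∷ encodeℕ s ∷ t₂ ∷ encodeℕ n ∷ t₃ ∷ t₄ ∷ []) searchE
                  (encL (localSearch n s C (times s (z ∷_) []))) 600
  eval-search z = ≤-coeff
    (eval-times (s * (s * (s * v))) encL (times s (times s (times s (improve C)))) Size
      (λ _ S lS → trans (len₃ S) lS , λ _ _ _ _ →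
        eval-times (s * (s * v)) encL (times s (times s (improve C))) Size
          (λ _ S lS → trans (len₂ S) lS , λ _ _ _ _ →
            eval-times (s * v) encL (times s (improve C)) Size
              (λ _ S lS → trans (len₁ S) lS , λ _ _ _ _ →
                eval-times v encL (improve C) Size
                  (λ _ S lS → trans (len₀ S) lS , λ _ _ _ _ →
                    eval-call (eval-cons (eval-var (# 22)) (eval-var 3F))
                      (eval-improve n≤w₁ C S (subst (λ l → l * w₁ ≤ w) (sym lS) s≤w) C≤v (subst (_≤ v) (sym lS) s≤v)))
                  s S lS ≤-refl (eval-var (# 18)) (eval-var 3F))
              s S lS ≤-refl (eval-var (# 13)) (eval-var 3F))
          s S lS ≤-refl (eval-var 8F) (eval-var 3F))
      (suc n) (times s (z ∷_) []) (trans (times-replicate s z []) (+-identityʳ s)) u≤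
      (eval-cons eval-nil (eval-var 5F))
      (eval-times 1 encL (z ∷_) (λ _ _ → ⊤) (λ _ _ _ → tt , λ _ _ _ _ → eval-cons (eval-var 5F) (eval-var 3F))
        s [] tt (≤-trans (≤-reflexive (*-identityʳ s)) s≤u) (eval-var 3F) eval-nil))

mainE : ℕ → ℕ → List (List (Vec Bool m)) → Exp 1
mainE b′ r fam = case (var 0F) nil (case (var 1F) nil
  (bind (call (candidatesE b′ r fam) (cons (var 2F) (var 1F))) (case (var 0F) nil searchE)))

eval-main : ∀ {u n} {{u≢0 : NonZero u}} b′ r (fam : List (List (Vec Bool m))) (F : CNF n) s {C : List (Vec Bool n)} →
  EvalIn u (node (encodeℕ n) (encF F) ∷ []) (candidatesE b′ r fam) (encL C) 1100 →
  (∀ z {t₁ t₂ t₃ t₄} → EvalIn u (encA z ∷ t₁ ∷ encL C ∷ encodeℕ s ∷ t₂ ∷ encodeℕ n ∷ t₃ ∷ t₄ ∷ []) searchE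
                         (encL (localSearch n s C (times s (z ∷_) []))) 600) →
  EvalIn u (encodeInput F s ∷ []) (mainE b′ r fam) (encL (disperse n s C)) 2000
eval-main {u = u} {n = n} b′ r fam F s {C} cand search = ≤-coeff (eval-caseN (eval-var 0F) (eval-caseN (eval-var 1F)
  (eval-bind (eval-call (eval-cons (eval-var 2F) (eval-var 1F)) cand) (rest C search))))
  where
  rest : ∀ (C : List (Vec Bool n)) → (∀ z {t₁ t₂ t₃ t₄} → EvalIn u (encA z ∷ t₁ ∷ encL C ∷ encodeℕ s ∷ t₂ ∷ encodeℕ n ∷ t₃ ∷ t₄ ∷ []) searchE
                         (encL (localSearch n s C (times s (z ∷_) [])))  600) →
         EvalIn u (encL C ∷ _) (case (var 0F) nil searchE) (encL (disperse n s C)) 700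
  rest []      h = ≤-coeff (eval-caseL (eval-var 0F) eval-nil)
  rest (z ∷ C) h = ≤-coeff (eval-caseN (eval-var 0F) (h z))

-- Covering codes

^-distribʳ-* : ∀ m x y → (x * y) ^ m ≡ x ^ m * y ^ m
^-distribʳ-* zero    x y = refl
^-distribʳ-* (suc m) x y rewrite ^-distribʳ-* m x y =
  solve 4 (λ x y p q → x :* y :* (p :* q) := x :* p :* (y :* q)) refl x y (x ^ m) (y ^ m)

sumTo : ℕ → (ℕ → ℕ) → ℕ
sumTo zero    g = 0
sumTo (suc m) g = g 0 + sumTo m (g ∘ suc)

sumTo-cong : ∀ m {f g} → (∀ i → f i ≡ g i) → sumTo m f ≡ sumTo m g
sumTo-cong zero    h = refl
sumTo-cong (suc m) h = cong₂ _+_ (h 0) (sumTo-cong m (h ∘ suc))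

sumTo-+ : ∀ m f g → sumTo m (λ i → f i + g i) ≡ sumTo m f + sumTo m g
sumTo-+ zero    f g = refl
sumTo-+ (suc m) f g rewrite sumTo-+ m (f ∘ suc) (g ∘ suc) =
  interchange (f 0) (g 0) (sumTo m (f ∘ suc)) (sumTo m (g ∘ suc))

sumTo-* : ∀ m c f → sumTo m (λ i → c * f i) ≡ c * sumTo m f
sumTo-* zero    c f = sym (*-zeroʳ c)
sumTo-* (suc m) c f rewrite sumTo-* m c (f ∘ suc) = sym (*-distribˡ-+ c (f 0) _)

sumTo-last : ∀ m g → sumTo (suc m) g ≡ sumTo m g + g m
sumTo-last zero    g = +-identityʳ (g 0)
sumTo-last (suc m) g = trans (cong (g 0 +_) (sumTo-last m (g ∘ suc))) (sym (+-assoc (g 0) _ _))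

sumTo-max : ∀ m g → ∃[ r ] sumTo (suc m) g ≤ suc m * g r
sumTo-max zero    g = 0 , ≤-reflexive refl
sumTo-max (suc m) g with r , le ← sumTo-max m (g ∘ suc) with ≤-total (g 0) (g (suc r))
... | inj₁ h = suc r , +-mono-≤ h le
... | inj₂ h = 0 , +-monoʳ-≤ (g 0) (≤-trans le (*-monoʳ-≤ (suc m) h))

sumCube : ∀ b → (Vec Bool b → ℕ) → ℕ
sumCube zero    f = f []
sumCube (suc b) f = sumCube b (f ∘ (false ∷_)) + sumCube b (f ∘ (true ∷_))

sumCube-cong : ∀ b {f g : Vec Bool b → ℕ} → (∀ x → f x ≡ g x) → sumCube b f ≡ sumCube b g
sumCube-cong zero    h = h []
sumCube-cong (suc b) h = cong₂ _+_ (sumCube-cong b (h ∘ (false ∷_))) (sumCube-cong b (h ∘ (true ∷_)))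

sumCube-+ : ∀ b f g → sumCube b (λ x → f x + g x) ≡ sumCube b f + sumCube b g
sumCube-+ zero    f g = refl
sumCube-+ (suc b) f g rewrite sumCube-+ b (f ∘ (false ∷_)) (g ∘ (false ∷_)) | sumCube-+ b (f ∘ (true ∷_)) (g ∘ (true ∷_)) =
  interchange (sumCube b (f ∘ (false ∷_))) (sumCube b (g ∘ (false ∷_))) (sumCube b (f ∘ (true ∷_))) (sumCube b (g ∘ (true ∷_)))

sumCube-0 : ∀ b → sumCube b (λ _ → 0) ≡ 0
sumCube-0 zero    = refl
sumCube-0 (suc b) rewrite sumCube-0 b = refl

sumCube-max : ∀ b f → ∃[ c ] sumCube b f ≤ 2 ^ b * f c
sumCube-max zero    f = [] , ≤-reflexive (sym (*-identityˡ _))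
sumCube-max (suc b) f with c , le ← sumCube-max b (f ∘ (false ∷_)) with d , le′ ← sumCube-max b (f ∘ (true ∷_))
  with ≤-total (f (false ∷ c)) (f (true ∷ d))
... | inj₁ h = true ∷ d , ≤-trans (+-mono-≤ (≤-trans le (*-monoʳ-≤ (2 ^ b) h)) le′)
                 (≤-reflexive (solve 2 (λ p x → p :* x :+ p :* x := con 2 :* p :* x) refl (2 ^ b) (f (true ∷ d))))
... | inj₂ h = false ∷ c , ≤-trans (+-mono-≤ le (≤-trans le′ (*-monoʳ-≤ (2 ^ b) h)))
                 (≤-reflexive (solve 2 (λ p x → p :* x :+ p :* x := con 2 :* p :* x) refl (2 ^ b) (f (false ∷ c))))

length-cartesianProductWith : ∀ {A B C : Set} (f : A → B → C) xs ys → length (cartesianProductWith f xs ys) ≡ length xs * length ys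
length-cartesianProductWith f []       ys = refl
length-cartesianProductWith f (x ∷ xs) ys = trans (length-++ (map (f x) ys))
  (cong₂ _+_ (length-map (f x) ys) (length-cartesianProductWith f xs ys))

length-bitVectors : ∀ n → length (bitVectors n) ≡ 2 ^ n
length-bitVectors zero    = refl
length-bitVectors (suc n) = trans (length-cartesianProductWith _∷_ (false ∷ true ∷ []) (bitVectors n)) (cong (2 *_) (length-bitVectors n))

-- Spheres and the choice of the radius

δ : ℕ → ℕ → ℕ
δ zero    zero    = 1
δ zero    (suc _) = 0
δ (suc _) zero    = 0
δ (suc a) (suc b) = δ a b

binom : ℕ → ℕ → ℕ
binom zero    zero    = 1
binom zero    (suc r) = 0
binom (suc b) zero    = binom b zero
binom (suc b) (suc r) = binom b r + binom b (suc r)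

binom≤2^ : ∀ b r → binom b r ≤ 2 ^ b
binom≤2^ zero    zero    = ≤-refl
binom≤2^ zero    (suc r) = z≤n
binom≤2^ (suc b) zero    = ≤-trans (binom≤2^ b zero) (m≤m+n (2 ^ b) _)
binom≤2^ (suc b) (suc r) = +-mono-≤ (binom≤2^ b r) (≤-trans (binom≤2^ b (suc r)) (m≤m+n (2 ^ b) 0))

-- Fixing the first bit of the centre leaves distance `r` or `r - 1` for the others, which is
-- Pascal's rule.
sphere : ∀ b r (x : Vec Bool b) → sumCube b (λ c → δ r (d-H c x)) ≡ binom b r
sphere zero    zero    []          = refl
sphere zero    (suc r) []          = refl
sphere (suc b) zero    (false ∷ x) = trans (cong₂ _+_ (sphere b zero x) (sumCube-0 b)) (+-identityʳ _)
sphere (suc b) zero    (true ∷ x)  = cong₂ _+_ (sumCube-0 b) (sphere b zero x)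
sphere (suc b) (suc r) (false ∷ x) = trans (cong₂ _+_ (sphere b (suc r) x) (sphere b r x)) (+-comm (binom b (suc r)) _)
sphere (suc b) (suc r) (true ∷ x)  = cong₂ _+_ (sphere b r x) (sphere b (suc r) x)

module _ (k : ℕ) where

  -- term b r = binom b r * k ^ (b - r), the r-th term of the expansion of (k + 1) ^ b.
  term : ℕ → ℕ → ℕ
  term zero    zero    = 1
  term zero    (suc r) = 0
  term (suc b) zero    = k * term b zero
  term (suc b) (suc r) = term b r + k * term b (suc r)

  -- The closed form of `term`, multiplied by `k ^ r` so that no truncated subtraction occurs.
  term-binom : ∀ b r → term b r * k ^ r ≡ binom b r * k ^ b
  term-binom zero    zero    = refl
  term-binom zero    (suc r) = refl
  term-binom (suc b) zero    = trans (solve 2 (λ k t → k :* t :* con 1 := k :* (t :* con 1)) refl k (term b 0))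
    (trans (cong (k *_) (term-binom b zero)) (solve 3 (λ k n p → k :* (n :* p) := n :* (k :* p)) refl k (binom b 0) (k ^ b)))
  term-binom (suc b) (suc r) = begin
    (term b r + k * term b (suc r)) * (k * k ^ r) ≡⟨ solve 4 (λ a k c p → (a :+ k :* c) :* (k :* p) := k :* (a :* p) :+ k :* (c :* (k :* p))) refl (term b r) k (term b (suc r)) (k ^ r) ⟩
    k * (term b r * k ^ r) + k * (term b (suc r) * k ^ suc r) ≡⟨ cong₂ (λ x y → k * x + k * y) (term-binom b r) (term-binom b (suc r)) ⟩
    k * (binom b r * k ^ b) + k * (binom b (suc r) * k ^ b) ≡⟨ solve 4 (λ k x y p → k :* (x :* p) :+ k :* (y :* p) := (x :+ y) :* (k :* p)) refl k (binom b r) (binom b (suc r)) (k ^ b) ⟩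
    (binom b r + binom b (suc r)) * (k * k ^ b) ∎
    where open ≡-Reasoning

  term-> : ∀ b i → term b (suc i + b) ≡ 0
  term-> zero    i = refl
  term-> (suc b) i rewrite +-suc i b | term-> b i | term-> b (suc i) = *-zeroʳ k

  moment : ℕ → (ℕ → ℕ) → ℕ
  moment b f = sumTo (suc b) (λ r → term b r * f r)

  moment-suc : ∀ b f → moment (suc b) f ≡ k * moment b f + moment b (f ∘ suc)
  moment-suc b f = begin
    k * term b 0 * f 0 + sumTo (suc b) (λ r → (term b r + k * term b (suc r)) * f (suc r))
      ≡⟨ cong₂ _+_ (*-assoc k _ _) (trans (sumTo-cong (suc b) (λ r → solve 4 (λ a k c p → (a :+ k :* c) :* p := k :* (c :* p) :+ a :* p) refl (term b r) k (term b (suc r)) (f (suc r))))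
          (trans (sumTo-+ (suc b) (λ r → k * (term b (suc r) * f (suc r))) (λ r → term b r * f (suc r))) (cong (_+ moment b (f ∘ suc)) (sumTo-* (suc b) k (λ r → term b (suc r) * f (suc r)))))) ⟩
    k * (term b 0 * f 0) + (k * sumTo (suc b) (λ r → term b (suc r) * f (suc r)) + moment b (f ∘ suc))
      ≡⟨ solve 4 (λ k x y z → k :* x :+ (k :* y :+ z) := k :* (x :+ y) :+ z) refl k (term b 0 * f 0) (sumTo (suc b) (λ r → term b (suc r) * f (suc r))) (moment b (f ∘ suc)) ⟩
    k * sumTo (suc (suc b)) (λ r → term b r * f r) + moment b (f ∘ suc)
      ≡⟨ cong (λ x → k * x + moment b (f ∘ suc)) (trans (sumTo-last (suc b) (λ r → term b r * f r)) (trans (cong (λ x → moment b f + x * f (suc b)) (term-> b 0)) (+-identityʳ _))) ⟩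
    k * moment b f + moment b (f ∘ suc) ∎
    where open ≡-Reasoning

  -- Under the weights `term b r` the value `r` is binomially distributed with success probability
  -- 1/(k + 1), so its mean is b/(k + 1). The factor `suc k` keeps the identity integral; `c` is
  -- general because shifting `r` by one in the recursion changes it.
  moment-affine : ∀ b c e → moment b (λ r → c + e * (suc k * r)) ≡ (c + e * b) * suc k ^ b
  moment-affine zero    c e = solve 3 (λ c e k → con 1 :* (c :+ e :* ((con 1 :+ k) :* con 0)) :+ con 0 := (c :+ e :* con 0) :* con 1) refl c e k
  moment-affine (suc b) c e = begin
    moment (suc b) (λ r → c + e * (suc k * r)) ≡⟨ moment-suc b (λ r → c + e * (suc k * r)) ⟩
    k * moment b (λ r → c + e * (suc k * r)) + moment b (λ r → c + e * (suc k * suc r))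
      ≡⟨ cong (λ x → k * moment b (λ r → c + e * (suc k * r)) + x) (sumTo-cong (suc b) (λ r → cong (term b r *_) (solve 4 (λ c e k r → c :+ e :* ((con 1 :+ k) :* (con 1 :+ r)) := (c :+ e :* (con 1 :+ k)) :+ e :* ((con 1 :+ k) :* r)) refl c e k r))) ⟩
    k * moment b (λ r → c + e * (suc k * r)) + moment b (λ r → (c + e * suc k) + e * (suc k * r))
      ≡⟨ cong₂ (λ x y → k * x + y) (moment-affine b c e) (moment-affine b (c + e * suc k) e) ⟩
    k * ((c + e * b) * suc k ^ b) + (c + e * suc k + e * b) * suc k ^ b
      ≡⟨ solve 5 (λ k c e b p → k :* ((c :+ e :* b) :* p) :+ (c :+ e :* (con 1 :+ k) :+ e :* b) :* p := (c :+ e :* (con 1 :+ b)) :* ((con 1 :+ k) :* p)) refl k c e b (suc k ^ b) ⟩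
    (c + e * suc b) * (suc k * suc k ^ b) ∎
    where open ≡-Reasoning

  moment-mono : ∀ b {f g} → (∀ r → f r ≤ g r) → moment b f ≤ moment b g
  moment-mono b {f} {g} h = go (suc b) (term b) f g h
    where
    go : ∀ m (t f g : ℕ → ℕ) → (∀ r → f r ≤ g r) → sumTo m (λ r → t r * f r) ≤ sumTo m (λ r → t r * g r)
    go zero    t f g h = z≤n
    go (suc m) t f g h = +-mono-≤ (*-monoʳ-≤ (t 0) (h 0)) (go m (t ∘ suc) (f ∘ suc) (g ∘ suc) (h ∘ suc))

  -- The mean of r under the weights term b r is b / (k + 1), so some term with
  -- r ≤ 2 b / (k + 1) carries a fair share of the total weight.
  good-radius : ∀ b .{{_ : NonZero b}} → ∃[ r ] suc k * r ≤ 2 * b × suc k ^ b ≤ 2 * suc b * term b r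
  good-radius b with r , le ← sumTo-max b (λ r → term b r * (2 * b ∸ suc k * r)) = r , r≤ , total≤
    where
    -- Truncation can only raise the mean of 2 b - (k + 1) r, which is b. A positive summand forces
    -- the bound on `r`, and since `f r` is at most 2 b, the largest summand has a weight of at
    -- least 1/(2 (b + 1)) of the total.
    f : ℕ → ℕ
    f r = 2 * b ∸ suc k * r
    lower : b * suc k ^ b ≤ moment b f
    lower = +-cancelʳ-≤ (b * suc k ^ b) _ _ (begin
      b * suc k ^ b + b * suc k ^ b ≡⟨ solve 2 (λ b p → b :* p :+ b :* p := (con 2 :* b :+ con 0 :* b) :* p) refl b (suc k ^ b) ⟩
      (2 * b + 0 * b) * suc k ^ b ≡⟨ sym (moment-affine b (2 * b) 0) ⟩
      moment b (λ r → 2 * b + 0 * (suc k * r)) ≤⟨ moment-mono b (λ r → ≤-trans (≤-reflexive (+-identityʳ (2 * b))) (≤-trans (m≤n+m∸n (2 * b) (suc k * r)) (≤-reflexive (+-comm (suc k * r) (f r))))) ⟩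
      moment b (λ r → f r + suc k * r) ≡⟨ trans (sumTo-cong (suc b) (λ r → *-distribˡ-+ (term b r) (f r) (suc k * r))) (sumTo-+ (suc b) (λ r → term b r * f r) (λ r → term b r * (suc k * r))) ⟩
      moment b f + moment b (λ r → suc k * r) ≡⟨ cong (moment b f +_) (trans (sumTo-cong (suc b) (λ r → cong (term b r *_) (sym (+-identityʳ (suc k * r))))) (moment-affine b 0 1)) ⟩
      moment b f + (0 + 1 * b) * suc k ^ b ≡⟨ cong (λ x → moment b f + x * suc k ^ b) (+-identityʳ b) ⟩
      moment b f + b * suc k ^ b ∎)
      where open ≤-Reasoning
    share : b * suc k ^ b ≤ suc b * (term b r * f r)
    share = ≤-trans lower le
    r≤ : suc k * r ≤ 2 * b
    r≤ with suc k * r ≤? 2 * b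
    ... | yes p = p
    ... | no ¬p = contradiction
      (≤-trans (>-nonZero⁻¹ (b * suc k ^ b) {{m*n≢0 b (suc k ^ b) {{it}} {{m^n≢0 (suc k) b}}}})
        (≤-trans share (≤-reflexive (trans (cong (λ x → suc b * (term b r * x)) (m≤n⇒m∸n≡0 (<⇒≤ (≰⇒> ¬p))))
          (trans (cong (suc b *_) (*-zeroʳ (term b r))) (*-zeroʳ (suc b)))))))
      (λ ())
    total≤ : suc k ^ b ≤ 2 * suc b * term b r
    total≤ = *-cancelˡ-≤ b (≤-trans share (≤-trans (*-monoʳ-≤ (suc b) (*-monoʳ-≤ (term b r) (m∸n≤m (2 * b) (suc k * r))))
      (≤-reflexive (solve 3 (λ b s t → s :* (t :* (con 2 :* b)) := b :* (con 2 :* s :* t)) refl b (suc b) (term b r)))))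

-- Greedy covering

module _ {b : ℕ} (r : ℕ) where

  hits : Vec Bool b → List (Vec Bool b) → ℕ
  hits c []      = 0
  hits c (x ∷ R) = δ r (d-H c x) + hits c R

  sumCube-hits : ∀ R → sumCube b (λ c → hits c R) ≡ length R * binom b r
  sumCube-hits []      = sumCube-0 b
  sumCube-hits (x ∷ R) = trans (sumCube-+ b (λ c → δ r (d-H c x)) (λ c → hits c R)) (cong₂ _+_ (sphere b r x) (sumCube-hits R))

  δ-cases : ∀ a b → (a ≡ b × δ a b ≡ 1) ⊎ δ a b ≡ 0
  δ-cases zero    zero    = inj₁ (refl , refl)
  δ-cases zero    (suc b) = inj₂ refl
  δ-cases (suc a) zero    = inj₂ refl
  δ-cases (suc a) (suc b) with δ-cases a b
  ... | inj₁ (refl , eq) = inj₁ (refl , eq)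
  ... | inj₂ eq          = inj₂ eq

  miss : ∀ c R → ∃[ U ] length U + hits c R ≡ length R × (∀ {x} → x ∈ R → x ∈ U ⊎ d-H c x ≡ r)
  miss c [] = [] , refl , λ ()
  miss c (x ∷ R) with U , eq , cov ← miss c R with δ-cases r (d-H c x)
  ... | inj₁ (h , eq′) = U , trans (cong (λ z → length U + (z + hits c R)) eq′) (trans (+-suc _ _) (cong suc eq)) ,
          λ { (here refl) → inj₂ (sym h) ; (there x∈) → cov x∈ }
  ... | inj₂ eq′ = x ∷ U , cong suc (trans (cong (λ z → length U + (z + hits c R)) eq′) eq) ,
          λ { (here refl) → inj₁ (here refl) ; (there x∈) → map₁ there (cov x∈) }

  Covered : List (Vec Bool b) → Vec Bool b → Set
  Covered K x = ∃[ c ] c ∈ K × d-H c x ≡ r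

  module _ {y : ℕ} (split : y + binom b r ≡ 2 ^ b) where

    -- By the double count `sumCube-hits`, the best centre covers at least a fraction
    -- `binom b r / 2 ^ b` of what is left. So each step leaves at most the fraction `y / 2 ^ b`.
    greedy : ∀ M R → ∃[ K ] length K ≡ M × ∃[ U ] length U * (2 ^ b) ^ M ≤ length R * y ^ M ×
             (∀ {x} → x ∈ R → x ∈ U ⊎ Covered K x)
    greedy zero    R = [] , refl , R , ≤-refl , inj₁
    greedy (suc M) R with c , le ← sumCube-max b (λ c → hits c R)
      with R′ , eq , cov ← miss c R
      with K , lK , U , le′ , cov′ ← greedy M R′ =
      c ∷ K , cong suc lK , U , bound , cover
      where
      N = 2 ^ b
      σ = binom b r
      shrink : length R′ * N ≤ length R * y
      shrink = +-cancelʳ-≤ (length R * σ) _ _ (begin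
        length R′ * N + length R * σ ≡⟨ cong (length R′ * N +_) (sym (sumCube-hits R)) ⟩
        length R′ * N + sumCube b (λ c → hits c R) ≤⟨ +-monoʳ-≤ (length R′ * N) le ⟩
        length R′ * N + N * hits c R ≡⟨ solve 3 (λ l n h → l :* n :+ n :* h := (l :+ h) :* n) refl (length R′) N (hits c R) ⟩
        (length R′ + hits c R) * N ≡⟨ cong₂ _*_ eq (sym split) ⟩
        length R * (y + σ) ≡⟨ *-distribˡ-+ (length R) y σ ⟩
        length R * y + length R * σ ∎)
        where open ≤-Reasoning
      bound : length U * (N * N ^ M) ≤ length R * (y * y ^ M)
      bound = begin
        length U * (N * N ^ M) ≡⟨ solve 3 (λ u n p → u :* (n :* p) := u :* p :* n) refl (length U) N (N ^ M) ⟩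
        length U * N ^ M * N ≤⟨ *-monoˡ-≤ N le′ ⟩
        length R′ * y ^ M * N ≡⟨ solve 3 (λ r p n → r :* p :* n := r :* n :* p) refl (length R′) (y ^ M) N ⟩
        length R′ * N * y ^ M ≤⟨ *-monoˡ-≤ (y ^ M) shrink ⟩
        length R * y * y ^ M ≡⟨ *-assoc (length R) y (y ^ M) ⟩
        length R * (y * y ^ M) ∎
        where open ≤-Reasoning
      cover : ∀ {x} → x ∈ R → x ∈ U ⊎ Covered (c ∷ K) x
      cover x∈ with cov x∈
      ... | inj₂ d = inj₂ (c , here refl , d)
      ... | inj₁ x∈′ with cov′ x∈′
      ...   | inj₁ x∈U            = inj₁ x∈U
      ...   | inj₂ (c′ , c∈ , d)  = inj₂ (c′ , there c∈ , d)

-- This is (1 - x)^t (1 + t x) ≤ 1 for x = σ/N, without fractions. The inductive step has exactly (t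
-- + 1) σ² to spare.
bernoulli : ∀ t {y σ N} → y + σ ≡ N → y ^ t * (N + t * σ) ≤ N ^ t * N
bernoulli zero {N = N} eq = ≤-reflexive (cong (_+ 0) (+-identityʳ N))
bernoulli (suc t) {y} {σ} {N} eq = begin
  y * y ^ t * (N + (σ + t * σ)) ≡⟨ solve 4 (λ y p n s → y :* p :* (n :+ s) := p :* (y :* n :+ y :* s)) refl y (y ^ t) N (σ + t * σ) ⟩
  y ^ t * (y * N + y * (σ + t * σ)) ≤⟨ *-monoʳ-≤ (y ^ t) (≤-trans (m≤m+n _ (σ * σ + σ * (t * σ))) (≤-reflexive (trans
                                                 (cong (λ n → y * n + y * (σ + t * σ) + (σ * σ + σ * (t * σ))) (sym eq))
                                                 (trans (solve 3 (λ y s u → y :* (y :+ s) :+ y :* (s :+ u) :+ (s :* s :+ s :* u) := (y :+ s) :* ((y :+ s) :+ u)) refl y σ (t * σ))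
                                                   (cong (λ n → n * (n + t * σ)) eq))))) ⟩
  y ^ t * (N * (N + t * σ)) ≡⟨ solve 3 (λ p n s → p :* (n :* s) := n :* (p :* s)) refl (y ^ t) N (N + t * σ) ⟩
  N * (y ^ t * (N + t * σ)) ≤⟨ *-monoʳ-≤ N (bernoulli t eq) ⟩
  N * (N ^ t * N) ≡⟨ sym (*-assoc N (N ^ t) N) ⟩
  N * N ^ t * N ∎
  where open ≤-Reasoning

-- Since `τ * σ` is at least `N`, `bernoulli` shows that `τ` greedy steps halve the uncovered set.
-- After `suc b` halvings fewer than one of the `2 ^ b` words is left.
covering-code : ∀ b r {{_ : NonZero (binom b r)}} →
                ∃[ K ] length K * binom b r ≤ 2 * 2 ^ b * suc b × (∀ (x : Vec Bool b) → Covered r K x)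
covering-code b r {{σ≢0}} with K , lK , U , le , cov ← greedy r {y = 2 ^ b ∸ binom b r} (m∸n+n≡m (binom≤2^ b r))
                                 (suc (2 ^ b ℕ./ binom b r) * suc b) (bitVectors b) = K , size≤ , covered
  where
  open ≤-Reasoning
  N σ y τ : ℕ
  N = 2 ^ b
  σ = binom b r
  y = N ∸ σ
  τ = suc (N ℕ./ σ)
  y+σ : y + σ ≡ N
  y+σ = m∸n+n≡m (binom≤2^ b r)
  instance
    N≢0 : NonZero N
    N≢0 = m^n≢0 2 b
  size≤ : length K * σ ≤ 2 * N * suc b
  size≤ = begin
    length K * σ ≡⟨ cong (_* σ) lK ⟩
    τ * suc b * σ ≡⟨ solve 3 (λ τ b s → τ :* b :* s := τ :* s :* b) refl τ (suc b) σ ⟩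
    τ * σ * suc b ≤⟨ *-monoˡ-≤ (suc b) (+-mono-≤ (binom≤2^ b r) (≤-trans (m/n*n≤m N σ) (m≤m+n N 0))) ⟩
    2 * N * suc b ∎
  tσ : N ≤ τ * σ
  tσ = begin
    N ≡⟨ m≡m%n+[m/n]*n N σ ⟩
    N % σ + N ℕ./ σ * σ ≤⟨ +-monoˡ-≤ (N ℕ./ σ * σ) (<⇒≤ (m%n<n N σ)) ⟩
    τ * σ ∎
  double : 2 * y ^ τ ≤ N ^ τ
  double = *-cancelʳ-≤ _ _ N (begin
    2 * y ^ τ * N ≡⟨ solve 2 (λ p n → con 2 :* p :* n := p :* (n :+ n)) refl (y ^ τ) N ⟩
    y ^ τ * (N + N) ≤⟨ *-monoʳ-≤ (y ^ τ) (+-monoʳ-≤ N tσ) ⟩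
    y ^ τ * (N + τ * σ) ≤⟨ bernoulli τ {y} {σ} {N} y+σ ⟩
    N ^ τ * N ∎)
  big : 2 ^ suc b * y ^ (τ * suc b) ≤ N ^ (τ * suc b)
  big = begin
    2 ^ suc b * y ^ (τ * suc b) ≡⟨ cong (2 ^ suc b *_) (sym (^-*-assoc y τ (suc b))) ⟩
    2 ^ suc b * (y ^ τ) ^ suc b ≡⟨ sym (^-distribʳ-* (suc b) 2 (y ^ τ)) ⟩
    (2 * y ^ τ) ^ suc b ≤⟨ ^-monoˡ-≤ (suc b) double ⟩
    (N ^ τ) ^ suc b ≡⟨ ^-*-assoc N τ (suc b) ⟩
    N ^ (τ * suc b) ∎
  -- For `u ≥ 1` the hypothesis and `big` would give 2 N y^m ≤ N y^m with m = `τ * suc b`, hence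
  -- both would vanish, but N^m is positive.
  empty : ∀ u → u * N ^ (τ * suc b) ≤ length (bitVectors b) * y ^ (τ * suc b) → u ≡ 0
  empty zero    le = refl
  empty (suc u) le = contradiction (>-nonZero⁻¹ (N ^ (τ * suc b)) {{m^n≢0 N (τ * suc b)}}) (≤⇒≯ (≤-trans N^≤ (≤-reflexive zero′)))
    where
    N^≤ : N ^ (τ * suc b) ≤ N * y ^ (τ * suc b)
    N^≤ = ≤-trans (m≤m+n _ _) (subst (λ l → suc u * N ^ (τ * suc b) ≤ l * y ^ (τ * suc b)) (length-bitVectors b) le)
    zero′ : N * y ^ (τ * suc b) ≡ 0
    zero′ = m+n≡0⇒m≡0 (N * y ^ (τ * suc b)) (n≤0⇒n≡0 (+-cancelʳ-≤ (N * y ^ (τ * suc b)) _ _ (begin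
      N * y ^ (τ * suc b) + 0 + N * y ^ (τ * suc b) ≡⟨ solve 2 (λ n p → n :* p :+ con 0 :+ n :* p := con 2 :* n :* p) refl N (y ^ (τ * suc b)) ⟩
      2 ^ suc b * y ^ (τ * suc b) ≤⟨ big ⟩
      N ^ (τ * suc b) ≤⟨ N^≤ ⟩
      0 + N * y ^ (τ * suc b) ∎)))
  covered : ∀ x → Covered r K x
  covered x with cov (bitVectors-complete x)
  ... | inj₂ p  = p
  ... | inj₁ x∈ = contradiction (nonempty x∈) (λ p → <⇒≢ p (sym (empty (length U) le)))
    where
    nonempty : ∀ {U : List (Vec Bool b)} {x} → x ∈ U → 0 < length U
    nonempty (here _)  = z<s
    nonempty (there _) = z<s

-- The cost of one block

2^-lower : ∀ l → suc l ≤ 2 ^ l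
2^-lower zero    = ≤-refl
2^-lower (suc l) = ≤-trans (+-mono-≤ (>-nonZero⁻¹ (2 ^ l) {{m^n≢0 2 l}}) (2^-lower l)) (≤-reflexive (cong (2 ^ l +_) (sym (+-identityʳ _))))

-- the first three terms of the binomial expansion, doubled
binomial-lower : ∀ k m → k ^ m * (2 * (k * k) + 2 * (m * k) + m * pred m) ≤ suc k ^ m * (2 * (k * k))
binomial-lower k zero    = ≤-reflexive (cong (_+ 0) (trans (+-identityʳ _) (+-identityʳ _)))
binomial-lower k (suc m) = begin
  k * k ^ m * (2 * (k * k) + 2 * (suc m * k) + suc m * m) ≤⟨ step m ⟩
  suc k * (k ^ m * (2 * (k * k) + 2 * (m * k) + m * pred m)) ≤⟨ *-monoʳ-≤ (suc k) (binomial-lower k m) ⟩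
  suc k * (suc k ^ m * (2 * (k * k))) ≡⟨ sym (*-assoc (suc k) (suc k ^ m) _) ⟩
  suc k * suc k ^ m * (2 * (k * k)) ∎
  where
  open ≤-Reasoning
  step : ∀ m → k * k ^ m * (2 * (k * k) + 2 * (suc m * k) + suc m * m) ≤ suc k * (k ^ m * (2 * (k * k) + 2 * (m * k) + m * pred m))
  step zero    = ≤-reflexive (solve 1 (λ k → k :* con 1 :* (con 2 :* (k :* k) :+ con 2 :* (con 1 :* k) :+ con 0) := (con 1 :+ k) :* (con 1 :* (con 2 :* (k :* k) :+ con 0 :+ con 0))) refl k)
  step (suc i) = ≤-trans (m≤m+n _ (k ^ suc i * (suc i * i))) (≤-reflexive (solve 3 (λ k p i →
      k :* p :* (con 2 :* (k :* k) :+ con 2 :* ((con 2 :+ i) :* k) :+ (con 2 :+ i) :* (con 1 :+ i)) :+ p :* ((con 1 :+ i) :* i)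
      := (con 1 :+ k) :* (p :* (con 2 :* (k :* k) :+ con 2 :* ((con 1 :+ i) :* k) :+ (con 1 :+ i) :* i))) refl k (k ^ suc i) i))

-- The first three terms of (1 + 1/k)^k add up to 5/2 - 1/(2 k), which is 7/3 at k = 3 and larger
-- beyond. The surplus over 2 has to absorb the polynomial factors.
seven-thirds : ∀ k → 3 ≤ k → 7 * k ^ k ≤ 3 * suc k ^ k
seven-thirds k@(suc k′) 3≤k = *-cancelʳ-≤ _ _ (2 * (k * k)) (begin
  7 * k ^ k * (2 * (k * k)) ≡⟨ solve 2 (λ p k → con 7 :* p :* (con 2 :* (k :* k)) := p :* (con 14 :* (k :* k))) refl (k ^ k) k ⟩
  k ^ k * (14 * (k * k)) ≤⟨ *-monoʳ-≤ (k ^ k) ineq ⟩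
  k ^ k * (3 * (2 * (k * k) + 2 * (k * k) + k * k′)) ≡⟨ solve 2 (λ p x → p :* (con 3 :* x) := con 3 :* (p :* x)) refl (k ^ k) _ ⟩
  3 * (k ^ k * (2 * (k * k) + 2 * (k * k) + k * k′)) ≤⟨ *-monoʳ-≤ 3 (binomial-lower k k) ⟩
  3 * (suc k ^ k * (2 * (k * k))) ≡⟨ sym (*-assoc 3 (suc k ^ k) _) ⟩
  3 * suc k ^ k * (2 * (k * k)) ∎)
  where
  open ≤-Reasoning
  ineq : 14 * (k * k) ≤ 3 * (2 * (k * k) + 2 * (k * k) + k * k′)
  ineq = +-cancelʳ-≤ (3 * k) _ _ (begin
    14 * (k * k) + 3 * k ≤⟨ +-monoʳ-≤ (14 * (k * k)) (*-monoˡ-≤ k 3≤k) ⟩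
    14 * (k * k) + k * k ≡⟨ solve 1 (λ k′ → let k = con 1 :+ k′ in con 14 :* (k :* k) :+ k :* k := con 3 :* (con 2 :* (k :* k) :+ con 2 :* (k :* k) :+ k :* k′) :+ con 3 :* k) refl k′ ⟩
    3 * (2 * (k * k) + 2 * (k * k) + k * k′) + 3 * k ∎)

-- since (7/6)^5 ≥ 2, the exponential catches up with the polynomial
polynomial≤exponential : ∀ k l → 4 * (suc (15 * k) * suc (15 * k)) ≤ l → let j = 5 * (3 * l) in
                         4 * (suc (k * j) * suc (k * j)) * 6 ^ j ≤ 7 ^ j
polynomial≤exponential k l large = begin
  4 * (suc (k * j′) * suc (k * j′)) * 6 ^ j′ ≤⟨ *-monoˡ-≤ (6 ^ j′) poly≤ ⟩
  2 ^ (3 * l) * 6 ^ j′ ≡⟨ cong (2 ^ (3 * l) *_) (sym (^-*-assoc 6 5 (3 * l))) ⟩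
  2 ^ (3 * l) * (6 ^ 5) ^ (3 * l) ≡⟨ sym (^-distribʳ-* (3 * l) 2 (6 ^ 5)) ⟩
  (2 * 6 ^ 5) ^ (3 * l) ≤⟨ ^-monoˡ-≤ (3 * l) (≤ᵇ⇒≤ (2 * 6 ^ 5) (7 ^ 5) _) ⟩
  (7 ^ 5) ^ (3 * l) ≡⟨ ^-*-assoc 7 5 (3 * l) ⟩
  7 ^ j′ ∎
  where
  open ≤-Reasoning
  j′ a : ℕ
  j′ = 5 * (3 * l)
  a = suc (15 * k)
  kj≤ : suc (k * j′) ≤ a * suc l
  kj≤ = ≤-trans (m≤m+n _ (15 * k + l)) (≤-reflexive (solve 2 (λ k l → con 1 :+ k :* (con 5 :* (con 3 :* l)) :+ (con 15 :* k :+ l) := (con 1 :+ con 15 :* k) :* (con 1 :+ l)) refl k l))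
  -- Of the three factors `2 ^ l`, one absorbs the constant `4 * (a * a)` and the other two absorb
  -- one `suc l` each.
  poly≤ : 4 * (suc (k * j′) * suc (k * j′)) ≤ 2 ^ (3 * l)
  poly≤ = begin
    4 * (suc (k * j′) * suc (k * j′)) ≤⟨ *-monoʳ-≤ 4 (*-mono-≤ kj≤ kj≤) ⟩
    4 * (a * suc l * (a * suc l)) ≡⟨ solve 2 (λ a l → con 4 :* (a :* l :* (a :* l)) := con 4 :* (a :* a) :* (l :* l)) refl a (suc l) ⟩
    4 * (a * a) * (suc l * suc l) ≤⟨ *-mono-≤ (≤-trans large (≤-trans (n≤1+n l) (2^-lower l))) (*-mono-≤ (2^-lower l) (2^-lower l)) ⟩
    2 ^ l * (2 ^ l * 2 ^ l) ≡⟨ trans (cong (2 ^ l *_) (sym (^-distribˡ-+-* 2 l l))) (sym (^-distribˡ-+-* 2 l (l + l))) ⟩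
    2 ^ (l + (l + l)) ≡⟨ cong (2 ^_) (solve 1 (λ l → l :+ (l :+ l) := con 3 :* l) refl l) ⟩
    2 ^ (3 * l) ∎

block-length : ∀ k → ∃[ j ] 4 * (suc (k * suc j) * suc (k * suc j)) * 6 ^ suc j ≤ 7 ^ suc j
block-length k = positive (4 * (suc (15 * k) * suc (15 * k))) {{m*n≢0 4 _}} ≤-refl
  where
  positive : ∀ l .{{_ : NonZero l}} → 4 * (suc (15 * k) * suc (15 * k)) ≤ l →
             ∃[ j ] 4 * (suc (k * suc j) * suc (k * suc j)) * 6 ^ suc j ≤ 7 ^ suc j
  positive (suc l) large = _ , polynomial≤exponential k (suc l) large

-- With `groups` = b/k, `cost≤` keeps centres times branches within 2^(b - b/k), with no constant in
-- front, since that would be raised to the number of blocks. Distance exactly `r` gives every error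
-- pattern the same weight, so that the averages below are equalities.
record BlockCode (k : ℕ) : Set where
  field
    b′ groups r  : ℕ
    words   : List (Vec Bool (suc b′))
    length≡ : suc b′ ≡ k * groups
    radius≤ : suc k * r ≤ 2 * suc b′
    cost≤   : length words * k ^ r ≤ 2 ^ ((k ∸ 1) * groups)
    covers  : ∀ x → ∃[ c ] c ∈ words × d-H c x ≡ r

-- The powers are abstracted: `A`, `B` are (k + 1)^b, k^b; `t`, `σ` are `term` and `binom`; `sb` is
-- b + 1; `tb`, `tj`, `tkj` are 2 to the powers b, j, (k - 1) j; `sj`, `thj` are 7^j, 3^j. In
-- fractions, L k^r = L σ k^b / t ≤ 4 (b + 1)² 2^b (k/(k + 1))^b, and the last power is at most
-- (3/7)^j.
module _ (L kr A B t σ sb tb tj tkj sj thj : ℕ) .{{_ : NonZero A}} .{{_ : NonZero thj}} where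

  combine-bounds : A ≤ 2 * sb * t → t * kr ≡ σ * B → L * σ ≤ 2 * tb * sb → tb ≡ tj * tkj →
                   4 * (sb * sb) * (tj * thj) ≤ sj → sj * B ≤ thj * A → L * kr ≤ tkj
  combine-bounds share eq size split big ratio = *-cancelʳ-≤ _ _ A (*-cancelʳ-≤ _ _ thj (begin
    L * kr * A * thj ≤⟨ *-monoˡ-≤ thj (*-monoʳ-≤ (L * kr) share) ⟩
    L * kr * (2 * sb * t) * thj ≡⟨ solve 5 (λ l p b t q → l :* p :* (con 2 :* b :* t) :* q := l :* (t :* p) :* (con 2 :* b :* q)) refl L kr sb t thj ⟩
    L * (t * kr) * (2 * sb * thj) ≡⟨ cong (λ x → L * x * (2 * sb * thj)) eq ⟩
    L * (σ * B) * (2 * sb * thj) ≡⟨ cong (_* (2 * sb * thj)) (sym (*-assoc L σ B)) ⟩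
    L * σ * B * (2 * sb * thj) ≤⟨ *-monoˡ-≤ (2 * sb * thj) (*-monoˡ-≤ B size) ⟩
    2 * tb * sb * B * (2 * sb * thj) ≡⟨ cong (λ x → 2 * x * sb * B * (2 * sb * thj)) split ⟩
    2 * (tj * tkj) * sb * B * (2 * sb * thj) ≡⟨ solve 5 (λ x y b p q → con 2 :* (x :* y) :* b :* p :* (con 2 :* b :* q) := y :* (con 4 :* (b :* b) :* (x :* q) :* p)) refl tj tkj sb B thj ⟩
    tkj * (4 * (sb * sb) * (tj * thj) * B) ≤⟨ *-monoʳ-≤ tkj (≤-trans (*-monoˡ-≤ B big) ratio) ⟩
    tkj * (thj * A) ≡⟨ solve 3 (λ x y z → x :* (y :* z) := x :* z :* y) refl tkj thj A ⟩
    tkj * A * thj ∎))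
    where open ≤-Reasoning

module _ (k j b : ℕ) .{{_ : NonZero k}} .{{_ : NonZero b}} (3≤k : 3 ≤ k) (b≡ : b ≡ k * j)
         (big : 4 * (suc b * suc b) * 6 ^ j ≤ 7 ^ j) where

  ratio-bound : 7 ^ j * k ^ b ≤ 3 ^ j * suc k ^ b
  ratio-bound = begin
    7 ^ j * k ^ b ≡⟨ cong (λ b → 7 ^ j * k ^ b) b≡ ⟩
    7 ^ j * k ^ (k * j) ≡⟨ cong (7 ^ j *_) (sym (^-*-assoc k k j)) ⟩
    7 ^ j * (k ^ k) ^ j ≡⟨ sym (^-distribʳ-* j 7 (k ^ k)) ⟩
    (7 * k ^ k) ^ j ≤⟨ ^-monoˡ-≤ j (seven-thirds k 3≤k) ⟩
    (3 * suc k ^ k) ^ j ≡⟨ ^-distribʳ-* j 3 (suc k ^ k) ⟩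
    3 ^ j * (suc k ^ k) ^ j ≡⟨ cong (3 ^ j *_) (trans (^-*-assoc (suc k) k j) (cong (suc k ^_) (sym b≡))) ⟩
    3 ^ j * suc k ^ b ∎
    where open ≤-Reasoning

  power-split : 2 ^ b ≡ 2 ^ j * 2 ^ ((k ∸ 1) * j)
  power-split = trans (cong (2 ^_) (trans b≡ (cong (_* j) (sym (suc-pred k))))) (^-distribˡ-+-* 2 j (pred k * j))

  CoveringBlock : Set
  CoveringBlock = ∃[ r ] ∃[ K ] suc k * r ≤ 2 * b × length K * k ^ r ≤ 2 ^ ((k ∸ 1) * j) × (∀ (x : Vec Bool b) → ∃[ c ] c ∈ K × d-H c x ≡ r)

  covering-block : CoveringBlock
  covering-block = from-radius (good-radius k b)
    where
    binom≢0 : ∀ r → suc k ^ b ≤ 2 * suc b * term k b r → NonZero (binom b r)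
    binom≢0 r share = ≢-nonZero λ σ≡0 → contradiction
      (m*n≡0⇒m≡0 (term k b r) (k ^ r) {{m^n≢0 k r}} (trans (term-binom k b r) (cong (_* k ^ b) σ≡0)))
      (λ eq → <⇒≢ (≤-trans (>-nonZero⁻¹ (suc k ^ b) {{m^n≢0 (suc k) b}}) share)
        (sym (trans (cong (2 * suc b *_) eq) (*-zeroʳ (2 * suc b)))))
    big′ : 4 * (suc b * suc b) * (2 ^ j * 3 ^ j) ≤ 7 ^ j
    big′ = subst (λ x → 4 * (suc b * suc b) * x ≤ 7 ^ j) (^-distribʳ-* j 2 3) big
    from-code : ∀ r → suc k * r ≤ 2 * b → suc k ^ b ≤ 2 * suc b * term k b r →
      (∃[ K ] length K * binom b r ≤ 2 * 2 ^ b * suc b × (∀ (x : Vec Bool b) → Covered r K x)) → CoveringBlock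
    from-code r radius share (K , size , cov) = r , K , radius ,
      combine-bounds (length K) (k ^ r) (suc k ^ b) (k ^ b) (term k b r) (binom b r) (suc b) (2 ^ b) (2 ^ j) (2 ^ ((k ∸ 1) * j)) (7 ^ j) (3 ^ j)
        {{m^n≢0 (suc k) b}} {{m^n≢0 3 j}} share (term-binom k b r) size power-split big′ ratio-bound , cov
    from-radius : (∃[ r ] suc k * r ≤ 2 * b × suc k ^ b ≤ 2 * suc b * term k b r) → CoveringBlock
    from-radius (r , radius , share) = from-code r radius share (covering-code b r {{binom≢0 r share}})

blockCode : ∀ k → 3 ≤ k → BlockCode k
blockCode k@(suc k′) 3≤k = from-length (block-length k)
  where
  from-length : (∃[ j ] 4 * (suc (k * suc j) * suc (k * suc j)) * 6 ^ suc j ≤ 7 ^ suc j) → BlockCode k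
  from-length (j , big) = from-block (covering-block k (suc j) (k * suc j) 3≤k refl big)
    where
    from-block : CoveringBlock k (suc j) (k * suc j) 3≤k refl big → BlockCode k
    from-block (r , K , radius , cost , cov) =
      record { b′ = j + k′ * suc j ; groups = suc j ; r = r ; words = K ; length≡ = refl ; radius≤ = radius ; cost≤ = cost ; covers = cov }

-- Averaging over rotations and translations

sumTo-min : ∀ m .{{_ : NonZero m}} g → ∃[ r ] r < m × m * g r ≤ sumTo m g
sumTo-min 1             g = 0 , z<s , ≤-refl
sumTo-min (suc (suc m)) g with r , r< , le ← sumTo-min (suc m) (g ∘ suc) with ≤-total (g 0) (g (suc r))
... | inj₁ h = 0 , z<s , +-monoʳ-≤ (g 0) (≤-trans (*-monoʳ-≤ (suc m) h) le)
... | inj₂ h = suc r , s<s r< , +-mono-≤ h le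

sumCube-min : ∀ b f → ∃[ c ] 2 ^ b * f c ≤ sumCube b f
sumCube-min zero    f = [] , ≤-reflexive (*-identityˡ _)
sumCube-min (suc b) f with c , le ← sumCube-min b (f ∘ (false ∷_)) with d , le′ ← sumCube-min b (f ∘ (true ∷_))
  with ≤-total (f (false ∷ c)) (f (true ∷ d))
... | inj₁ h = false ∷ c , ≤-trans (≤-reflexive (solve 2 (λ p x → con 2 :* p :* x := p :* x :+ p :* x) refl (2 ^ b) (f (false ∷ c))))
                 (+-mono-≤ le (≤-trans (*-monoʳ-≤ (2 ^ b) h) le′))
... | inj₂ h = true ∷ d , ≤-trans (≤-reflexive (solve 2 (λ p x → con 2 :* p :* x := p :* x :+ p :* x) refl (2 ^ b) (f (true ∷ d))))
                 (+-mono-≤ (≤-trans (*-monoʳ-≤ (2 ^ b) h) le) le′)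

sumCube-const : ∀ b c → sumCube b (λ _ → c) ≡ 2 ^ b * c
sumCube-const zero    c = sym (*-identityˡ c)
sumCube-const (suc b) c rewrite sumCube-const b c = solve 2 (λ p x → p :* x :+ p :* x := con 2 :* p :* x) refl (2 ^ b) c

sumTo-const : ∀ m c → sumTo m (λ _ → c) ≡ m * c
sumTo-const zero    c = refl
sumTo-const (suc m) c = cong (c +_) (sumTo-const m c)

sumTo-sumCube : ∀ m b (f : ℕ → Vec Bool b → ℕ) →
                sumTo m (λ i → sumCube b (f i)) ≡ sumCube b (λ x → sumTo m (λ i → f i x))
sumTo-sumCube zero    b f = sym (sumCube-0 b)
sumTo-sumCube (suc m) b f = trans (cong (sumCube b (f 0) +_) (sumTo-sumCube m b (f ∘ suc))) (sym (sumCube-+ b (f 0) _))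

infixl 6 _⊕_
_⊕_ : Vec Bool m → Vec Bool m → Vec Bool m
_⊕_ = zipWith _xor_

⊕-cancel : ∀ (x a : Vec Bool m) → x ⊕ a ⊕ a ≡ x
⊕-cancel []      []      = refl
⊕-cancel (x ∷ v) (a ∷ w) = cong₂ _∷_ (bit x a) (⊕-cancel v w)
  where
  bit : ∀ x a → (x xor a) xor a ≡ x
  bit false false = refl
  bit false true  = refl
  bit true  false = refl
  bit true  true  = refl

⊕-shift : ∀ (x y a : Vec Bool m) → (x ⊕ a) ⊕ (y ⊕ a) ≡ x ⊕ y
⊕-shift []      []      []      = refl
⊕-shift (x ∷ u) (y ∷ v) (a ∷ w) = cong₂ _∷_ (bit x y a) (⊕-shift u v w)
  where
  bit : ∀ x y a → (x xor a) xor (y xor a) ≡ x xor y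
  bit false false false = refl
  bit false false true  = refl
  bit false true  false = refl
  bit false true  true  = refl
  bit true  false false = refl
  bit true  false true  = refl
  bit true  true  false = refl
  bit true  true  true  = refl

sumCube-⊕ : ∀ b (x : Vec Bool b) f → sumCube b (λ a → f (x ⊕ a)) ≡ sumCube b f
sumCube-⊕ zero    []          f = refl
sumCube-⊕ (suc b) (false ∷ x) f = cong₂ _+_ (sumCube-⊕ b x (f ∘ (false ∷_))) (sumCube-⊕ b x (f ∘ (true ∷_)))
sumCube-⊕ (suc b) (true ∷ x)  f = trans (cong₂ _+_ (sumCube-⊕ b x (f ∘ (true ∷_))) (sumCube-⊕ b x (f ∘ (false ∷_)))) (+-comm (sumCube b (f ∘ (true ∷_))) _)

bit : Bool → ℕ
bit x = if x then 1 else 0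

weight : Vec Bool m → ℕ
weight []      = 0
weight (x ∷ v) = bit x + weight v

-- The size of the intersection. For `v` the error of a centre at `x` and `w` = `x ⊕ y`, it counts
-- the part of the distance from `x` to `y` that may be lost.
common : Vec Bool m → Vec Bool m → ℕ
common []      []      = 0
common (x ∷ v) (y ∷ w) = bit y * bit x + common v w

weight-⊕ : ∀ (x y : Vec Bool m) → weight (x ⊕ y) ≡ d-H x y
weight-⊕ []      []      = refl
weight-⊕ (x ∷ u) (y ∷ v) = cong (bit (x xor y) +_) (weight-⊕ u v)

rotate : Vec Bool (suc m) → Vec Bool (suc m)
rotate (x ∷ v) = v Vec.∷ʳ x

unrotate : Vec Bool (suc m) → Vec Bool (suc m)
unrotate v = Vec.last v ∷ Vec.init v

rotate-unrotate : ∀ (v : Vec Bool (suc m)) → rotate (unrotate v) ≡ v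
rotate-unrotate v with v′ , x , refl ← Vec.initLast v = refl

rotate-⊕ : ∀ (v w : Vec Bool (suc m)) → rotate v ⊕ rotate w ≡ rotate (v ⊕ w)
rotate-⊕ (x ∷ v) (y ∷ w) = go v w
  where
  go : ∀ {m} (v w : Vec Bool m) → (v Vec.∷ʳ x) ⊕ (w Vec.∷ʳ y) ≡ (v ⊕ w) Vec.∷ʳ (x xor y)
  go []      []      = refl
  go (a ∷ v) (b ∷ w) = cong ((a xor b) ∷_) (go v w)

rotateBy unrotateBy : ℕ → Vec Bool (suc m) → Vec Bool (suc m)
rotateBy zero    v = v
rotateBy (suc i) v = rotate (rotateBy i v)
unrotateBy zero    v = v
unrotateBy (suc i) v = unrotateBy i (unrotate v)

rotateBy-unrotateBy : ∀ i (v : Vec Bool (suc m)) → rotateBy i (unrotateBy i v) ≡ v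
rotateBy-unrotateBy zero    v = refl
rotateBy-unrotateBy (suc i) v = trans (cong rotate (rotateBy-unrotateBy i (unrotate v))) (rotate-unrotate v)

rotateBy-⊕ : ∀ i (v w : Vec Bool (suc m)) → rotateBy i v ⊕ rotateBy i w ≡ rotateBy i (v ⊕ w)
rotateBy-⊕ zero    v w = refl
rotateBy-⊕ (suc i) v w = trans (rotate-⊕ (rotateBy i v) (rotateBy i w)) (cong rotate (rotateBy-⊕ i v w))

-- Rotations of a word are the windows of its periodic extension.
window : (ℕ → Bool) → ℕ → ∀ m → Vec Bool m
window f i zero    = []
window f i (suc m) = f i ∷ window f (suc i) m

window-∷ʳ : ∀ f i m → window f i (suc m) ≡ window f i m Vec.∷ʳ f (i + m)
window-∷ʳ f i zero    = cong (λ j → f j ∷ []) (sym (+-identityʳ i))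
window-∷ʳ f i (suc m) = cong (f i ∷_) (trans (window-∷ʳ f (suc i) m) (cong (λ j → window f (suc i) m Vec.∷ʳ f j) (sym (+-suc i m))))

weight-window : ∀ f i m → weight (window f i m) ≡ sumTo m (λ j → bit (f (j + i)))
weight-window f i zero    = refl
weight-window f i (suc m) = cong (bit (f i) +_) (trans (weight-window f (suc i) m) (sumTo-cong m (λ j → cong (bit ∘ f) (+-suc j i))))

module _ {m : ℕ} (f : ℕ → Bool) (periodic : ∀ i → f (i + suc m) ≡ f i) where

  private
    b : ℕ
    b = suc m

  rotateBy-window : ∀ i → rotateBy i (window f 0 b) ≡ window f i b
  rotateBy-window zero    = refl
  rotateBy-window (suc i) = trans (cong rotate (rotateBy-window i))
    (trans (cong (window f (suc i) m Vec.∷ʳ_) (trans (sym (periodic i)) (cong f (+-suc i m)))) (sym (window-∷ʳ f (suc i) m)))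

  period-sum : ∀ i → sumTo b (λ j → bit (f (j + i))) ≡ sumTo b (λ j → bit (f (j + 0)))
  period-sum zero    = refl
  period-sum (suc i) = trans (+-cancelˡ-≡ (bit (f i)) _ _ (trans
    (cong (bit (f i) +_) (sumTo-cong b (λ j → cong (bit ∘ f) (+-suc j i))))
    (trans (sumTo-last b (λ j → bit (f (j + i))))
      (trans (cong (sumTo b (λ j → bit (f (j + i))) +_) (cong bit (trans (cong f (+-comm b i)) (periodic i))))
        (+-comm _ (bit (f i))))))) (period-sum i)

  common-windows : ∀ {l} (w : Vec Bool l) i →
                    sumTo b (λ ρ → common (window f (ρ + i) l) w) ≡ weight w * sumTo b (λ j → bit (f (j + 0)))
  common-windows []              i = trans (sumTo-const b 0) (*-zeroʳ b)
  common-windows {suc l} (y ∷ w) i = begin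
    sumTo b (λ ρ → bit y * bit (f (ρ + i)) + common (window f (suc (ρ + i)) l) w)
      ≡⟨ sumTo-+ b (λ ρ → bit y * bit (f (ρ + i))) (λ ρ → common (window f (suc (ρ + i)) l) w) ⟩
    sumTo b (λ ρ → bit y * bit (f (ρ + i))) + sumTo b (λ ρ → common (window f (suc (ρ + i)) l) w)
      ≡⟨ cong₂ _+_ (trans (sumTo-* b (bit y) (λ ρ → bit (f (ρ + i)))) (cong (bit y *_) (period-sum i)))
           (trans (sumTo-cong b (λ ρ → cong (λ j → common (window f j l) w) (sym (+-suc ρ i)))) (common-windows w (suc i))) ⟩
    bit y * P + weight w * P ≡⟨ sym (*-distribʳ-+ P (bit y) (weight w)) ⟩
    weight (y ∷ w) * P ∎
    where
    open ≡-Reasoning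
    P = sumTo b (λ j → bit (f (j + 0)))

window-tabulate : ∀ f i m → window f i m ≡ tabulate (λ j → f (i + toℕ j))
window-tabulate f i zero    = refl
window-tabulate f i (suc m) = cong₂ _∷_ (cong f (sym (+-identityʳ i)))
  (trans (window-tabulate f (suc i) m) (tabulate-cong (λ j → cong f (sym (+-suc i (toℕ j))))))

-- In a full turn each one of `v` visits every position once, so it meets each one of `w` exactly
-- once.
common-rotations : ∀ (v w : Vec Bool (suc m)) → sumTo (suc m) (λ ρ → common (rotateBy ρ v) w) ≡ weight w * weight v
common-rotations {m} v w = begin
  sumTo b (λ ρ → common (rotateBy ρ v) w) ≡⟨ sumTo-cong b (λ ρ → cong (λ u → common u w) (trans (cong (rotateBy ρ) (sym window-v)) (trans (rotateBy-window f periodic ρ) (cong (λ j → window f j b) (sym (+-identityʳ ρ)))))) ⟩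
  sumTo b (λ ρ → common (window f (ρ + 0) b) w) ≡⟨ common-windows f periodic w 0 ⟩
  weight w * sumTo b (λ j → bit (f (j + 0))) ≡⟨ cong (weight w *_) (trans (sym (weight-window f 0 b)) (cong weight window-v)) ⟩
  weight w * weight v ∎
  where
  open ≡-Reasoning
  b : ℕ
  b = suc m
  f : ℕ → Bool
  f i = lookup v (fromℕ< (m%n<n i b))
  periodic : ∀ i → f (i + b) ≡ f i
  periodic i = cong (lookup v) (fromℕ<-cong _ _ ([m+n]%n≡m%n i b) (m%n<n (i + b) b) (m%n<n i b))
  window-v : window f 0 b ≡ v
  window-v = trans (window-tabulate f 0 b) (trans (tabulate-cong (λ j → cong (lookup v) (toℕ-injective
    (trans (toℕ-fromℕ< (m%n<n (toℕ j) b)) (m<n⇒m%n≡m (toℕ<n j)))))) (tabulate∘lookup v))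

weight-∷ʳ : ∀ (v : Vec Bool m) x → weight (v Vec.∷ʳ x) ≡ bit x + weight v
weight-∷ʳ []      x = refl
weight-∷ʳ (y ∷ v) x = trans (cong (bit y +_) (weight-∷ʳ v x))
  (trans (sym (+-assoc (bit y) (bit x) (weight v))) (trans (cong (_+ weight v) (+-comm (bit y) (bit x))) (+-assoc (bit x) (bit y) (weight v))))

weight-rotateBy : ∀ i (v : Vec Bool (suc m)) → weight (rotateBy i v) ≡ weight v
weight-rotateBy zero    v = refl
weight-rotateBy (suc i) v = trans (weight-rotate (rotateBy i v)) (weight-rotateBy i v)
  where
  weight-rotate : ∀ {m} (v : Vec Bool (suc m)) → weight (rotate v) ≡ weight v
  weight-rotate (x ∷ v) = weight-∷ʳ v x

-- Summing over all translations turns `back ρ x ⊕ a` into a free variable `y`, independent of `x`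
-- and `ρ`. After the sums are exchanged, `orbit` averages each error pattern `E y` over its
-- rotations.
average : ∀ b r (back forth : ℕ → Vec Bool b → Vec Bool b) (E : Vec Bool b → Vec Bool b) (err : ℕ → Vec Bool b → Vec Bool b → Vec Bool b) →
  (∀ ρ a x → err ρ a x ≡ forth ρ (E (back ρ x ⊕ a))) →
  (∀ v w → sumTo b (λ ρ → common (forth ρ v) w) ≡ weight w * weight v) → (∀ y → weight (E y) ≡ r) →
  ∀ x w → sumTo b (λ ρ → sumCube b (λ a → common (err ρ a x) w)) ≡ 2 ^ b * (r * weight w)
average b r back forth E err err≡ orbit weight≡ x w = begin
  sumTo b (λ ρ → sumCube b (λ a → common (err ρ a x) w))
    ≡⟨ sumTo-cong b (λ ρ → trans (sumCube-cong b (λ a → cong (λ e → common e w) (err≡ ρ a x)))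
         (sumCube-⊕ b (back ρ x) (λ y → common (forth ρ (E y)) w))) ⟩
  sumTo b (λ ρ → sumCube b (λ y → common (forth ρ (E y)) w))
    ≡⟨ sumTo-sumCube b b (λ ρ y → common (forth ρ (E y)) w) ⟩
  sumCube b (λ y → sumTo b (λ ρ → common (forth ρ (E y)) w))
    ≡⟨ sumCube-cong b (λ y → trans (orbit (E y) w) (trans (cong (weight w *_) (weight≡ y)) (*-comm (weight w) r))) ⟩
  sumCube b (λ _ → r * weight w) ≡⟨ sumCube-const b (r * weight w) ⟩
  2 ^ b * (r * weight w) ∎
  where open ≡-Reasoning

module _ {k : ℕ} (code : BlockCode k) where
  open BlockCode code

  private
    b : ℕ
    b = suc b′

  word : Vec Bool b → Vec Bool b
  word x = proj₁ (covers x)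

  family : List (List (Vec Bool b))
  family = cartesianProductWith (λ ρ a → map (λ c → rotateBy ρ (c ⊕ a)) words) (upTo b) (bitVectors b)

  length-family : length family ≡ b * 2 ^ b
  length-family = length-product (upTo b) {b} (length-upTo b)
    where
    length-product : ∀ (is : List ℕ) {l} → length is ≡ l → length (cartesianProductWith (λ ρ a → map (λ c → rotateBy ρ (c ⊕ a)) words) is (bitVectors b)) ≡ l * 2 ^ b
    length-product is eq = trans (length-cartesianProductWith _ is (bitVectors b)) (cong₂ _*_ eq (length-bitVectors b))

  word-in : ℕ → Vec Bool b → Vec Bool b → Vec Bool b
  word-in ρ a x = rotateBy ρ (word (unrotateBy ρ x ⊕ a) ⊕ a)

  -- The translation cancels from the difference, so the transformed code makes the errors of the
  -- original one at another word, rotated.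
  error : ∀ ρ a x → word-in ρ a x ⊕ x ≡ rotateBy ρ (word (unrotateBy ρ x ⊕ a) ⊕ (unrotateBy ρ x ⊕ a))
  error ρ a x = begin
    rotateBy ρ (c ⊕ a) ⊕ x ≡⟨ cong (rotateBy ρ (c ⊕ a) ⊕_) (sym (rotateBy-unrotateBy ρ x)) ⟩
    rotateBy ρ (c ⊕ a) ⊕ rotateBy ρ x₀ ≡⟨ rotateBy-⊕ ρ (c ⊕ a) x₀ ⟩
    rotateBy ρ (c ⊕ a ⊕ x₀) ≡⟨ cong (λ y → rotateBy ρ (c ⊕ a ⊕ y)) (sym (⊕-cancel x₀ a)) ⟩
    rotateBy ρ ((c ⊕ a) ⊕ (x₀ ⊕ a ⊕ a)) ≡⟨ cong (rotateBy ρ) (⊕-shift c (x₀ ⊕ a) a) ⟩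
    rotateBy ρ (c ⊕ (x₀ ⊕ a)) ∎
    where
    open ≡-Reasoning
    x₀ = unrotateBy ρ x
    c = word (x₀ ⊕ a)

  weight-error : ∀ ρ a x → weight (word-in ρ a x ⊕ x) ≡ r
  weight-error ρ a x = trans (cong weight (error ρ a x)) (trans (weight-rotateBy ρ (word y ⊕ y)) (trans (weight-⊕ (word y) y) (proj₂ (proj₂ (covers y)))))
    where y = unrotateBy ρ x ⊕ a

  balanced : ∀ x w → sumTo b (λ ρ → sumCube b (λ a → common (word-in ρ a x ⊕ x) w)) ≡ 2 ^ b * (r * weight w)
  balanced = average b r unrotateBy rotateBy (λ y → word y ⊕ y) (λ ρ a x → word-in ρ a x ⊕ x) error (common-rotations {b′})
               (λ y → trans (weight-⊕ (word y) y) (proj₂ (proj₂ (covers y))))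

⊕-take-drop : ∀ {b l} (c : Vec Bool b) (C : Vec Bool l) (X : Vec Bool (b + l)) → (c Vec.++ C) ⊕ X ≡ (c ⊕ Vec.take b X) Vec.++ (C ⊕ Vec.drop b X)
⊕-take-drop {b} c C X = trans (cong ((c Vec.++ C) ⊕_) (sym (take++drop≡id b X))) (zip-++ c (Vec.take b X))
  where
  zip-++ : ∀ {m} (c x : Vec Bool m) → (c Vec.++ C) ⊕ (x Vec.++ Vec.drop b X) ≡ (c ⊕ x) Vec.++ (C ⊕ Vec.drop b X)
  zip-++ []      []      = refl
  zip-++ (y ∷ c) (x ∷ v) = cong ((y xor x) ∷_) (zip-++ c v)

weight-++ : ∀ {l m} (u : Vec Bool l) (v : Vec Bool m) → weight (u Vec.++ v) ≡ weight u + weight v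
weight-++ []      v = refl
weight-++ (x ∷ u) v = trans (cong (bit x +_) (weight-++ u v)) (sym (+-assoc (bit x) _ _))

common-++ : ∀ {l m} (u : Vec Bool l) (v : Vec Bool m) w → common (u Vec.++ v) w ≡ common u (Vec.take l w) + common v (Vec.drop l w)
common-++ []      v w       = refl
common-++ (x ∷ u) v (y ∷ w) = trans (cong (bit y * bit x +_) (common-++ u v w)) (sym (+-assoc (bit y * bit x) _ _))

weight-take-drop : ∀ l {m} (w : Vec Bool (l + m)) → weight w ≡ weight (Vec.take l w) + weight (Vec.drop l w)
weight-take-drop l w = trans (cong weight (sym (take++drop≡id l w))) (weight-++ (Vec.take l w) (Vec.drop l w))

sumOver : {A : Set} → (A → ℕ) → List A → ℕ
sumOver f []      = 0
sumOver f (x ∷ R) = f x + sumOver f R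

module Centres (b r : ℕ) .{{_ : NonZero b}} (word-in : ℕ → Vec Bool b → Vec Bool b → Vec Bool b)
         (weight-error : ∀ ρ a x → weight (word-in ρ a x ⊕ x) ≡ r)
         (balanced : ∀ x w → sumTo b (λ ρ → sumCube b (λ a → common (word-in ρ a x ⊕ x) w)) ≡ 2 ^ b * (r * weight w)) where

  centre : ℕ → Vec Bool b → ∀ q → Vec Bool (q * b) → Vec Bool (q * b)
  centre ρ a zero    X = []
  centre ρ a (suc q) X = word-in ρ a (Vec.take b X) Vec.++ centre ρ a q (Vec.drop b X)

  centre-weight : ∀ ρ a q X → weight (centre ρ a q X ⊕ X) ≡ q * r
  centre-weight ρ a zero    [] = refl
  centre-weight ρ a (suc q) X  = trans (cong weight (⊕-take-drop (word-in ρ a (Vec.take b X)) (centre ρ a q (Vec.drop b X)) X))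
    (trans (weight-++ (word-in ρ a (Vec.take b X) ⊕ Vec.take b X) _)
      (cong₂ _+_ (weight-error ρ a (Vec.take b X)) (centre-weight ρ a q (Vec.drop b X))))

  -- The average is additive over blocks, so all blocks can share `ρ` and `a`. The number of codes
  -- to try is then not raised to the power `q`.
  centre-balanced : ∀ q X w → sumTo b (λ ρ → sumCube b (λ a → common (centre ρ a q X ⊕ X) w)) ≡ 2 ^ b * (r * weight w)
  centre-balanced zero [] [] = trans (sumTo-cong b (λ _ → sumCube-0 b)) (trans (sumTo-const b 0)
    (trans (*-zeroʳ b) (sym (trans (cong (2 ^ b *_) (*-zeroʳ r)) (*-zeroʳ (2 ^ b))))))
  centre-balanced (suc q) X w = begin
    sumTo b (λ ρ → sumCube b (λ a → common (centre ρ a (suc q) X ⊕ X) w))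
      ≡⟨ sumTo-cong b (λ ρ → trans (sumCube-cong b (λ a → trans
           (cong (λ e → common e w) (⊕-take-drop (word-in ρ a (Vec.take b X)) (centre ρ a q (Vec.drop b X)) X))
           (common-++ (word-in ρ a (Vec.take b X) ⊕ Vec.take b X) (centre ρ a q (Vec.drop b X) ⊕ Vec.drop b X) w)))
           (sumCube-+ b (λ a → common (word-in ρ a (Vec.take b X) ⊕ Vec.take b X) w₁) (λ a → common (centre ρ a q (Vec.drop b X) ⊕ Vec.drop b X) w₂))) ⟩
    sumTo b (λ ρ → sumCube b (λ a → common (word-in ρ a (Vec.take b X) ⊕ Vec.take b X) w₁) + sumCube b (λ a → common (centre ρ a q (Vec.drop b X) ⊕ Vec.drop b X) w₂))
      ≡⟨ sumTo-+ b (λ ρ → sumCube b (λ a → common (word-in ρ a (Vec.take b X) ⊕ Vec.take b X) w₁)) (λ ρ → sumCube b (λ a → common (centre ρ a q (Vec.drop b X) ⊕ Vec.drop b X) w₂)) ⟩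
    _ ≡⟨ cong₂ _+_ (balanced (Vec.take b X) w₁) (centre-balanced q (Vec.drop b X) w₂) ⟩
    2 ^ b * (r * weight w₁) + 2 ^ b * (r * weight w₂)
      ≡⟨ solve 4 (λ p r x y → p :* (r :* x) :+ p :* (r :* y) := p :* (r :* (x :+ y))) refl (2 ^ b) r (weight w₁) (weight w₂) ⟩
    2 ^ b * (r * (weight w₁ + weight w₂)) ≡⟨ cong (λ x → 2 ^ b * (r * x)) (sym (weight-take-drop b w)) ⟩
    2 ^ b * (r * weight w) ∎
    where
    open ≡-Reasoning
    w₁ = Vec.take b w
    w₂ = Vec.drop b w

  -- The average is taken for the total over `W` before a rotation and a translation are picked. The
  -- choice depends on `W`, but the set of choices does not.
  good-centre : ∀ {k} → suc k * r ≤ 2 * b → ∀ q X (W : List (Vec Bool (q * b))) → ∃[ ρ ] ∃[ a ] ρ < b ×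
                suc k * sumOver (common (centre ρ a q X ⊕ X)) W ≤ 2 * sumOver weight W
  good-centre {k} radius≤ q X W with ρ , ρ< , le ← sumTo-min b (λ ρ → sumCube b (λ a → sumOver (common (centre ρ a q X ⊕ X)) W))
    with a , le′ ← sumCube-min b (λ a → sumOver (common (centre ρ a q X ⊕ X)) W) =
    ρ , a , ρ< , *-cancelˡ-≤ (b * 2 ^ b) {{m*n≢0 b (2 ^ b) {{it}} {{m^n≢0 2 b}}}} (begin
      b * 2 ^ b * (suc k * G) ≡⟨ solve 4 (λ b p k g → b :* p :* (k :* g) := k :* (b :* (p :* g))) refl b (2 ^ b) (suc k) G ⟩
      suc k * (b * (2 ^ b * G)) ≤⟨ *-monoʳ-≤ (suc k) (≤-trans (*-monoʳ-≤ b le′) le) ⟩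
      suc k * sumTo b (λ ρ → sumCube b (λ a → sumOver (common (centre ρ a q X ⊕ X)) W)) ≡⟨ cong (suc k *_) (total W) ⟩
      suc k * (2 ^ b * (r * S)) ≡⟨ solve 4 (λ k p r s → k :* (p :* (r :* s)) := k :* r :* (p :* s)) refl (suc k) (2 ^ b) r S ⟩
      suc k * r * (2 ^ b * S) ≤⟨ *-monoˡ-≤ (2 ^ b * S) radius≤ ⟩
      2 * b * (2 ^ b * S) ≡⟨ solve 3 (λ b p s → con 2 :* b :* (p :* s) := b :* p :* (con 2 :* s)) refl b (2 ^ b) S ⟩
      b * 2 ^ b * (2 * S) ∎)
    where
    open ≤-Reasoning
    G = sumOver (common (centre ρ a q X ⊕ X)) W
    S = sumOver weight W
    total : ∀ W → sumTo b (λ ρ → sumCube b (λ a → sumOver (common (centre ρ a q X ⊕ X)) W)) ≡ 2 ^ b * (r * sumOver weight W)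
    total [] = trans (sumTo-cong b (λ _ → sumCube-0 b)) (trans (sumTo-const b 0)
      (trans (*-zeroʳ b) (sym (trans (cong (2 ^ b *_) (*-zeroʳ r)) (*-zeroʳ (2 ^ b))))))
    total (w ∷ W) = trans (sumTo-cong b (λ ρ → sumCube-+ b (λ a → common (centre ρ a q X ⊕ X) w) (λ a → sumOver (common (centre ρ a q X ⊕ X)) W)))
      (trans (sumTo-+ b (λ ρ → sumCube b (λ a → common (centre ρ a q X ⊕ X) w)) (λ ρ → sumCube b (λ a → sumOver (common (centre ρ a q X ⊕ X)) W)))
        (trans (cong₂ _+_ (centre-balanced q X w) (total W))
          (solve 4 (λ p r x y → p :* (r :* x) :+ p :* (r :* y) := p :* (r :* (x :+ y))) refl (2 ^ b) r (weight w) (sumOver weight W))))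

-- Local search for satisfying assignments

takeVec-toList : ∀ {N} → (C : Vec Bool N) → takeVec N (toList C) ≡ C
takeVec-toList []      = refl
takeVec-toList (x ∷ C) = cong (x ∷_) (takeVec-toList C)

-- `n` need not be a multiple of the block length. Padding both `x` and `y` adds no difference
-- between them, and cutting the centre back to length `n` only removes errors.
pad : ∀ N → Vec Bool n → Vec Bool N
pad N x = takeVec N (toList x)

d-H-pad : ∀ N (x y : Vec Bool n) → n ≤ N → weight (pad N x ⊕ pad N y) ≡ d-H x y
d-H-pad zero    []      []      z≤n = refl
d-H-pad (suc N) []      []      z≤n = d-H-pad N [] [] z≤n
d-H-pad (suc N) (x ∷ u) (y ∷ v) (s≤s le) = cong (bit (x xor y) +_) (d-H-pad N u v le)

truncate-d-H : ∀ {N} (C : Vec Bool N) (x : Vec Bool n) → n ≤ N → d-H (takeVec n (toList C)) x ≤ weight (C ⊕ pad N x)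
truncate-d-H C       []      le       = z≤n
truncate-d-H (c ∷ C) (x ∷ u) (s≤s le) = +-monoʳ-≤ (bit (c xor x)) (truncate-d-H C u le)

truncate-common : ∀ {N} (C : Vec Bool N) (x y : Vec Bool n) → n ≤ N →
  common (takeVec n (toList C) ⊕ x) (x ⊕ y) ≤ common (C ⊕ pad N x) (pad N x ⊕ pad N y)
truncate-common C       []      []      le       = z≤n
truncate-common (c ∷ C) (x ∷ u) (y ∷ v) (s≤s le) = +-monoʳ-≤ (bit (x xor y) * bit (c xor x)) (truncate-common C u v le)

-- `z` lies on a geodesic of the cube from `c` to `x`.
Between : Vec Bool n → Vec Bool n → Vec Bool n → Set
Between z c x = ∀ i → lookup z i ≡ lookup x i ⊎ lookup z i ≡ lookup c i

-- A coordinate counted by `d-H x y` but not by `d-H z y` has `z = y ≠ x`, hence `z = c ≠ x`, and is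
-- counted by `common`.
between-d-H : ∀ (z c x y : Vec Bool n) → Between z c x → d-H x y ≤ d-H z y + common (c ⊕ x) (x ⊕ y)
between-d-H []      []      []      []      h = z≤n
between-d-H (z ∷ zs) (c ∷ cs) (x ∷ xs) (y ∷ ys) h = ≤-trans (+-mono-≤ (bits z c x y (h Fin.zero)) (between-d-H zs cs xs ys (h ∘ Fin.suc)))
  (≤-reflexive (interchange (bit (z xor y)) (bit (x xor y) * bit (c xor x)) (d-H zs ys) (common (cs ⊕ xs) (xs ⊕ ys))))
  where
  bits : ∀ z c x y → z ≡ x ⊎ z ≡ c → bit (x xor y) ≤ bit (z xor y) + bit (x xor y) * bit (c xor x)
  bits z     c     .z    y     (inj₁ refl) = m≤m+n _ _
  bits z     .z    x     y     (inj₂ refl) with x | y | z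
  ... | false | false | _     = z≤n
  ... | true  | true  | _     = z≤n
  ... | false | true  | false = s≤s z≤n
  ... | false | true  | true  = s≤s z≤n
  ... | true  | false | false = s≤s z≤n
  ... | true  | false | true  = s≤s z≤n

set-between : ∀ (z c x : Vec Bool n) i {b} → lookup x i ≡ b → Between z c x → Between (z [ i ]≔ b) c x
set-between (z ∷ zs) (c ∷ cs) (x ∷ xs) Fin.zero    eq h Fin.zero    = inj₁ (sym eq)
set-between (z ∷ zs) (c ∷ cs) (x ∷ xs) Fin.zero    eq h (Fin.suc j) = h (Fin.suc j)
set-between (z ∷ zs) (c ∷ cs) (x ∷ xs) (Fin.suc i) eq h Fin.zero    = h Fin.zero
set-between (z ∷ zs) (c ∷ cs) (x ∷ xs) (Fin.suc i) eq h (Fin.suc j) = set-between zs cs xs i eq (h ∘ Fin.suc) j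

set-closer : ∀ (z x : Vec Bool n) i {b} → lookup x i ≡ b → ¬ lookup z i ≡ b → suc (d-H (z [ i ]≔ b) x) ≡ d-H z x
set-closer (false ∷ z) (false ∷ x) Fin.zero refl ne = contradiction refl ne
set-closer (false ∷ z) (true ∷ x)  Fin.zero refl ne = refl
set-closer (true ∷ z)  (false ∷ x) Fin.zero refl ne = refl
set-closer (true ∷ z)  (true ∷ x)  Fin.zero refl ne = contradiction refl ne
set-closer (z ∷ zs)    (x ∷ xs) (Fin.suc i) eq ne = trans (sym (+-suc (bit (z xor x)) _)) (cong (bit (z xor x) +_) (set-closer zs xs i eq ne))

d-H≡0 : ∀ (z x : Vec Bool n) → d-H z x ≡ 0 → z ≡ x
d-H≡0 []          []          eq = refl
d-H≡0 (false ∷ z) (false ∷ x) eq = cong (false ∷_) (d-H≡0 z x eq)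
d-H≡0 (true ∷ z)  (true ∷ x)  eq = cong (true ∷_) (d-H≡0 z x eq)

d-H-refl : ∀ (z : Vec Bool n) → d-H z z ≡ 0
d-H-refl []          = refl
d-H-refl (false ∷ z) = d-H-refl z
d-H-refl (true ∷ z)  = d-H-refl z

module _ (F : CNF n) where

  expand-acc : ∀ {acc y} z → y ∈ acc → y ∈ expand F acc z
  expand-acc z y∈ with falsified z F
  ... | nothing = there y∈
  ... | just C  = consMap-acc C y∈

  fold-acc : ∀ {acc y} L → y ∈ acc → y ∈ foldl (expand F) acc L
  fold-acc []      y∈ = y∈
  fold-acc (z ∷ L) y∈ = fold-acc L (expand-acc z y∈)

  ∈-round : ∀ {z y} L → z ∈ L → (∀ {acc} → y ∈ expand F acc z) → y ∈ round F L
  ∈-round L = go [] L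
    where
    go : ∀ acc L {z y} → z ∈ L → (∀ {acc} → y ∈ expand F acc z) → y ∈ foldl (expand F) acc L
    go acc (z ∷ L) (here refl) h = fold-acc L h
    go acc (z ∷ L) (there z∈)  h = go (expand F acc z) L z∈ h

  module _ {x : Vec Bool n} (sat : Sat F x) (c : Vec Bool n) where

    -- The walk towards `x` may end early at another solution; `Between` still controls where that
    -- one differs from `x`.
    Near : ℕ → List (Vec Bool n) → Set
    Near d L = ∃[ z ] z ∈ L × Between z c x × (Sat F z ⊎ d-H z x ≤ d)

    -- `x` satisfies some literal of the clause that `z` falsifies. The branch that sets this
    -- literal comes one step closer to `x` and changes only a coordinate to its value in `x`.
    near-round : ∀ d L → Near (suc d) L → Near d (round F L)
    near-round d L (z , z∈ , btw , close) with falsified z F in eq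
    ... | nothing = z , ∈-round L z∈ (λ {acc} → stays acc) , btw , inj₁ (proj₂ (find-nothing z nothing F eq))
      where
      stays : ∀ acc → z ∈ expand F acc z
      stays acc rewrite eq = here refl
    ... | just C with C∈ , false-all ← find-falsified z F eq with close
    ...   | inj₁ satz with _ , l∈ , p ← find (All.lookup satz C∈) = contradiction p (All.lookup false-all l∈)
    ...   | inj₂ le with (i , b) , l∈ , p ← find (All.lookup sat C∈) =
      z [ i ]≔ b , ∈-round L z∈ (λ {acc} → moves acc) , set-between z c x i p btw ,
      inj₂ (s≤s⁻¹ (≤-trans (≤-reflexive (set-closer z x i p (All.lookup false-all l∈))) le))
      where
      moves : ∀ acc → z [ i ]≔ b ∈ expand F acc z
      moves acc rewrite eq = ∈-consMap {f = setLit z} l∈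

    near-times : ∀ r d L → Near (r + d) L → Near d (times r (round F) L)
    near-times zero    d L h = h
    near-times (suc r) d L h = near-times r d (round F L) (near-round (r + d) L h)

    near-rounds : ∀ q r L → Near (q * r) L → Near 0 (rounds F q r L)
    near-rounds zero    r L h = h
    near-rounds (suc q) r L h = near-rounds q r (times r (round F) L) (near-times r (q * r) L h)

  keep-sat : ∀ L acc → All (Sat F) acc → All (Sat F) (foldl (keep F) acc L)
  keep-sat []      acc h = h
  keep-sat (z ∷ L) acc h = keep-sat L (keep F acc z) (one z)
    where
    one : ∀ z → All (Sat F) (keep F acc z)
    one z with falsified z F in eq
    ... | nothing = proj₂ (find-nothing z nothing F eq) ∷ h
    ... | just _  = h

  ∈-keep : ∀ {z} L acc → Sat F z → z ∈ L → z ∈ foldl (keep F) acc L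
  ∈-keep L acc satz z∈ = go L acc (inj₁ z∈)
    where
    step : ∀ {z} y acc → z ∈ acc → z ∈ keep F acc y
    step y acc z∈ with falsified y F
    ... | nothing = there z∈
    ... | just _  = z∈
    new : ∀ {z} acc → Sat F z → z ∈ keep F acc z
    new {z} acc satz with falsified z F in eq
    ... | nothing = here refl
    ... | just C with C∈ , false-all ← find-falsified z F eq with _ , l∈ , p ← find (All.lookup satz C∈) = contradiction p (All.lookup false-all l∈)
    go : ∀ L acc → _ ∈ L ⊎ _ ∈ acc → _ ∈ foldl (keep F) acc L
    go []      acc (inj₂ z∈)          = z∈
    go (y ∷ L) acc (inj₁ (here refl)) = go L _ (inj₂ (new acc satz))
    go (y ∷ L) acc (inj₁ (there z∈))  = go L _ (inj₁ z∈)
    go (y ∷ L) acc (inj₂ z∈)          = go L _ (inj₂ (step y acc z∈))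

∈-allCentres : ∀ q {κ : List (Vec Bool m)} fam {p} → κ ∈ fam → p ∈ times q (extend κ) ([] ∷ []) → takeVec n p ∈ allCentres n q fam
∈-allCentres {m = m} {n = n} q {κ} fam {p} κ∈ p∈ = go [] fam κ∈
  where
  keeps : ∀ acc (fam : List (List (Vec Bool m))) {y} → y ∈ acc → y ∈ foldl (centres n q) acc fam
  keeps acc []        y∈ = y∈
  keeps acc (κ ∷ fam) y∈ = keeps (centres n q acc κ) fam (consMap-acc (times q (extend κ) ([] ∷ [])) y∈)
  go : ∀ acc (fam : List (List (Vec Bool m))) → κ ∈ fam → takeVec n p ∈ foldl (centres n q) acc fam
  go acc (κ ∷ fam) (here refl) = keeps (centres n q acc κ) fam (∈-consMap p∈)
  go acc (κ ∷ fam) (there κ∈)  = go (centres n q acc κ) fam κ∈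

times-suc : ∀ {A : Set} q (f : A → A) x → times (suc q) f x ≡ f (times q f x)
times-suc zero    f x = refl
times-suc (suc q) f x = times-suc q f (f x)

module _ {k n : ℕ} (code : BlockCode k) where
  open BlockCode code

  private
    b : ℕ
    b = suc b′

  open Centres b r (word-in code) (weight-error code) (balanced code)

  ∈-parts : ∀ ρ a q X {κ} → (∀ x → word-in code ρ a x ∈ κ) → toList (centre ρ a q X) ∈ times q (extend κ) ([] ∷ [])
  ∈-parts ρ a zero    X h = here refl
  -- `extend` prepends, so the first block of the centre belongs to the last pass; `times-suc`
  -- brings that pass outside.
  ∈-parts ρ a (suc q) X {κ} h = subst₂ _∈_ (sym (toList-++ (word-in code ρ a (Vec.take b X)) (centre ρ a q (Vec.drop b X)))) (sym (times-suc q (extend κ) _))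
    (∈-extend (h (Vec.take b X)) (∈-parts ρ a q (Vec.drop b X) h))

  module _ (F : CNF n) {x : Vec Bool n} (sat : Sat F x) (R : List (Vec Bool n)) (q : ℕ) (n≤N : n ≤ q * b) where

    private
      N : ℕ
      N = q * b
      X : Vec Bool N
      X = pad N x
      W : List (Vec Bool n) → List (Vec Bool N)
      W = map (λ y → X ⊕ pad N y)

      total : ∀ R → sumOver weight (W R) ≡ sumD x R
      total []      = refl
      total (y ∷ R) = cong₂ _+_ (d-H-pad N x y n≤N) (total R)

      module _ (C : Vec Bool N) where

        c : Vec Bool n
        c = takeVec n (toList C)

        loss : List (Vec Bool n) → ℕ
        loss R = sumOver (common (C ⊕ X)) (W R)

        far : ∀ {z} → Between z c x → ∀ R → sumD x R ≤ sumD z R + loss R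
        far {z} btw []      = z≤n
        far {z} btw (y ∷ R) = ≤-trans (+-mono-≤ (≤-trans (between-d-H z c x y btw) (+-monoʳ-≤ (d-H z y) (truncate-common C x y n≤N))) (far btw R))
          (≤-reflexive (interchange (d-H z y) (common (C ⊕ X) (X ⊕ pad N y)) (sumD z R) (loss R)))

        near-solution : ∀ L → Near F sat c 0 L → suc k * loss R ≤ 2 * sumOver weight (W R) →
                        ∃[ z ] z ∈ foldl (keep F) [] L × suc k * sumD x R ≤ suc k * sumD z R + 2 * sumD x R
        near-solution L (z , z∈ , btw , close) le = z , ∈-keep F L [] (satz close) z∈ , (begin
          suc k * sumD x R ≤⟨ *-monoʳ-≤ (suc k) (far btw R) ⟩
          suc k * (sumD z R + loss R) ≡⟨ *-distribˡ-+ (suc k) (sumD z R) (loss R) ⟩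
          suc k * sumD z R + suc k * loss R ≤⟨ +-monoʳ-≤ (suc k * sumD z R) le ⟩
          suc k * sumD z R + 2 * sumOver weight (W R) ≡⟨ cong (λ s → suc k * sumD z R + 2 * s) (total R) ⟩
          suc k * sumD z R + 2 * sumD x R ∎)
          where
          open ≤-Reasoning
          satz : Sat F z ⊎ d-H z x ≤ 0 → Sat F z
          satz (inj₁ p) = p
          satz (inj₂ p) = subst (Sat F) (sym (d-H≡0 z x (n≤0⇒n≡0 p))) sat

    from-centre : (∃[ ρ ] ∃[ a ] ρ < b × suc k * loss (centre ρ a q X) R ≤ 2 * sumOver weight (W R)) →
                  ∃[ z ] z ∈ candidates (family code) r q F × suc k * sumD x R ≤ suc k * sumD z R + 2 * sumD x R
    from-centre (ρ , a , ρ< , le) = near-solution C (rounds F q r L)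
      (near-rounds F sat (c C) q r L (c C , ∈-allCentres q (family code) code∈ (∈-parts ρ a q X word∈) , (λ i → inj₂ refl) ,
        inj₂ (≤-trans (truncate-d-H C x n≤N) (≤-reflexive (centre-weight ρ a q X))))) le
      where
      C : Vec Bool N
      C = centre ρ a q X
      L : List (Vec Bool n)
      L = allCentres n q (family code)
      κ : List (Vec Bool b)
      κ = map (λ c → rotateBy ρ (c ⊕ a)) words
      code∈ : κ ∈ family code
      code∈ = ∈-cartesianProductWith⁺ (λ ρ a → map (λ c → rotateBy ρ (c ⊕ a)) words) (∈-upTo⁺ ρ<) (bitVectors-complete a)
      word∈ : ∀ y → word-in code ρ a y ∈ κ
      word∈ y = ∈-map⁺ (λ c → rotateBy ρ (c ⊕ a)) (proj₁ (proj₂ (covers (unrotateBy ρ y ⊕ a))))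

    -- The subtraction-free form of (k - 1) `sumD x R` ≤ (k + 1) `sumD z R`. The witness depends on
    -- `R`, the candidates do not.
    approximates : ∃[ z ] z ∈ candidates (family code) r q F × suc k * sumD x R ≤ suc k * sumD z R + 2 * sumD x R
    approximates = from-centre (good-centre {k} radius≤ q X (W R))

-- Best-response local search

times-+ : ∀ {A : Set} a b (f : A → A) x → times (a + b) f x ≡ times b f (times a f x)
times-+ zero    b f x = refl
times-+ (suc a) b f x = times-+ a b f (f x)

times-* : ∀ {A : Set} a b (f : A → A) x → times a (times b f) x ≡ times (a * b) f x
times-* zero    b f x = refl
times-* (suc a) b f x = trans (times-* a b f (times b f x)) (sym (times-+ b (a * b) f x))

times-cong : ∀ {A : Set} a {f g : A → A} → (∀ x → f x ≡ g x) → ∀ x → times a f x ≡ times a g x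
times-cong zero            h x = refl
times-cong (suc a) {g = g} h x = trans (times-cong a h _) (cong (times a g) (h x))

d-H-comm : ∀ (x y : Vec Bool n) → d-H x y ≡ d-H y x
d-H-comm []          []          = refl
d-H-comm (false ∷ x) (false ∷ y) = d-H-comm x y
d-H-comm (false ∷ x) (true ∷ y)  = cong suc (d-H-comm x y)
d-H-comm (true ∷ x)  (false ∷ y) = cong suc (d-H-comm x y)
d-H-comm (true ∷ x)  (true ∷ y)  = d-H-comm x y

sumD-++ : ∀ (z : Vec Bool n) A B → sumD z (A ++ B) ≡ sumD z A + sumD z B
sumD-++ z []      B = refl
sumD-++ z (y ∷ A) B = trans (cong (d-H z y +_) (sumD-++ z A B)) (sym (+-assoc (d-H z y) _ _))

sumD-∷ʳ : ∀ (z : Vec Bool n) R y → sumD z (R ∷ʳ y) ≡ sumD z (y ∷ R)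
sumD-∷ʳ z R y = trans (sumD-++ z R (y ∷ [])) (trans (cong (sumD z R +_) (+-identityʳ _)) (+-comm (sumD z R) (d-H z y)))

-- The potential of the local search. Each pair of members counts once, so exchanging `y` alters
-- only the summand `sumD y R`.
pairs : List (Vec Bool n) → ℕ
pairs []      = 0
pairs (y ∷ R) = sumD y R + pairs R

pairs-∷ʳ : ∀ R (b : Vec Bool n) → pairs (R ∷ʳ b) ≡ sumD b R + pairs R
pairs-∷ʳ []      b = refl
pairs-∷ʳ (y ∷ R) b = begin
  sumD y (R ∷ʳ b) + pairs (R ∷ʳ b) ≡⟨ cong₂ _+_ (trans (sumD-∷ʳ y R b) (cong (_+ sumD y R) (d-H-comm y b))) (pairs-∷ʳ R b) ⟩
  d-H b y + sumD y R + (sumD b R + pairs R) ≡⟨ interchange (d-H b y) (sumD y R) (sumD b R) (pairs R) ⟩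
  d-H b y + sumD b R + (sumD y R + pairs R) ∎
  where open ≡-Reasoning

pairs≤ : ∀ (S : List (Vec Bool n)) → pairs S ≤ length S * (length S * n)
pairs≤         []      = z≤n
pairs≤ {n = n} (y ∷ R) = +-mono-≤ (≤-trans (sumD≤ y R) (m≤n+m (length R * n) n))
  (≤-trans (pairs≤ R) (*-monoʳ-≤ (length R) (m≤n+m (length R * n) n)))

module _ (C : List (Vec Bool n)) where

  better-spec : ∀ R (a z : Vec Bool n) → let b = better R a z in
                sumD a R ≤ sumD b R × sumD z R ≤ sumD b R × (b ≡ a ⊎ (b ≡ z × sumD a R < sumD b R))
  better-spec R a z with sumD z R ∸ sumD a R in eq
  ... | zero  = ≤-refl , m∸n≡0⇒m≤n eq , inj₁ refl
  ... | suc d = <⇒≤ lt , ≤-refl , inj₂ (refl , lt)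
    where
    lt : sumD a R < sumD z R
    lt = ≰⇒> λ le → contradiction (trans (sym eq) (m≤n⇒m∸n≡0 le)) λ ()

  best-spec : ∀ Cs R (y : Vec Bool n) → let b = best Cs R y in
              (∀ {z} → z ∈ Cs → sumD z R ≤ sumD b R) × (b ≡ y ⊎ (b ∈ Cs × sumD y R < sumD b R))
  best-spec []       R y = (λ ()) , inj₁ refl
  best-spec (z ∷ Cs) R y with upper , from ← best-spec Cs R (better R y z) with better-spec R y z
  ... | le₁ , le₂ , from′ = above , pick from from′
    where
    grows : ∀ {b b′} → b ≡ b′ ⊎ (b ∈ Cs × sumD b′ R < sumD b R) → sumD b′ R ≤ sumD b R
    grows (inj₁ eq)       = ≤-reflexive (cong (λ b → sumD b R) (sym eq))
    grows (inj₂ (_ , lt)) = <⇒≤ lt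
    above : ∀ {x} → x ∈ z ∷ Cs → sumD x R ≤ sumD (best Cs R (better R y z)) R
    above (here refl) = ≤-trans le₂ (grows from)
    above (there x∈)  = upper x∈
    pick : ∀ {b b′} → b ≡ b′ ⊎ (b ∈ Cs × sumD b′ R < sumD b R) → b′ ≡ y ⊎ (b′ ≡ z × sumD y R < sumD b′ R) →
           b ≡ y ⊎ (b ∈ z ∷ Cs × sumD y R < sumD b R)
    pick (inj₁ refl)      (inj₁ refl)       = inj₁ refl
    pick (inj₁ refl)      (inj₂ (refl , h)) = inj₂ (here refl , h)
    pick (inj₂ (b∈ , lt)) (inj₁ refl)       = inj₂ (there b∈ , lt)
    pick (inj₂ (b∈ , lt)) (inj₂ (refl , h)) = inj₂ (there b∈ , <-trans h lt)

  -- sumD z S still counts the member y that z would replace, hence the term d-H z y.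
  OptAt : List (Vec Bool n) → Vec Bool n → Set
  OptAt S y = ∀ {z} → z ∈ C → sumD z S ≤ sumD y S + d-H z y

  -- A step without gain changes only the order and certifies the member that it tried.
  step-spec : ∀ y R → pairs (y ∷ R) < pairs (improve C (y ∷ R)) ⊎ (improve C (y ∷ R) ≡ R ∷ʳ y × OptAt (y ∷ R) y)
  step-spec y R with best-spec C R y
  ... | upper , inj₂ (_ , lt) = inj₁ (≤-trans (+-monoˡ-< (pairs R) lt) (≤-reflexive (sym (pairs-∷ʳ R (best C R y)))))
  ... | upper , inj₁ eq       = inj₂ (cong (R ∷ʳ_) eq , λ {z} z∈ → begin
    d-H z y + sumD z R ≤⟨ +-monoʳ-≤ (d-H z y) (≤-trans (upper z∈) (≤-reflexive (cong (λ b → sumD b R) eq))) ⟩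
    d-H z y + sumD y R ≤⟨ +-monoʳ-≤ (d-H z y) (m≤n+m (sumD y R) (d-H y y)) ⟩
    d-H z y + (d-H y y + sumD y R) ≡⟨ +-comm (d-H z y) _ ⟩
    d-H y y + sumD y R + d-H z y ∎)
    where open ≤-Reasoning

  pairs-improve : ∀ S → pairs S ≤ pairs (improve C S)
  pairs-improve []      = ≤-refl
  pairs-improve (y ∷ R) with step-spec y R
  ... | inj₁ lt       = <⇒≤ lt
  ... | inj₂ (eq , _) = ≤-reflexive (trans (sym (pairs-∷ʳ R y)) (cong pairs (sym eq)))

  pairs-times : ∀ j S → pairs S ≤ pairs (times j (improve C) S)
  pairs-times zero    S = ≤-refl
  pairs-times (suc j) S = ≤-trans (pairs-improve S) (pairs-times j (improve C S))

  -- `P` waits to be tried and `Q` has been tried. `OptAt` refers to sums over the whole list, so it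
  -- survives the rotations of the queue.
  sweep : ∀ P Q → pairs (P ++ Q) < pairs (times (length P) (improve C) (P ++ Q)) ⊎
          (times (length P) (improve C) (P ++ Q) ≡ Q ++ P × All (OptAt (P ++ Q)) P)
  sweep []      Q = inj₂ (sym (++-identityʳ Q) , [])
  sweep (y ∷ P) Q with step-spec y (P ++ Q)
  ... | inj₁ lt = inj₁ (≤-trans lt (pairs-times (length P) (improve C (y ∷ P ++ Q))))
  ... | inj₂ (eq , opt) rewrite eq | ++-assoc P Q (y ∷ []) with sweep P (Q ∷ʳ y)
  ...   | inj₁ lt = inj₁ (≤-trans (s≤s (≤-reflexive rotated)) lt)
    where
    rotated : pairs (y ∷ P ++ Q) ≡ pairs (P ++ Q ∷ʳ y)
    rotated = trans (sym (pairs-∷ʳ (P ++ Q) y)) (cong pairs (++-assoc P Q (y ∷ [])))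
  ...   | inj₂ (eq′ , opts) = inj₂ (trans eq′ (++-assoc Q (y ∷ []) P) , opt ∷ All.map (λ {x} o {z} z∈ → subst₂ _≤_ (same z) (cong (_+ d-H z x) (same x)) (o z∈)) opts)
    where
    same : ∀ z → sumD z (P ++ Q ∷ʳ y) ≡ sumD z (y ∷ P ++ Q)
    same z = trans (cong (sumD z) (sym (++-assoc P Q (y ∷ [])))) (sumD-∷ʳ z (P ++ Q) y)

  LocallyOptimal : List (Vec Bool n) → Set
  LocallyOptimal S = All (OptAt S) S

  module _ (s : ℕ) where

    phase : List (Vec Bool n) → List (Vec Bool n)
    phase = times s (improve C)

    phase-spec : ∀ S → length S ≡ s → pairs S < pairs (phase S) ⊎ (phase S ≡ S × LocallyOptimal S)
    phase-spec S refl with sweep S []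
    ... | r rewrite ++-identityʳ S = r

    times-fixed : ∀ p {S} → phase S ≡ S → times p phase S ≡ S
    times-fixed zero    eq = refl
    times-fixed (suc p) eq = trans (cong (times p phase) eq) (times-fixed p eq)

    -- A phase without gain is a fixed point, so all later phases keep the local optimum.
    phases : ∀ p S → length S ≡ s → pairs S + p ≤ pairs (times p phase S) ⊎ LocallyOptimal (times p phase S)
    phases zero    S lS = inj₁ (≤-reflexive (+-identityʳ _))
    phases (suc p) S lS with phase-spec S lS
    ... | inj₂ (eq , opt) = inj₂ (subst LocallyOptimal (sym (times-fixed (suc p) eq)) opt)
    ... | inj₁ lt with phases p (phase S) (trans (times-length s (improve C) (length-improve C) S) lS)
    ...   | inj₂ opt = inj₂ opt
    ...   | inj₁ le  = inj₁ (≤-trans (≤-reflexive (+-suc (pairs S) p)) (≤-trans (+-monoˡ-≤ p lt) le))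

    localSearch-phases : ∀ S → localSearch n s C S ≡ times (suc n * (s * s)) phase S
    localSearch-phases S = trans (times-cong (suc n) (times-* s s phase) S) (times-* (suc n) (s * s) phase S)

    length-localSearch : ∀ S → length S ≡ s → length (localSearch n s C S) ≡ s
    length-localSearch S lS rewrite localSearch-phases S =
      trans (times-length (suc n * (s * s)) phase (times-length s (improve C) (length-improve C)) S) lS

    localSearch-optimal : .{{_ : NonZero s}} → ∀ S → length S ≡ s → LocallyOptimal (localSearch n s C S)
    localSearch-optimal S lS with phases (suc n * (s * s)) S lS
    ... | inj₂ opt = subst LocallyOptimal (sym (localSearch-phases S)) opt
    -- Otherwise every phase would have raised the potential by at least one, past its bound
    -- `s * (s * n)`.
    ... | inj₁ le  = contradiction (≤-trans (m≤n+m _ (pairs S)) le) (<⇒≱ (begin-strict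
      pairs S′ ≤⟨ pairs≤ S′ ⟩
      length S′ * (length S′ * n) ≡⟨ cong (λ l → l * (l * n)) lS′ ⟩
      s * (s * n) ≡⟨ solve 2 (λ s n → s :* (s :* n) := n :* (s :* s)) refl s n ⟩
      n * (s * s) <⟨ m<n+m (n * (s * s)) (>-nonZero⁻¹ (s * s) {{m*n≢0 s s}}) ⟩
      suc n * (s * s) ∎))
      where
      open ≤-Reasoning
      S′ : List (Vec Bool n)
      S′ = times (suc n * (s * s)) phase S
      lS′ : length S′ ≡ s
      lS′ = trans (times-length (suc n * (s * s)) phase (times-length s (improve C) (length-improve C)) S) lS

  improve-⊆ : ∀ S → All (_∈ C) S → All (_∈ C) (improve C S)
  improve-⊆ []      []        = []
  improve-⊆ (y ∷ R) (y∈ ∷ R∈) with best-spec C R y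
  ... | _ , inj₁ eq       = ∷ʳ⁺ R∈ (subst (_∈ C) (sym eq) y∈)
  ... | _ , inj₂ (b∈ , _) = ∷ʳ⁺ R∈ b∈

times-preserves : ∀ {A : Set} {P : A → Set} {f : A → A} → (∀ x → P x → P (f x)) → ∀ p x → P x → P (times p f x)
times-preserves h zero    x px = px
times-preserves h (suc p) x px = times-preserves h p _ (h x px)

module _ {n s : ℕ} .{{_ : NonZero s}} (z : Vec Bool n) (C : List (Vec Bool n)) where

  private
    start : List (Vec Bool n)
    start = times s (z ∷_) []

    length-start : length start ≡ s
    length-start = trans (times-replicate s z []) (+-identityʳ s)

  disperse-length : length (disperse n s (z ∷ C)) ≡ s
  disperse-length = length-localSearch (z ∷ C) s start length-start

  disperse-optimal : LocallyOptimal (z ∷ C) (disperse n s (z ∷ C))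
  disperse-optimal = localSearch-optimal (z ∷ C) s start length-start

  disperse-⊆ : All (_∈ z ∷ C) (disperse n s (z ∷ C))
  disperse-⊆ = preserve (suc n) (preserve s (preserve s (preserve s (improve-⊆ (z ∷ C))))) start
    (times-preserves {P = All (_∈ z ∷ C)} (λ _ h → here refl ∷ h) s [] [])
    where
    preserve : ∀ p {f} → (∀ S → All (_∈ z ∷ C) S → All (_∈ z ∷ C) (f S)) → ∀ S → All (_∈ z ∷ C) S → All (_∈ z ∷ C) (times p f S)
    preserve p h = times-preserves {P = All (_∈ z ∷ C)} h p

-- Inequalities between sums of distances

cross : List (Vec Bool n) → List (Vec Bool n) → ℕ
cross O S = sumOver (λ x → sumD x S) O

cross-cartesian : ∀ (O S : List (Vec Bool n)) → sum (cartesianProductWith d-H O S) ≡ cross O S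
cross-cartesian []      S = refl
cross-cartesian (x ∷ O) S = trans (sum-++ (map (d-H x) S) _) (cong₂ _+_ (row S) (cross-cartesian O S))
  where
  row : ∀ S → sum (map (d-H x) S) ≡ sumD x S
  row []      = refl
  row (y ∷ S) = cong (d-H x y +_) (row S)

ones zeros : List Bool → ℕ
ones []          = 0
ones (true ∷ X)  = suc (ones X)
ones (false ∷ X) = ones X
zeros []          = 0
zeros (true ∷ X)  = zeros X
zeros (false ∷ X) = suc (zeros X)

ones+zeros : ∀ X → ones X + zeros X ≡ length X
ones+zeros []          = refl
ones+zeros (true ∷ X)  = cong suc (ones+zeros X)
ones+zeros (false ∷ X) = trans (+-suc _ _) (cong suc (ones+zeros X))

heads : List (Vec Bool (suc n)) → List Bool
heads = map Vec.head

tails : List (Vec Bool (suc n)) → List (Vec Bool n)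
tails = map Vec.tail

sumD-bits : ∀ x u (S : List (Vec Bool (suc n))) →
            sumD (x ∷ u) S ≡ (if x then zeros (heads S) else ones (heads S)) + sumD u (tails S)
sumD-bits true  u []                = refl
sumD-bits false u []                = refl
sumD-bits true  u ((true ∷ v) ∷ S)  = trans (cong (d-H u v +_) (sumD-bits true u S)) (x∙yz≈y∙xz (d-H u v) (zeros (heads S)) _)
sumD-bits true  u ((false ∷ v) ∷ S) = cong suc (trans (cong (d-H u v +_) (sumD-bits true u S)) (x∙yz≈y∙xz (d-H u v) (zeros (heads S)) _))
sumD-bits false u ((true ∷ v) ∷ S)  = cong suc (trans (cong (d-H u v +_) (sumD-bits false u S)) (x∙yz≈y∙xz (d-H u v) (ones (heads S)) _))
sumD-bits false u ((false ∷ v) ∷ S) = trans (cong (d-H u v +_) (sumD-bits false u S)) (x∙yz≈y∙xz (d-H u v) (ones (heads S)) _)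

bits : List Bool → List Bool → ℕ
bits X Y = ones X * zeros Y + zeros X * ones Y

cross-bits : ∀ (O S : List (Vec Bool (suc n))) → cross O S ≡ bits (heads O) (heads S) + cross (tails O) (tails S)
cross-bits []                S = refl
cross-bits ((x ∷ u) ∷ O) S = trans (cong₂ _+_ (sumD-bits x u S) (cross-bits O S)) (first x)
  where
  p = zeros (heads S)
  q = ones (heads S)
  a = ones (heads O)
  b = zeros (heads O)
  first : ∀ x → (if x then p else q) + sumD u (tails S) + (bits (heads O) (heads S) + cross (tails O) (tails S))
          ≡ bits (x ∷ heads O) (heads S) + (sumD u (tails S) + cross (tails O) (tails S))
  first true  = solve 6 (λ p q a b d c → p :+ d :+ (a :* p :+ b :* q :+ c) := (con 1 :+ a) :* p :+ b :* q :+ (d :+ c)) refl p q a b (sumD u (tails S)) (cross (tails O) (tails S))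
  first false = solve 6 (λ p q a b d c → q :+ d :+ (a :* p :+ b :* q :+ c) := a :* p :+ (con 1 :+ b) :* q :+ (d :+ c)) refl p q a b (sumD u (tails S)) (cross (tails O) (tails S))

cross-Vec0 : ∀ (O S : List (Vec Bool 0)) → cross O S ≡ 0
cross-Vec0 []       S = refl
cross-Vec0 ([] ∷ O) S = cong₂ _+_ (n≤0⇒n≡0 (≤-trans (sumD≤ [] S) (≤-reflexive (*-zeroʳ (length S))))) (cross-Vec0 O S)

-- (o₁ - p₁)² ≥ 0
square-nonneg : ∀ o₁ o₀ p₁ p₀ → o₁ + o₀ ≡ p₁ + p₀ → (o₁ * o₀ + o₀ * o₁) + (p₁ * p₀ + p₀ * p₁) ≤ 2 * (o₁ * p₀ + o₀ * p₁)
square-nonneg o₁ o₀ p₁ p₀ eq with ≤-total o₁ p₁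
... | inj₁ le with e , refl ← m≤n⇒∃[o]m+o≡n le rewrite +-cancelˡ-≡ o₁ o₀ (e + p₀) (trans eq (+-assoc o₁ e p₀)) =
  ≤-trans (m≤m+n _ (2 * (e * e))) (≤-reflexive (solve 3 (λ o e p → let o₀ = e :+ p; p₁ = o :+ e in
    (o :* o₀ :+ o₀ :* o) :+ (p₁ :* p :+ p :* p₁) :+ con 2 :* (e :* e) := con 2 :* (o :* p :+ o₀ :* p₁)) refl o₁ e p₀))
... | inj₂ le with e , refl ← m≤n⇒∃[o]m+o≡n le rewrite sym (+-cancelˡ-≡ p₁ (e + o₀) p₀ (trans (sym (+-assoc p₁ e o₀)) eq)) =
  ≤-trans (m≤m+n _ (2 * (e * e))) (≤-reflexive (solve 3 (λ p e o → let p₀ = e :+ o; o₁ = p :+ e in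
    (o₁ :* o :+ o :* o₁) :+ (p :* p₀ :+ p₀ :* p) :+ con 2 :* (e :* e) := con 2 :* (o₁ :* p₀ :+ o :* p)) refl p₁ e o₀))

module _ where
  open ≤-Reasoning

  -- A coordinate with `o₁` ones in `O` and `p₁` in `S` contributes 2 (o₁ - p₁)² to the difference
  -- of the two sides; the zeros differ by the same amount because the lengths agree.
  negative-type : ∀ (O S : List (Vec Bool n)) → length O ≡ length S → cross O O + cross S S ≤ 2 * cross O S
  negative-type {zero}  O S eq = ≤-trans (≤-reflexive (cong₂ _+_ (cross-Vec0 O O) (cross-Vec0 S S))) z≤n
  negative-type {suc n} O S eq = begin
    cross O O + cross S S ≡⟨ cong₂ _+_ (cross-bits O O) (cross-bits S S) ⟩
    bits X X + cross O′ O′ + (bits Y Y + cross S′ S′) ≡⟨ interchange (bits X X) (cross O′ O′) (bits Y Y) (cross S′ S′) ⟩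
    bits X X + bits Y Y + (cross O′ O′ + cross S′ S′) ≤⟨ +-mono-≤ (square-nonneg (ones X) (zeros X) (ones Y) (zeros Y)
                                                            (trans (ones+zeros X) (trans (length-map Vec.head O) (trans eq (trans (sym (length-map Vec.head S)) (sym (ones+zeros Y)))))))
                                                            (negative-type O′ S′ (trans (length-map Vec.tail O) (trans eq (sym (length-map Vec.tail S))))) ⟩
    2 * bits X Y + 2 * cross O′ S′ ≡⟨ sym (*-distribˡ-+ 2 (bits X Y) (cross O′ S′)) ⟩
    2 * (bits X Y + cross O′ S′) ≡⟨ cong (2 *_) (sym (cross-bits O S)) ⟩
    2 * cross O S ∎
    where
    X = heads O
    Y = heads S
    O′ = tails O
    S′ = tails S

  -- One coordinate of the sum of d(x, x′) ≤ d(x, y) + d(y, x′) over x ≠ x′ in `O` and y in `S`.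
  -- Each x has only `s` partners x′; in a column this means that `o₀` is at most `s` once `o₁` is
  -- positive.
  triangle-bits : ∀ s X Y → length X ≡ suc s → length Y ≡ suc s → suc s * bits X X ≤ 2 * (s * bits X Y)
  triangle-bits s X Y lX lY = begin
    suc s * (o₁ * o₀ + o₀ * o₁) ≡⟨ cong (_* (o₁ * o₀ + o₀ * o₁)) (trans (sym lY) (sym (ones+zeros Y))) ⟩
    (p₁ + p₀) * (o₁ * o₀ + o₀ * o₁) ≡⟨ solve 4 (λ o o′ p p′ → (p :+ p′) :* (o :* o′ :+ o′ :* o) := con 2 :* (o′ :* (o :* p′) :+ o :* (o′ :* p))) refl o₁ o₀ p₁ p₀ ⟩
    2 * (o₀ * (o₁ * p₀) + o₁ * (o₀ * p₁)) ≤⟨ *-monoʳ-≤ 2 (+-mono-≤ (part o₁ o₀ p₀ (trans (ones+zeros X) lX)) (part o₀ o₁ p₁ (trans (+-comm o₀ o₁) (trans (ones+zeros X) lX)))) ⟩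
    2 * (s * (o₁ * p₀) + s * (o₀ * p₁)) ≡⟨ cong (2 *_) (sym (*-distribˡ-+ s (o₁ * p₀) (o₀ * p₁))) ⟩
    2 * (s * (o₁ * p₀ + o₀ * p₁)) ∎
    where
    o₁ = ones X
    o₀ = zeros X
    p₁ = ones Y
    p₀ = zeros Y
    part : ∀ a b p → a + b ≡ suc s → b * (a * p) ≤ s * (a * p)
    part zero    b p eq = ≤-reflexive (trans (*-zeroʳ b) (sym (*-zeroʳ s)))
    part (suc a) b p eq = *-monoˡ-≤ (suc a * p) (≤-trans (m≤n+m b a) (≤-reflexive (suc-injective eq)))

  triangle : ∀ s (O S : List (Vec Bool n)) → length O ≡ suc s → length S ≡ suc s → suc s * cross O O ≤ 2 * (s * cross O S)
  triangle {zero}  s O S lO lS = ≤-trans (≤-reflexive (trans (cong (suc s *_) (cross-Vec0 O O)) (*-zeroʳ (suc s)))) z≤n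
  triangle {suc n} s O S lO lS = begin
    suc s * cross O O ≡⟨ trans (cong (suc s *_) (cross-bits O O)) (*-distribˡ-+ (suc s) (bits X X) (cross O′ O′)) ⟩
    suc s * bits X X + suc s * cross O′ O′ ≤⟨ +-mono-≤ (triangle-bits s X Y (trans (length-map Vec.head O) lO) (trans (length-map Vec.head S) lS))
                                                            (triangle s O′ S′ (trans (length-map Vec.tail O) lO) (trans (length-map Vec.tail S) lS)) ⟩
    2 * (s * bits X Y) + 2 * (s * cross O′ S′) ≡⟨ solve 3 (λ s a b → con 2 :* (s :* a) :+ con 2 :* (s :* b) := con 2 :* (s :* (a :+ b))) refl s (bits X Y) (cross O′ S′) ⟩
    2 * (s * (bits X Y + cross O′ S′)) ≡⟨ cong (λ x → 2 * (s * x)) (sym (cross-bits O S)) ⟩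
    2 * (s * cross O S) ∎
    where
    X = heads O
    Y = heads S
    O′ = tails O
    S′ = tails S

-- h stands for k - 1.
module _ (h : ℕ) (C : List (Vec Bool n)) where

  Approximated : Vec Bool n → Set
  Approximated x = ∀ R → ∃[ z ] z ∈ C × suc (suc h) * sumD x R ≤ suc (suc h) * sumD z R + 2 * sumD x R

  module _ {S : List (Vec Bool n)} (opt : LocallyOptimal C S) where
    open ≤-Reasoning

    -- The candidate `z` stands in for `x` against `S` without `y`, and local optimality bounds `z`
    -- by `y`. The last summand restores d(x, y), which the exchange does not see.
    exchange : ∀ {x y} → Approximated x → y ∈ S → h * sumD x S ≤ suc (suc h) * sumD y S + h * d-H x y
    exchange {x} {y} app y∈ with A , B , S≡ ← ∈-∃++ y∈ with z , z∈ , le ← app (A ++ B) = begin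
      h * sumD x S ≡⟨ cong (h *_) (remove x) ⟩
      h * (sumD x R + d-H x y) ≡⟨ *-distribˡ-+ h (sumD x R) (d-H x y) ⟩
      h * sumD x R + h * d-H x y ≤⟨ +-monoˡ-≤ (h * d-H x y) (+-cancelʳ-≤ (2 * sumD x R) _ _ (begin
        h * sumD x R + 2 * sumD x R ≡⟨ solve 2 (λ h a → h :* a :+ con 2 :* a := (con 2 :+ h) :* a) refl h (sumD x R) ⟩
        suc (suc h) * sumD x R ≤⟨ le ⟩
        suc (suc h) * sumD z R + 2 * sumD x R ≤⟨ +-monoˡ-≤ (2 * sumD x R) (*-monoʳ-≤ (suc (suc h)) zR≤) ⟩
        suc (suc h) * sumD y S + 2 * sumD x R ∎)) ⟩
      suc (suc h) * sumD y S + h * d-H x y ∎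
      where
      R : List (Vec Bool n)
      R = A ++ B
      remove : ∀ x → sumD x S ≡ sumD x R + d-H x y
      remove x = trans (cong (sumD x) S≡) (trans (sumD-++ x A (y ∷ B))
        (trans (solve 3 (λ a b c → a :+ (b :+ c) := a :+ c :+ b) refl (sumD x A) (d-H x y) (sumD x B)) (cong (_+ d-H x y) (sym (sumD-++ x A B)))))
      zR≤ : sumD z R ≤ sumD y S
      zR≤ = +-cancelʳ-≤ (d-H z y) _ _ (≤-trans (≤-reflexive (sym (remove z))) (All.lookup opt y∈ z∈))

    -- Summed over all `y`, the terms d(x, y) make up one `sumD x S`, so the effective factor on the
    -- left is |S| - 1.
    exchange-sum : ∀ {x} → Approximated x → length S * (h * sumD x S) ≤ suc (suc h) * cross S S + h * sumD x S
    exchange-sum {x} app = go S (λ y∈ → y∈)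
      where
      go : ∀ T → (∀ {y} → y ∈ T → y ∈ S) → length T * (h * sumD x S) ≤ suc (suc h) * cross T S + h * sumD x T
      go []      sub = z≤n
      go (y ∷ T) sub = begin
        h * sumD x S + length T * (h * sumD x S) ≤⟨ +-mono-≤ (exchange app (sub (here refl))) (go T (λ p → sub (there p))) ⟩
        suc (suc h) * sumD y S + h * d-H x y + (suc (suc h) * cross T S + h * sumD x T)
          ≡⟨ solve 5 (λ h a b c d → (con 2 :+ h) :* a :+ h :* b :+ ((con 2 :+ h) :* c :+ h :* d) := (con 2 :+ h) :* (a :+ c) :+ h :* (b :+ d)) refl h (sumD y S) (d-H x y) (cross T S) (sumD x T) ⟩
        suc (suc h) * cross (y ∷ T) S + h * sumD x (y ∷ T) ∎

    module _ {O : List (Vec Bool n)} {s : ℕ} (app : All Approximated O) (lO : length O ≡ suc s) (lS : length S ≡ suc s) where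

      cross-bound : s * (h * cross O S) ≤ suc s * (suc (suc h) * cross S S)
      cross-bound = +-cancelˡ-≤ (h * cross O S) _ _ (subst (λ l → suc s * (h * cross O S) ≤ h * cross O S + l * (suc (suc h) * cross S S)) lO (go app))
        where
        go : ∀ {T} → All Approximated T → suc s * (h * cross T S) ≤ h * cross T S + length T * (suc (suc h) * cross S S)
        go []                   = ≤-reflexive (trans (cong (suc s *_) (*-zeroʳ h)) (trans (*-zeroʳ (suc s)) (sym (trans (+-identityʳ _) (*-zeroʳ h)))))
        go {x ∷ T} (appx ∷ rest) = begin
          suc s * (h * (sumD x S + cross T S)) ≡⟨ solve 4 (λ s h a b → s :* (h :* (a :+ b)) := s :* (h :* a) :+ s :* (h :* b)) refl (suc s) h (sumD x S) (cross T S) ⟩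
          suc s * (h * sumD x S) + suc s * (h * cross T S) ≤⟨ +-mono-≤ (subst (λ l → l * (h * sumD x S) ≤ suc (suc h) * cross S S + h * sumD x S) lS (exchange-sum appx)) (go rest) ⟩
          suc (suc h) * cross S S + h * sumD x S + (h * cross T S + length T * (suc (suc h) * cross S S))
            ≡⟨ solve 5 (λ a h b c d → a :+ h :* b :+ (h :* c :+ d) := h :* (b :+ c) :+ (a :+ d)) refl (suc (suc h) * cross S S) h (sumD x S) (cross T S) (length T * (suc (suc h) * cross S S)) ⟩
          h * (sumD x S + cross T S) + suc (length T) * (suc (suc h) * cross S S) ∎

      small-bound : h * cross O O ≤ 2 * (suc (suc h) * cross S S)
      small-bound = *-cancelˡ-≤ (suc s) (begin
        suc s * (h * cross O O) ≡⟨ solve 3 (λ s h a → s :* (h :* a) := h :* (s :* a)) refl (suc s) h (cross O O) ⟩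
        h * (suc s * cross O O) ≤⟨ *-monoʳ-≤ h (triangle s O S lO lS) ⟩
        h * (2 * (s * cross O S)) ≡⟨ solve 3 (λ h s a → h :* (con 2 :* (s :* a)) := con 2 :* (s :* (h :* a))) refl h s (cross O S) ⟩
        2 * (s * (h * cross O S)) ≤⟨ *-monoʳ-≤ 2 cross-bound ⟩
        2 * (suc s * (suc (suc h) * cross S S)) ≡⟨ solve 2 (λ s a → con 2 :* (s :* a) := s :* (con 2 :* a)) refl (suc s) (suc (suc h) * cross S S) ⟩
        suc s * (2 * (suc (suc h) * cross S S)) ∎)

      -- `negative-type` adds h s `cross S S` on the left. Taking it off 2 (s + 1)(h + 2) leaves (s
      -- + 1)(h + 4) + h, the denominator in `largeRatio-eq`.
      large-bound : h * s * cross O O ≤ (suc s * (4 + h) + h) * cross S S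
      large-bound = +-cancelʳ-≤ (h * s * cross S S) _ _ (begin
        h * s * cross O O + h * s * cross S S ≡⟨ sym (*-distribˡ-+ (h * s) (cross O O) (cross S S)) ⟩
        h * s * (cross O O + cross S S) ≤⟨ *-monoʳ-≤ (h * s) (negative-type O S (trans lO (sym lS))) ⟩
        h * s * (2 * cross O S) ≡⟨ solve 3 (λ h s a → h :* s :* (con 2 :* a) := con 2 :* (s :* (h :* a))) refl h s (cross O S) ⟩
        2 * (s * (h * cross O S)) ≤⟨ *-monoʳ-≤ 2 cross-bound ⟩
        2 * (suc s * (suc (suc h) * cross S S)) ≡⟨ solve 3 (λ s h a → con 2 :* ((con 1 :+ s) :* ((con 2 :+ h) :* a)) := ((con 1 :+ s) :* (con 4 :+ h) :+ h) :* a :+ h :* s :* a) refl s h (cross S S) ⟩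
        (suc s * (4 + h) + h) * cross S S + h * s * cross S S ∎)

-- Time and success

as-Vec : ∀ {A : Set} {s} (L : List A) → length L ≡ s → ∃[ S ] toList {n = s} S ≡ L
as-Vec []      refl = [] , refl
as-Vec (x ∷ L) refl with S , eq ← as-Vec L refl = x ∷ S , cong (x ∷_) eq

All-toList⁻ : ∀ {A : Set} {P : A → Set} {s} (S : Vec A s) → All P (toList S) → VecAll.All P S
All-toList⁻ []      []       = []
All-toList⁻ (x ∷ S) (p ∷ ps) = p ∷ All-toList⁻ S ps

All-toList⁺ : ∀ {A : Set} {P : A → Set} {s} {S : Vec A s} → VecAll.All P S → All P (toList S)
All-toList⁺ []       = []
All-toList⁺ (p ∷ ps) = p ∷ All-toList⁺ ps

decode-bits : (z : Vec Bool n) → decodeVec decodeBit n (encA z) ≡ just z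
decode-bits []          = refl
decode-bits (false ∷ z) rewrite decode-bits z = refl
decode-bits (true ∷ z)  rewrite decode-bits z = refl

decode-output : ∀ {s} (S : Vec (Vec Bool n) s) → decodeOutput n s (encL (toList S)) ≡ just S
decode-output []      = refl
decode-output (z ∷ S) rewrite decode-bits z | decode-output S = refl

sumPD-cross : ∀ {s} (S : Vec (Vec Bool n) s) → sumPD S ≡ ℚ.½ ℚ.* ι (cross (toList S) (toList S))
sumPD-cross S = cong (λ t → ℚ.½ ℚ.* ι t) (cross-cartesian (toList S) (toList S))

module _ {h s : ℕ} {F : CNF n} {S : Vec (Vec Bool n) (suc s)} (sat : VecAll.All (Sat F) S) (C : List (Vec Bool n))
         (opt : LocallyOptimal C (toList S)) (app : ∀ {x} → Sat F x → Approximated h C x) (satisfiable : Satisfiable F) where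

  private
    bound : ∀ ratio a c .{{_ : NonZero c}} (O : Vec (Vec Bool n) (suc s)) → sumPD O ≡ OptSum F (suc s) → ι c ℚ.* ratio ≡ ι a →
            a * cross (toList O) (toList O) ≤ c * cross (toList S) (toList S) → ratio ℚ.* OptSum F (suc s) ℚ.≤ sumPD S
    bound ratio a c O O≡ eq le = subst₂ (λ x y → ratio ℚ.* x ℚ.≤ y) (trans (sym (sumPD-cross O)) O≡) (sym (sumPD-cross S))
      (scale-≤ {ratio} {a} {c} {cross (toList O) (toList O)} {cross (toList S) (toList S)} eq le)

    module _ (O : Vec (Vec Bool n) (suc s)) (satO : VecAll.All (Sat F) O) where

      small : h * cross (toList O) (toList O) ≤ 2 * suc (suc h) * cross (toList S) (toList S)
      small = ≤-trans (small-bound h C opt (All.map (λ {x} → app {x}) (All-toList⁺ satO)) (length-toList O) (length-toList S))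
        (≤-reflexive (sym (*-assoc 2 (suc (suc h)) (cross (toList S) (toList S)))))

      large : h * s * cross (toList O) (toList O) ≤ (suc s * (4 + h) + h) * cross (toList S) (toList S)
      large = large-bound h C opt (All.map (λ {x} → app {x}) (All-toList⁺ satO)) (length-toList O) (length-toList S)

  optimum-good : Good (suc h) F (suc s) S
  optimum-good = from-optimum (OptSum-attained F (suc s) satisfiable)
    where
    from-optimum : (∃[ O ] VecAll.All (Sat F) {n = suc s} O × sumPD O ≡ OptSum F (suc s)) → Good (suc h) F (suc s) S
    from-optimum (O , satO , O≡) = good sat
      (λ _ → bound (smallRatio (suc h)) h (2 * suc (suc h)) O O≡ (smallRatio-eq h) (small O satO))
      (λ _ → bound (largeRatio (suc h) (suc s)) (h * s) (suc s * (4 + h) + h) {{>-nonZero (≤-trans z<s (m≤m+n (suc s * (4 + h)) h))}}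
               O O≡ (largeRatio-eq h s) (large O satO))

disperse-good : ∀ {h s} {F : CNF n} (C : List (Vec Bool n)) → All (Sat F) C → (∀ {x} → Sat F x → Approximated h C x) →
                Satisfiable F → ∃[ S ] toList {n = suc s} S ≡ disperse n (suc s) C × Good (suc h) F (suc s) S
-- Approximation with respect to the empty multiset already provides a candidate.
disperse-good [] satC app (x , satx) with () ← proj₁ (proj₂ (app {x} satx []))
disperse-good {n = n} {s = s} {F} (z ∷ C) satC app satisfiable with S , eq ← as-Vec (disperse n (suc s) (z ∷ C)) (disperse-length {s = suc s} z C) =
  S , eq , optimum-good (All-toList⁻ S (subst (All (Sat F)) (sym eq) (All.map (All.lookup satC) (disperse-⊆ {s = suc s} z C)))) (z ∷ C)
             (subst (LocallyOptimal (z ∷ C)) (sym eq) (disperse-optimal {s = suc s} z C)) (λ {x} → app {x}) satisfiable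

-- Adding up the time

≤-multiple : ∀ x r {u} .{{_ : NonZero r}} → r * x ≡ u → x ≤ u
≤-multiple x r eq = ≤-trans (m≤n*m x r) (≤-reflexive eq)

module _ {k : ℕ} (code : BlockCode k) where
  open BlockCode code

  words≢0 : NonZero (length words)
  words≢0 with w , w∈ , _ ← covers (Vec.replicate _ false) = nonempty w∈
    where
    nonempty : ∀ {A : Set} {x : A} {xs} → x ∈ xs → NonZero (length xs)
    nonempty (here _)  = _
    nonempty (there _) = _

  family-lengths : All (λ κ → length κ ≡ length words) (family code)
  family-lengths = All.tabulate λ {κ} κ∈ → go (∈-cartesianProductWith⁻ (λ ρ a → map (λ c → rotateBy ρ (c ⊕ a)) words) (upTo (suc b′)) (bitVectors (suc b′)) κ∈)
    where
    go : ∀ {κ} → (∃[ ρ ] ∃[ a ] ρ ∈ upTo (suc b′) × a ∈ bitVectors (suc b′) × κ ≡ map (λ c → rotateBy ρ (c ⊕ a)) words) → length κ ≡ length words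
    go (_ , _ , _ , _ , refl) = length-map _ words

  constant : ℕ
  constant = suc (length words * suc b′ + size (encodeℕ b′) + size (encFam (family code)) + length (family code) + r + size (encodeℕ r) + k)

module _ (Z N ℓ s X : ℕ) where
  -- One product that dominates all units: `Z` bounds what depends on `k` only, `N` is n + 1, `ℓ`
  -- exceeds the number of clauses, and `X` bounds the number of words. The factor s⁴ comes from the
  -- local search alone.
  unit : ℕ
  unit = Z * Z * Z * (N * N * N) * ℓ * (s * s * s * s) * X

module _ (Z N ℓ s X : ℕ) .{{_ : NonZero Z}} .{{_ : NonZero N}} .{{_ : NonZero ℓ}} .{{_ : NonZero s}} .{{_ : NonZero X}} where

  private
    infixr 5 _⊗_
    _⊗_ : ∀ {a b} → NonZero a → NonZero b → NonZero (a * b)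
    _⊗_ {a} {b} p q = m*n≢0 a b {{p}} {{q}}
    nz : ∀ a .{{_ : NonZero a}} → NonZero a
    nz (suc a) = _

  unit≢0 : NonZero (unit Z N ℓ s X)
  unit≢0 = (((((nz Z ⊗ nz Z) ⊗ nz Z) ⊗ ((nz N ⊗ nz N) ⊗ nz N)) ⊗ nz ℓ) ⊗ (((nz s ⊗ nz s) ⊗ nz s) ⊗ nz s)) ⊗ nz X

  unit₁ : N * (Z * N) ≤ unit Z N ℓ s X
  unit₁ = ≤-multiple _ (Z * Z * N * ℓ * (s * s * s * s) * X) {{((((nz Z ⊗ nz Z) ⊗ nz N) ⊗ nz ℓ) ⊗ (((nz s ⊗ nz s) ⊗ nz s) ⊗ nz s)) ⊗ nz X}}
    (solve 5 (λ z n l s x → z :* z :* n :* l :* (s :* s :* s :* s) :* x :* (n :* (z :* n)) := z :* z :* z :* (n :* n :* n) :* l :* (s :* s :* s :* s) :* x) refl Z N ℓ s X)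

  unit₂ : Z * (N * Z * (X * (Z * N))) ≤ unit Z N ℓ s X
  unit₂ = ≤-multiple _ (N * ℓ * (s * s * s * s)) {{(nz N ⊗ nz ℓ) ⊗ (((nz s ⊗ nz s) ⊗ nz s) ⊗ nz s)}}
    (solve 5 (λ z n l s x → n :* l :* (s :* s :* s :* s) :* (z :* (n :* z :* (x :* (z :* n)))) := z :* z :* z :* (n :* n :* n) :* l :* (s :* s :* s :* s) :* x) refl Z N ℓ s X)

  unit₃ : N * Z * (Z * (X * (ℓ * (Z * N)))) ≤ unit Z N ℓ s X
  unit₃ = ≤-multiple _ (N * (s * s * s * s)) {{nz N ⊗ (((nz s ⊗ nz s) ⊗ nz s) ⊗ nz s)}}
    (solve 5 (λ z n l s x → n :* (s :* s :* s :* s) :* (n :* z :* (z :* (x :* (l :* (z :* n))))) := z :* z :* z :* (n :* n :* n) :* l :* (s :* s :* s :* s) :* x) refl Z N ℓ s X)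

  unit₄ : N * (s * (s * (s * (X * (s * N))))) ≤ unit Z N ℓ s X
  unit₄ = ≤-multiple _ (Z * Z * Z * N * ℓ) {{(((nz Z ⊗ nz Z) ⊗ nz Z) ⊗ nz N) ⊗ nz ℓ}}
    (solve 5 (λ z n l s x → z :* z :* z :* n :* l :* (n :* (s :* (s :* (s :* (x :* (s :* n)))))) := z :* z :* z :* (n :* n :* n) :* l :* (s :* s :* s :* s) :* x) refl Z N ℓ s X)

  unit₅ : Z ≤ unit Z N ℓ s X
  unit₅ = ≤-trans (≤-trans (m≤m*n Z N) (m≤n*m (Z * N) N)) unit₁

  unit₆ : s * (X * (s * N)) ≤ unit Z N ℓ s X
  unit₆ = ≤-trans (≤-multiple _ (N * (s * s)) {{nz N ⊗ (nz s ⊗ nz s)}}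
    (solve 3 (λ n s x → n :* (s :* s) :* (s :* (x :* (s :* n))) := n :* (s :* (s :* (s :* (x :* (s :* n)))))) refl N s X)) unit₄

  unit₇ : s ≤ X * (s * N)
  unit₇ = ≤-multiple s (X * N) {{nz X ⊗ nz N}} (solve 3 (λ n s x → x :* n :* s := x :* (s :* n)) refl N s X)

  unit₈ : X * (ℓ * (Z * N)) ≤ unit Z N ℓ s X
  unit₈ = ≤-trans (≤-multiple _ (N * Z * Z) {{(nz N ⊗ nz Z) ⊗ nz Z}} (*-assoc (N * Z) Z _)) unit₃

summands : ∀ a b c d e f g → let Z = suc (a + b + c + d + e + f + g) in
           a ≤ Z × b ≤ Z × c ≤ Z × d ≤ Z × e ≤ Z × f ≤ Z × g ≤ Z
summands a b c d e f g =
  up₂ (m≤m+n a b) , up₂ (m≤n+m b a) , up₃ (m≤n+m c _) , up₄ (m≤n+m d _) , up₅ (m≤n+m e _) , up₆ (m≤n+m f _) , up₇ (m≤n+m g _)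
  where
  up₇ : ∀ {x} → x ≤ a + b + c + d + e + f + g → x ≤ suc (a + b + c + d + e + f + g)
  up₇ = m≤n⇒m≤1+n
  up₆ : ∀ {x} → x ≤ a + b + c + d + e + f → x ≤ suc (a + b + c + d + e + f + g)
  up₆ le = up₇ (m≤n⇒m≤n+o g le)
  up₅ : ∀ {x} → x ≤ a + b + c + d + e → x ≤ suc (a + b + c + d + e + f + g)
  up₅ le = up₆ (m≤n⇒m≤n+o f le)
  up₄ : ∀ {x} → x ≤ a + b + c + d → x ≤ suc (a + b + c + d + e + f + g)
  up₄ le = up₅ (m≤n⇒m≤n+o e le)
  up₃ : ∀ {x} → x ≤ a + b + c → x ≤ suc (a + b + c + d + e + f + g)
  up₃ le = up₄ (m≤n⇒m≤n+o d le)
  up₂ : ∀ {x} → x ≤ a + b → x ≤ suc (a + b + c + d + e + f + g)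
  up₂ le = up₃ (m≤n⇒m≤n+o c le)

blocks≤ : ∀ b′ n {M Z} .{{_ : NonZero M}} → M * suc b′ ≤ Z → suc (blocks b′ n) ≤ suc n * Z
blocks≤ b′ n {M} {Z} le with c , c≤ , eq ← blocks-cover b′ n = begin
  suc (blocks b′ n) ≤⟨ s≤s (m≤m*n (blocks b′ n) (suc b′)) ⟩
  suc (blocks b′ n * suc b′) ≡⟨ cong suc eq ⟩
  suc (n + c) ≤⟨ s≤s (+-monoʳ-≤ n c≤) ⟩
  suc (n + b′) ≡⟨ cong suc (+-comm n b′) ⟩
  suc b′ + n ≤⟨ +-mono-≤ b≤Z (m≤m*n n Z {{>-nonZero (≤-trans z<s b≤Z)}}) ⟩
  Z + n * Z ∎
  where
  open ≤-Reasoning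
  b≤Z : suc b′ ≤ Z
  b≤Z = ≤-trans (m≤n*m (suc b′) M) le

module _ {h : ℕ} (code : BlockCode (suc h)) (F : CNF n) (kF : IsKCNF (suc h) F) (s : ℕ) .{{_ : NonZero s}} where
  open BlockCode code

  private
    K M Z N ℓ q X w₁ w₂ w₃ wC u₁ u₂ u₃ U : ℕ
    K = suc h
    fam : List (List (Vec Bool (suc b′)))
    fam = family code
    M = length words
    Z = constant code
    N = suc n
    ℓ = suc (length F)
    q = blocks b′ n
    X = length fam * (M * K ^ r) ^ q
    w₁ = N
    w₂ = Z * N
    w₃ = ℓ * w₂
    wC = Z * N
    u₁ = suc q * (M ^ q * wC)
    u₂ = X * w₃
    u₃ = Z * u₂
    U = unit Z N ℓ s X

    instance
      M≢0 : NonZero M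
      M≢0 = words≢0 code
      fam≢0 : NonZero (length fam)
      fam≢0 = subst NonZero (sym (length-family code)) (m*n≢0 (suc b′) (2 ^ suc b′) {{_}} {{m^n≢0 2 (suc b′)}})
      G≢0 : NonZero ((M * K ^ r) ^ q)
      G≢0 = m^n≢0 (M * K ^ r) q {{m*n≢0 M (K ^ r) {{it}} {{m^n≢0 K r}}}}
      X≢0 : NonZero X
      X≢0 = m*n≢0 (length fam) ((M * K ^ r) ^ q)
      w₂≢0 : NonZero w₂
      w₂≢0 = m*n≢0 Z N
      w₃≢0 : NonZero w₃
      w₃≢0 = m*n≢0 ℓ w₂
      u₁≢0 : NonZero u₁
      u₁≢0 = m*n≢0 (suc q) (M ^ q * wC) {{_}} {{m*n≢0 (M ^ q) wC {{m^n≢0 M q}}}}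
      u₂≢0 : NonZero u₂
      u₂≢0 = m*n≢0 X w₃
      u₃≢0 : NonZero u₃
      u₃≢0 = m*n≢0 Z u₂
      U≢0 : NonZero U
      U≢0 = unit≢0 Z N ℓ s X

    constants : M * suc b′ ≤ Z × size (encodeℕ b′) ≤ Z × size (encFam fam) ≤ Z × length fam ≤ Z × r ≤ Z × size (encodeℕ r) ≤ Z × K ≤ Z
    constants = summands (M * suc b′) (size (encodeℕ b′)) (size (encFam fam)) (length fam) r (size (encodeℕ r)) K

    M≤ = proj₁ constants
    sizeb≤ = proj₁ (proj₂ constants)
    sizefam≤ = proj₁ (proj₂ (proj₂ constants))
    fam≤ = proj₁ (proj₂ (proj₂ (proj₂ constants)))
    r≤ = proj₁ (proj₂ (proj₂ (proj₂ (proj₂ constants))))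
    sizer≤ = proj₁ (proj₂ (proj₂ (proj₂ (proj₂ (proj₂ constants)))))
    k≤ = proj₂ (proj₂ (proj₂ (proj₂ (proj₂ (proj₂ constants)))))

    Mq≤X : M ^ q ≤ X
    Mq≤X = ≤-trans (^-monoˡ-≤ q (m≤m*n M (K ^ r) {{m^n≢0 K r}})) (m≤n*m ((M * K ^ r) ^ q) (length fam))

    q≤ : suc q ≤ N * Z
    q≤ = blocks≤ b′ n {M} {Z} M≤

    total : length fam * M ^ q * (K ^ r) ^ q ≤ X
    total = ≤-reflexive (trans (*-assoc (length fam) (M ^ q) ((K ^ r) ^ q)) (cong (length fam *_) (sym (^-distribʳ-* q M (K ^ r)))))

    within-Z : ∀ {a} → a ≤ Z → a ≤ Z * N
    within-Z le = ≤-trans le (m≤m*n Z N)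

    nwC≤U : n * wC ≤ U
    nwC≤U = ≤-trans (*-monoˡ-≤ wC (n≤1+n n)) (unit₁ Z N ℓ s X)

    famu₁≤U : length fam * u₁ ≤ U
    famu₁≤U = ≤-trans (*-mono-≤ fam≤ (*-mono-≤ q≤ (*-monoˡ-≤ wC Mq≤X))) (unit₂ Z N ℓ s X)

    qu₃≤U : q * u₃ ≤ U
    qu₃≤U = ≤-trans (*-monoˡ-≤ u₃ (≤-trans (n≤1+n q) q≤)) (unit₃ Z N ℓ s X)

    s≤U : s ≤ U
    s≤U = ≤-trans (unit₇ Z N ℓ s X) (≤-trans (m≤n*m (X * (s * N)) s) (unit₆ Z N ℓ s X))

    instance
      sN≢0 : NonZero (s * N)
      sN≢0 = m*n≢0 s N
      XsN≢0 : NonZero (X * (s * N))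
      XsN≢0 = m*n≢0 X (s * N)

    C : List (Vec Bool n)
    C = candidates fam r q F

    length-C : length C ≤ X
    length-C = length-candidates b′ r M fam (family-lengths code) kF q total

    eval-C : EvalIn U (node (encodeℕ n) (encF F) ∷ []) (candidatesE b′ r fam) (encL C) 1100
    eval-C = eval-candidates b′ r M fam (family-lengths code) kF {X} {w₁} {w₂} {w₃} {wC} {u₁} {u₂} {u₃} {U}
      (n≤1+n n) (*-monoˡ-≤ N k≤) (m≤n*m w₂ ℓ) (*-monoˡ-≤ w₂ (n≤1+n (length F)))
      (within-Z M≤) (m≤n*m N Z) (within-Z sizeb≤) nwC≤U total ≤-refl famu₁≤U (≤-trans sizefam≤ (unit₅ Z N ℓ s X))
      ≤-refl (*-monoˡ-≤ u₂ r≤) (≤-trans sizer≤ (m≤m*n Z u₂)) qu₃≤U (unit₈ Z N ℓ s X)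

  evaluates : EvalIn (unit (constant code) (suc n) (suc (length F)) s (length (family code) * (length words * suc h ^ r) ^ blocks b′ n))
                (encodeInput F s ∷ []) (mainE b′ r (family code)) (encL (disperse n s (candidates (family code) r (blocks b′ n) F))) 2000
  evaluates = eval-main b′ r fam F s eval-C
    (λ z → eval-search {U} {X * (s * N)} {s * N} {w₁} (n≤1+n n) {C} ≤-refl (*-monoˡ-≤ (s * N) length-C) (unit₇ Z N ℓ s X) (unit₄ Z N ℓ s X) (s≤U) (unit₆ Z N ℓ s X) z)

-- From costs to halting and certain success

run-value : ∀ {T P x v} → Eval (x ∷ []) P v T → ∀ ω → run T P x ω ≡ just v
run-value {T} ev ω with t , t≤T , eq ← evals ev T (toList ω) ≤-refl
  rewrite eq | Equivalence.to Bool.T-≡ (≤⇒≤ᵇ t≤T) = refl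

halts : ∀ {T P x v} → Eval (x ∷ []) P v T → HaltsWithin T P x
halts ev ω = subst Is-just (sym (run-value ev ω)) (MaybeAny.just tt)

certain : ∀ {T} {E : Vec Bool T → Set} (E? : Decidable E) → (∀ ω → E ω) → 1ℚ ℚ.- 0ℚ ℚ.≤ Pr E?
certain {T} E? all = ℚ.≤-reflexive (sym (trans
  (cong (λ l → (ℤ.+ l / 2 ^ T) {{m^n≢0 2 T}}) (trans (cong length (filter-all E? (All.universal all (bitVectors T)))) (length-bitVectors T)))
  (n/n≡1 (2 ^ T) {{m^n≢0 2 T}})))

succeeds : ∀ {T P k} {F : CNF n} {s} .{{_ : NonZero s}} {S : Vec (Assignment n) s} →
           Eval (encodeInput F s ∷ []) P (encL (toList S)) T → Good k F s S → ∀ ω → Success P k F s T ω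
succeeds {n = n} {k = k} {F} {s} {S} ev goodS ω =
  subst (λ out → MaybeAny.Any (Good k F s) (out Maybe.>>= decodeOutput n s)) (sym (run-value ev ω))
    (subst (MaybeAny.Any (Good k F s)) (sym (decode-output S)) (MaybeAny.just goodS))

module _ {h : ℕ} (code : BlockCode (suc h)) where
  open BlockCode code

  private
    K φ D : ℕ
    K = suc h
    φ = length (family code)
    D = φ * 2 ^ b′

  -- In the k-th power the exponent per block, (k - 1) b/k, becomes integral: in total it is (k -
  -- 1)(n + c), where `c` is the excess of the last block. Its share is a constant, absorbed into
  -- `D`.
  candidates-bound : ∀ n → (length (family code) * (length words * suc h ^ r) ^ blocks b′ n) ^ suc h ≤
                     (length (family code) * 2 ^ b′) ^ suc h * 2 ^ ((suc h ∸ 1) * n)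
  candidates-bound n = with-blocks (blocks-cover b′ n)
    where
    open ≤-Reasoning
    q : ℕ
    q = blocks b′ n
    with-blocks : (∃[ c ] c ≤ b′ × q * suc b′ ≡ n + c) → (φ * (length words * K ^ r) ^ q) ^ K ≤ D ^ K * 2 ^ (h * n)
    with-blocks (c , c≤ , eq) = begin
      (φ * (length words * K ^ r) ^ q) ^ K ≤⟨ ^-monoˡ-≤ K (*-monoʳ-≤ φ (^-monoˡ-≤ q cost≤)) ⟩
      (φ * (2 ^ (h * groups)) ^ q) ^ K ≡⟨ ^-distribʳ-* K φ ((2 ^ (h * groups)) ^ q) ⟩
      φ ^ K * ((2 ^ (h * groups)) ^ q) ^ K ≡⟨ cong (φ ^ K *_) (trans (cong (_^ K) (^-*-assoc 2 (h * groups) q)) (^-*-assoc 2 (h * groups * q) K)) ⟩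
      φ ^ K * 2 ^ (h * groups * q * K) ≡⟨ cong (λ e → φ ^ K * 2 ^ e) exponent ⟩
      φ ^ K * 2 ^ (h * n + h * c) ≤⟨ *-monoʳ-≤ (φ ^ K) (^-monoʳ-≤ 2 (+-monoʳ-≤ (h * n) (≤-trans (*-mono-≤ (n≤1+n h) c≤) (≤-reflexive (*-comm K b′))))) ⟩
      φ ^ K * 2 ^ (h * n + b′ * K) ≡⟨ cong (φ ^ K *_) (trans (^-distribˡ-+-* 2 (h * n) (b′ * K)) (cong (2 ^ (h * n) *_) (sym (^-*-assoc 2 b′ K)))) ⟩
      φ ^ K * (2 ^ (h * n) * (2 ^ b′) ^ K) ≡⟨ solve 3 (λ a b c → a :* (b :* c) := a :* c :* b) refl (φ ^ K) (2 ^ (h * n)) ((2 ^ b′) ^ K) ⟩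
      φ ^ K * (2 ^ b′) ^ K * 2 ^ (h * n) ≡⟨ cong (_* 2 ^ (h * n)) (sym (^-distribʳ-* K φ (2 ^ b′))) ⟩
      D ^ K * 2 ^ (h * n) ∎
      where
      exponent : h * groups * q * K ≡ h * n + h * c
      exponent = trans (solve 4 (λ h j q K → h :* j :* q :* K := h :* (q :* (K :* j))) refl h groups q K)
        (trans (cong (λ b → h * (q * b)) (sym length≡)) (trans (cong (h *_) eq) (*-distribˡ-+ h n c)))

  -- `poly` uses one number as coefficient and exponent, so both are added. The 3 + c covers N³ and
  -- the length of the formula.
  degree : ℕ → ℕ → ℕ
  degree t c = t * (constant code * constant code * constant code) * suc c * D + (3 + c)

module _ (t Z n f c D : ℕ) where
  open ≤-Reasoning

  private
    N K : ℕ
    N = suc n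
    K = t * (Z * Z * Z) * suc c * D

  polynomial-bound : f ≤ poly c n → t * (Z * Z * Z * (N * N * N) * suc f) * D ≤ poly (K + (3 + c)) n
  polynomial-bound f≤ = begin
    t * (Z * Z * Z * (N * N * N) * suc f) * D ≤⟨ *-monoˡ-≤ D (*-monoʳ-≤ t (*-monoʳ-≤ (Z * Z * Z * (N * N * N)) (+-mono-≤ (>-nonZero⁻¹ (N ^ c) {{m^n≢0 N c}}) f≤))) ⟩
    t * (Z * Z * Z * (N * N * N) * (N ^ c + c * N ^ c)) * D ≡⟨ regroup N (N ^ c) ⟩
    K * N ^ (3 + c) ≤⟨ *-mono-≤ (m≤m+n K (3 + c)) (^-monoʳ-≤ N (m≤n+m (3 + c) K)) ⟩
    (K + (3 + c)) * N ^ (K + (3 + c)) ∎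
    where
    regroup : ∀ N p → t * (Z * Z * Z * (N * N * N) * (p + c * p)) * D ≡ t * (Z * Z * Z) * suc c * D * (N * (N * (N * p)))
    regroup N p = solve 6 (λ t z n c p d → t :* (z :* z :* z :* (n :* n :* n) :* (p :+ c :* p)) :* d := t :* (z :* z :* z) :* (con 1 :+ c) :* d :* (n :* (n :* (n :* p)))) refl t Z N c p D

time-bound : ∀ k n d D B s X t A → B ≡ t * (A * (s * s * s * s) * X) → X ^ k ≤ D ^ k * 2 ^ ((k ∸ 1) * n) → t * A * D ≤ poly d n →
             TimeBound k d n s B
time-bound k n d D B s X t A refl X≤ A≤ = begin
  (t * (A * s⁴ * X)) ^ k ≡⟨ cong (_^ k) (solve 4 (λ t a s x → t :* (a :* s :* x) := t :* a :* s :* x) refl t A s⁴ X) ⟩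
  (t * A * s⁴ * X) ^ k ≡⟨ ^-distribʳ-* k (t * A * s⁴) X ⟩
  (t * A * s⁴) ^ k * X ^ k ≤⟨ *-monoʳ-≤ ((t * A * s⁴) ^ k) X≤ ⟩
  (t * A * s⁴) ^ k * (D ^ k * P) ≡⟨ sym (*-assoc ((t * A * s⁴) ^ k) (D ^ k) P) ⟩
  (t * A * s⁴) ^ k * D ^ k * P ≡⟨ cong (_* P) (sym (^-distribʳ-* k (t * A * s⁴) D)) ⟩
  (t * A * s⁴ * D) ^ k * P ≤⟨ *-monoˡ-≤ P (^-monoˡ-≤ k (begin
    t * A * s⁴ * D ≡⟨ solve 3 (λ a s d → a :* (s :* s :* s :* s) :* d := a :* d :* (s :* (s :* (s :* (s :* con 1))))) refl (t * A) s D ⟩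
    t * A * D * s ^ 4 ≤⟨ *-monoˡ-≤ (s ^ 4) A≤ ⟩
    poly d n * s ^ 4 ∎)) ⟩
  (poly d n * s ^ 4) ^ k * P ∎
  where
  open ≤-Reasoning
  s⁴ P : ℕ
  s⁴ = s * s * s * s
  P = 2 ^ ((k ∸ 1) * n)

module _ (k : ℕ) (P : Program) where

  Computes : (d n : ℕ) (F : CNF n) (s : ℕ) .{{_ : NonZero s}} → Set
  Computes d n F s = Σ[ T ∈ ℕ ] TimeBound k d n s T × (Σ[ L ∈ List (Vec Bool n) ] Eval (encodeInput F s ∷ []) P (encL L) T ×
    (Satisfiable F → ∃[ S ] toList {n = s} S ≡ L × Good k F s S))

  deterministic-success : ∀ {n} (F : CNF n) s .{{_ : NonZero s}} T L → Eval (encodeInput F s ∷ []) P (encL L) T →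
    (∃[ S ] toList {n = s} S ≡ L × Good k F s S) → 1ℚ ℚ.- 0ℚ ℚ.≤ Pr (success? P k F s T)
  deterministic-success F s T L ev (S , refl , goodS) = certain {E = Success P k F s T} (success? P k F s T)
    (succeeds {T = T} {P = P} {k = k} {F = F} {s = s} {S = S} ev goodS)

  from-deterministic : (∀ c → Σ[ d ∈ ℕ ] (∀ n (F : CNF n) s .{{_ : NonZero s}} → IsKCNF k F → length F ≤ poly c n → Computes d n F s)) →
    ∀ (c : ℕ) →
    Σ[ d ∈ ℕ ] Σ[ δ ∈ (ℕ → ℚ) ] Vanishing δ ×
    (∀ (n : ℕ) (F : CNF n) (s : ℕ) .{{_ : NonZero s}} →
    IsKCNF k F → length F ≤ poly c n →
    Σ[ T ∈ ℕ ] TimeBound k d n s T ×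
    HaltsWithin T P (encodeInput F s) ×
    (Satisfiable F → 1ℚ ℚ.- δ n ℚ.≤ Pr (success? P k F s T)))
  -- Every coin sequence succeeds, so the error probability is the zero sequence.
  from-deterministic computes c = proj₁ (computes c) , (λ _ → 0ℚ) , (λ ε 0<ε → 0 , λ _ _ → ℚ.<⇒≤ 0<ε) , λ n F s kF F≤ →
    let T , bound , L , ev , output = proj₂ (computes c) n F s kF F≤ in
    T , bound , halts ev , λ satisfiable → deterministic-success F s T L ev (output satisfiable)

module _ {h : ℕ} (code : BlockCode (suc h)) {n} (F : CNF n) (s : ℕ) where
  open BlockCode code

  private
    C : List (Vec Bool n)
    C = candidates (family code) r (blocks b′ n) F
    q≥ : n ≤ blocks b′ n * suc b′
    q≥ = let e , _ , eq = blocks-cover b′ n in ≤-trans (m≤m+n n e) (≤-reflexive (sym eq))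

  good-output : Satisfiable F → ∃[ S ] toList {n = suc s} S ≡ disperse n (suc s) C × Good (suc h) F (suc s) S
  good-output = disperse-good {h = h} {s = s} {F = F} C (keep-sat F (rounds F (blocks b′ n) r (allCentres n (blocks b′ n) (family code))) [] [])
    (λ satx R → approximates code F satx R (blocks b′ n) q≥)

unit-bound : ∀ k n d D Z N ℓ s X t → X ^ k ≤ D ^ k * 2 ^ ((k ∸ 1) * n) → t * (Z * Z * Z * (N * N * N) * ℓ) * D ≤ poly d n →
             TimeBound k d n s (t * unit Z N ℓ s X)
unit-bound k n d D Z N ℓ s X t = time-bound k n d D (t * unit Z N ℓ s X) s X t (Z * Z * Z * (N * N * N) * ℓ) refl

module _ {h : ℕ} (code : BlockCode (suc h)) (c n : ℕ) (F : CNF n) (kF : IsKCNF (suc h) F) (F≤ : length F ≤ poly c n) where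
  open BlockCode code

  unit-timely : ∀ t s → TimeBound (suc h) (degree code t c) n s
             (t * unit (constant code) (suc n) (suc (length F)) s (length (family code) * (length words * suc h ^ r) ^ blocks b′ n))
  unit-timely t s = unit-bound (suc h) n (degree code t c) (length (family code) * 2 ^ b′) (constant code) (suc n) (suc (length F)) s
    (length (family code) * (length words * suc h ^ r) ^ blocks b′ n) t (candidates-bound code n)
    (polynomial-bound t (constant code) n (length F) c (length (family code) * 2 ^ b′) F≤)

  computes : ∀ s .{{_ : NonZero s}} → Computes (suc h) (mainE b′ r (family code)) (degree code 2000 c) n F s
  computes zero    {{()}}
  computes (suc s) = _ , unit-timely 2000 (suc s) , _ , raw (evaluates code F kF (suc s)) , good-output code F s

theorem15 : ∀ (k : ℕ) → 3 ≤ k →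
    Σ[ P ∈ Program ]
    (∀ (c : ℕ) →
    Σ[ d ∈ ℕ ] Σ[ δ ∈ (ℕ → ℚ) ] Vanishing δ ×
    (∀ (n : ℕ) (F : CNF n) (s : ℕ) .{{_ : NonZero s}} →
    IsKCNF k F → length F ≤ poly c n →
    Σ[ T ∈ ℕ ] TimeBound k d n s T ×
    HaltsWithin T P (encodeInput F s) ×
    (Satisfiable F → 1ℚ ℚ.- δ n ℚ.≤ Pr (success? P k F s T))))
theorem15 (suc h) 3≤k = program , from-deterministic (suc h) program (λ c → degree code 2000 c , λ n F s kF F≤ → computes code c n F kF F≤ s)
  where
  code : BlockCode (suc h)
  code = blockCode (suc h) 3≤k
  program : Program
  program = mainE (BlockCode.b′ code) (BlockCode.r code) (family code)
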